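{- Let $p \geq 7$ be a prime and let $(r_1, r_2, q)$ be one of the six tuples \[ \left(\tfrac{1}{2}, \tfrac{1}{2}, \tfrac{4}{3}\right), \left(\tfrac{1}{2}, \tfrac{1}{2}, \tfrac{7}{6}\right), \left(\tfrac{1}{2}, \tfrac{1}{3}, \tfrac{7}{6}\right), \left(\tfrac{1}{2}, \tfrac{1}{3}, \tfrac{5}{4}\right), \left(\tfrac{1}{2}, \tfrac{1}{4}, \tfrac{7}{6}\right), \left(\tfrac{1}{2}, \tfrac{1}{2}, \tfrac{5}{4}\right). \] Let $\alpha = \{r_1, 1-r_1, r_2, 1-r_2\}$ and $\beta = \{1,1,q,2-q\}$. Then for all integers $s \geq 0$, \[ p^{s+1} F_{s+1}(\alpha,\beta) \equiv p^s F_s(\alpha,\beta)\cdot pF_1(\alpha,\beta) \pmod{p^3}, \] where the congruence means that the difference of the two sides (rational numbers) has $p$-adic valuation at least $3$.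
   Context: For a rational $a$ and integer $k \ge 0$, $(a)_k = a(a+1)\cdots(a+k-1)$ with $(a)_0=1$. For multisets $\alpha=\{a_1,a_2,a_3,a_4\}$ and $\beta=\{b_1,b_2,b_3,b_4\}$ of rationals and an integer $s \ge 0$, \[F_s(\alpha,\beta) = \sum_{k=0}^{p^s-1} \frac{(a_1)_k(a_2)_k(a_3)_k(a_4)_k}{(b_1)_k(b_2)_k(b_3)_k(b_4)_k}.\] With $\beta=\{1,1,q,2-q\}$ this is the truncation at $p^s-1$ of ${}_4F_3\left[\begin{smallmatrix} r_1 & 1-r_1 & r_2 & 1-r_2\\ & 1 & q & 2-q\end{smallmatrix}; 1\right]$. In particular $F_0(\alpha,\beta)=1$. -}

module Defs where

open import Data.Nat as ℕ using (ℕ; zero; suc; _^_)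
open import Data.Nat.Divisibility using (_∣_)
open import Data.Integer as ℤ using (ℤ; +_)
open import Data.Rational using (ℚ; 0ℚ; 1ℚ; _+_; _*_; _-_; _÷_; _/_; ≢-nonZero)
open import Data.Rational.Properties using (_≟_)
open import Data.Product using (Σ; _×_)
open import Data.List using (List; _∷_; [])
open import Relation.Nullary using (¬_; yes; no)
open import Relation.Binary.PropositionalEquality using (_≡_; _≢_)

ι : ℕ → ℚ
ι n = + n / 1

poch : ℚ → ℕ → ℚ
poch a zero    = 1ℚ
poch a (suc k) = poch a k * (a + ι k)

-- division on ℚ, total: returns 0 when the divisor is 0
-- (never happens for the parameters considered: denominators are nonzero)
divℚ : ℚ → ℚ → ℚ
divℚ x y with y ≟ 0ℚ
... | yes _  = 0ℚ
... | no y≢0 = _÷_ x y {{≢-nonZero y≢0}}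

sumTo : ℕ → (ℕ → ℚ) → ℚ
sumTo zero    f = 0ℚ
sumTo (suc n) f = sumTo n f + f n

-- multisets of four rationals (as 4-tuples)
record Quad : Set where
  constructor quad
  field
    x₁ x₂ x₃ x₄ : ℚ

term : Quad → Quad → ℕ → ℚ
term (quad a₁ a₂ a₃ a₄) (quad b₁ b₂ b₃ b₄) k =
  divℚ (poch a₁ k * poch a₂ k * poch a₃ k * poch a₄ k)
       (poch b₁ k * poch b₂ k * poch b₃ k * poch b₄ k)

F : ℕ → ℕ → Quad → Quad → ℚ
F p s α β = sumTo (p ^ s) (term α β)

-- x has p-adic valuation ≥ m: x = p^m · a / b with a ∈ ℤ, b ∈ ℕ, b ≠ 0, p ∤ b
-- (x = 0 is included, with a = 0)
vAtLeast : ℕ → ℕ → ℚ → Set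
vAtLeast p m x = Σ ℤ λ a → Σ ℕ λ b → (b ≢ 0) × (¬ (p ∣ b)) × (x * ι b ≡ ι (p ^ m) * (a / 1))

_≡[_^_] : ℚ → ℕ → ℕ → ℚ → Set
(x ≡[ p ^ m ]) y = vAtLeast p m (x - y)

record Triple : Set where
  constructor triple
  field
    r₁ r₂ q : ℚ

half third quarter : ℚ
half    = + 1 / 2
third   = + 1 / 3
quarter = + 1 / 4

sixTuples : List Triple
sixTuples =
  triple half half    (+ 4 / 3) ∷
  triple half half    (+ 7 / 6) ∷
  triple half third   (+ 7 / 6) ∷
  triple half third   (+ 5 / 4) ∷
  triple half quarter (+ 7 / 6) ∷
  triple half half    (+ 5 / 4) ∷ []

alpha : Triple → Quad
alpha (triple r₁ r₂ q) = quad r₁ (1ℚ - r₁) r₂ (1ℚ - r₂)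

beta : Triple → Quad
beta (triple r₁ r₂ q) = quad 1ℚ 1ℚ q (ι 2 - q)

{-# OPTIONS --safe #-}

-- Write p = 2m + 1 and q = 1 + γ, κ = p r₂, θ = p γ. There are e, g with κ - e ∈ {r₂, 1 - r₂} and θ - g ∈ {γ, - γ}.
-- For k = a + x with x = p b, the quotient p · term(k) / term(b) is divisible by p³ if m < a < p (up to a
-- denominator 1 - γ + b, harmless after multiplication by p^s term(b)). For a ≤ m, blocks of p consecutive
-- factors of a Pochhammer symbol telescope modulo p³ by Wolstenholme's theorem, so that the quotient is
-- a constant times a rational function v a x, and the theorem becomes Σ v a (p b) ≡ Σ v a 0 (mod p³).
--
-- Since r₁ = 1/2 = 1 - r₁, the v a may be replaced, for any h ∈ pℤ₍ₚ₎ and up to factors that do not matter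
-- modulo p³, by (x + h)(x + κ) R(a + x), where
--   R(t) = Π_{l=1}^m (t+l-h) Π_{l=1}^e (t+l-κ) Π_{l=0}^{g-1} (t-l+θ)
--            / ( Π_{l=0}^m (t-l+h) Π_{l=0}^e (t-l+κ) Π_{l=1}^g (t+l-θ) ).
-- As R has degree -2, its residues add up to zero. Those at θ - l are divisible by p², and those at a - h
-- and a - κ are the values at x = - h and x = - κ divided by ±(κ - h). Hence Σ v a (- h) ≡ Σ v a (- κ) (mod p³);
-- the choices h = - p b and h = 0 compare both sums in question with the same one.

module Submission where

open import Algebra.Bundles using (CommutativeRing)
import Algebra.Solver.Ring as RingSolver
import Algebra.Solver.Ring.AlmostCommutativeRing as ACR
open import Algebra.Structures using (IsCommutativeRing)
open import Data.Empty using (⊥-elim)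
open import Data.Integer as ℤ using (ℤ; -[1+_])
import Data.Integer.Divisibility.Signed as ℤ∣
import Data.Integer.Properties as ℤₚ
open import Data.List using (List; []; _∷_; _++_; length)
open import Data.List.Membership.Propositional using (_∈_)
open import Data.List.Properties using (length-++)
open import Data.List.Relation.Unary.All as All using (All; []; _∷_)
import Data.List.Relation.Unary.All.Properties as Allₚ
open import Data.List.Relation.Unary.AllPairs using ([]; _∷_)
import Data.List.Relation.Unary.AllPairs.Properties as AllPairsₚ
open import Data.List.Relation.Unary.Any using (here; there)
open import Data.List.Relation.Unary.Unique.Propositional using (Unique)
open import Data.Maybe using (Maybe; just; nothing)
open import Data.Nat as ℕ using (ℕ; zero; suc; _≤_; _<_; _^_; z≤n; s≤s)
import Data.Nat.Divisibility as ℕ∣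
open ℕ∣ using (_∣_)
import Data.Nat.DivMod as ℕ÷
open import Data.Nat.Primality using (Prime; euclidsLemma; prime⇒nonTrivial; prime⇒irreducible)
import Data.Nat.Properties as ℕₚ
open import Data.Product using (Σ; ∃; _×_; _,_)
import Data.Rational as ℚ
import Data.Rational.Properties as ℚₚ
import Data.Rational.Unnormalised as ℚᵘ
import Data.Rational.Unnormalised.Properties as ℚᵘₚ
open import Data.Sum using (_⊎_; inj₁; inj₂)
open import Relation.Binary.Definitions using (tri<; tri≈; tri>)
open import Relation.Binary.PropositionalEquality
open import Relation.Nullary using (¬_; Dec; yes; no)
open ≡-Reasoning

-- The summands enter only through differences v a x - v a y with x, y ∈ pℤ₍ₚ₎, and these are
-- divisible by p. A factor that is 1 modulo p² and does not depend on x modulo p³ therefore leaves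
-- such a difference unchanged modulo p³. Ratios of Pochhammer symbols that are even in a
-- perturbation δ ∈ pℤ₍ₚ₎ are factors of this kind, since only δ² occurs in them. The pair belonging
-- to r₁ = 1/2 is symmetric about p/2, so moving its centre produces such an even ratio. This frees
-- h, while κ stays tied to r₂.
--
-- The inequalities g ≤ e ≤ m make both h and κ contribute a factor p to the residues at θ - l. They
-- hold because all six tuples have r₂ = 1/d and γ = 1/d′ with 2 ≤ d < d′ and p ≡ ±1 modulo d and
-- d′.
--
-- The remaining obstacle is the denominator 1 - γ + b, which may contain high powers of p. For this
-- reason the induction on the base-p digits of b shows that even p^s term(b) / (1 - γ + b) is
-- p-integral for b < p^s. In each step the new divisor 1 - γ + k is a unit for all but one last
-- digit, and for that digit the quotient p · term(k) / term(b) makes up for it.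

record CharZeroField : Set₁ where
  infixl 6 _+_
  infixl 7 _*_
  infix 8 -_
  field
    K       : Set
    _+_ _*_ : K → K → K
    -_      : K → K
    ⟦_⟧     : ℤ → K

  0# : K
  0# = ⟦ ℤ.+ 0 ⟧

  1# : K
  1# = ⟦ ℤ.+ 1 ⟧

  field
    isCommutativeRing : IsCommutativeRing _≡_ _+_ _*_ -_ 0# 1#
    _≟_   : (x y : K) → Dec (x ≡ y)
    inv   : K → K
    -- With 1/0 = 0, inversion is multiplicative on all of K (`inv-*`), so quotients of long
    -- products can be regrouped without a nonvanishing proof for each factor.
    inv-0 : inv 0# ≡ 0#
    inv-r : ∀ {x} → x ≢ 0# → x * inv x ≡ 1#
    ⟦⟧-+  : ∀ i j → ⟦ i ℤ.+ j ⟧ ≡ ⟦ i ⟧ + ⟦ j ⟧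
    ⟦⟧-*  : ∀ i j → ⟦ i ℤ.* j ⟧ ≡ ⟦ i ⟧ * ⟦ j ⟧
    ⟦⟧-neg : ∀ i → ⟦ ℤ.- i ⟧ ≡ - ⟦ i ⟧
    ⟦⟧≡0  : ∀ i → ⟦ i ⟧ ≡ 0# → i ≡ ℤ.+ 0

-- Field arithmetic, Pochhammer symbols and finite sums

module FieldAlgebra (F : CharZeroField) where
  open CharZeroField F
  open IsCommutativeRing isCommutativeRing public
    using (+-identityˡ; +-identityʳ; *-identityˡ; *-identityʳ; +-comm; *-comm; +-assoc; *-assoc; -‿inverseʳ; zeroˡ; zeroʳ)

  infixl 6 _-_
  _-_ : K → K → K
  x - y = x + - y

  private
    commutativeRing : CommutativeRing _ _
    commutativeRing = record { isCommutativeRing = isCommutativeRing }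

    acr = ACR.fromCommutativeRing commutativeRing

    morphism : CommutativeRing.rawRing ℤₚ.+-*-commutativeRing ACR.-Raw-AlmostCommutative⟶ acr
    morphism = record
      { ⟦_⟧ = ⟦_⟧ ; +-homo = ⟦⟧-+ ; *-homo = ⟦⟧-* ; -‿homo = ⟦⟧-neg ; 0-homo = refl ; 1-homo = refl }

    coeff≟ : ∀ i j → Maybe (⟦ i ⟧ ≡ ⟦ j ⟧)
    coeff≟ i j with i ℤ.≟ j
    ... | yes i≡j = just (cong ⟦_⟧ i≡j)
    ... | no  _   = nothing

  open RingSolver (CommutativeRing.rawRing ℤₚ.+-*-commutativeRing) acr morphism coeff≟ public
    using (Polynomial; solve; _:=_; _:+_; _:*_; _:-_; :-_; con)

  :0 : ∀ {n} → Polynomial n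
  :0 = con (ℤ.+ 0)

  :1 : ∀ {n} → Polynomial n
  :1 = con (ℤ.+ 1)

  ι : ℕ → K
  ι n = ⟦ ℤ.+ n ⟧

  ι-+ : ∀ m n → ι (m ℕ.+ n) ≡ ι m + ι n
  ι-+ m n = ⟦⟧-+ (ℤ.+ m) (ℤ.+ n)

  ι-suc : ∀ n → ι (suc n) ≡ 1# + ι n
  ι-suc n = ι-+ 1 n

  ι-* : ∀ m n → ι (m ℕ.* n) ≡ ι m * ι n
  ι-* m n = trans (cong ⟦_⟧ (ℤₚ.pos-* m n)) (⟦⟧-* (ℤ.+ m) (ℤ.+ n))

  ι≢0 : ∀ n → ι (suc n) ≢ 0#
  ι≢0 n eq with ⟦⟧≡0 (ℤ.+ suc n) eq
  ... | ()

  1≢0 : 1# ≢ 0#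
  1≢0 = ι≢0 0

  inv-l : ∀ {x} → x ≢ 0# → inv x * x ≡ 1#
  inv-l {x} x≢0 = trans (*-comm (inv x) x) (inv-r x≢0)

  *-cancelʳ : ∀ {x y} z → z ≢ 0# → x * z ≡ y * z → x ≡ y
  *-cancelʳ {x} {y} z z≢0 eq = begin
    x               ≡⟨ trans (cong (x *_) (inv-r z≢0)) (*-identityʳ x) ⟨
    x * (z * inv z) ≡⟨ *-assoc x z (inv z) ⟨
    x * z * inv z   ≡⟨ cong (_* inv z) eq ⟩
    y * z * inv z   ≡⟨ *-assoc y z (inv z) ⟩
    y * (z * inv z) ≡⟨ trans (cong (y *_) (inv-r z≢0)) (*-identityʳ y) ⟩
    y               ∎

  *≡0 : ∀ {x y} → x ≢ 0# → x * y ≡ 0# → y ≡ 0#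
  *≡0 {x} {y} x≢0 eq = *-cancelʳ x x≢0 (trans (*-comm y x) (trans eq (sym (zeroˡ x))))

  *-nonzero : ∀ {x y} → x ≢ 0# → y ≢ 0# → x * y ≢ 0#
  *-nonzero x≢0 y≢0 eq = y≢0 (*≡0 x≢0 eq)

  factorˡ-nonzero : ∀ {x y} → x * y ≢ 0# → x ≢ 0#
  factorˡ-nonzero {x} {y} xy≢0 refl = xy≢0 (zeroˡ y)

  inv-unique : ∀ {x y} → x * y ≡ 1# → inv x ≡ y
  inv-unique {x} {y} eq = *-cancelʳ x x≢0 (trans (inv-l x≢0) (trans (sym eq) (*-comm x y)))
    where
    x≢0 : x ≢ 0#
    x≢0 refl = 1≢0 (trans (sym eq) (zeroˡ y))

  inv-* : ∀ x y → inv (x * y) ≡ inv x * inv y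
  inv-* x y with x ≟ 0# | y ≟ 0#
  ... | yes refl | _ = trans (cong inv (zeroˡ y)) (trans inv-0 (sym (trans (cong (_* inv y) inv-0) (zeroˡ _))))
  ... | no _ | yes refl = trans (cong inv (zeroʳ x)) (trans inv-0 (sym (trans (cong (inv x *_) inv-0) (zeroʳ _))))
  ... | no x≢0 | no y≢0 = inv-unique (begin
    x * y * (inv x * inv y)     ≡⟨ solve 4 (λ x y a b → x :* y :* (a :* b) := (x :* a) :* (y :* b)) refl x y (inv x) (inv y) ⟩
    (x * inv x) * (y * inv y)   ≡⟨ cong₂ _*_ (inv-r x≢0) (inv-r y≢0) ⟩
    1# * 1#                     ≡⟨ *-identityˡ 1# ⟩
    1# ∎)

  inv-1 : inv 1# ≡ 1#
  inv-1 = inv-unique (*-identityˡ 1#)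

  inv-nonzero : ∀ {x} → x ≢ 0# → inv x ≢ 0#
  inv-nonzero {x} x≢0 eq = 1≢0 (trans (sym (inv-r x≢0)) (trans (cong (x *_) eq) (zeroʳ x)))

  inv-inv : ∀ {x} → x ≢ 0# → inv (inv x) ≡ x
  inv-inv x≢0 = inv-unique (inv-l x≢0)

  fraction-≡ : ∀ {a b c d} → b ≢ 0# → d ≢ 0# → a * d ≡ c * b → a * inv b ≡ c * inv d
  fraction-≡ {a} {b} {c} {d} b≢0 d≢0 eq = *-cancelʳ (b * d) (*-nonzero b≢0 d≢0) (begin
    a * inv b * (b * d)   ≡⟨ solve 4 (λ a i b d → a :* i :* (b :* d) := a :* d :* (i :* b)) refl a (inv b) b d ⟩
    a * d * (inv b * b)   ≡⟨ cong₂ _*_ eq (trans (inv-l b≢0) (sym (inv-l d≢0))) ⟩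
    c * b * (inv d * d)   ≡⟨ solve 4 (λ c b i d → c :* b :* (i :* d) := c :* i :* (b :* d)) refl c b (inv d) d ⟩
    c * inv d * (b * d)   ∎)

  difference-nonzero : ∀ {x y} → x ≢ y → x - y ≢ 0#
  difference-nonzero {x} {y} x≢y eq = x≢y (begin
    x          ≡⟨ solve 2 (λ x y → x := x :- y :+ y) refl x y ⟩
    x - y + y  ≡⟨ cong (_+ y) eq ⟩
    0# + y     ≡⟨ +-identityˡ y ⟩
    y          ∎)

  poch : K → ℕ → K
  poch a zero    = 1#
  poch a (suc k) = poch a k * (a + ι k)

  poch-+ : ∀ a i j → poch a (i ℕ.+ j) ≡ poch a i * poch (a + ι i) j
  poch-+ a i zero = trans (cong (poch a) (ℕₚ.+-identityʳ i)) (sym (*-identityʳ _))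
  poch-+ a i (suc j) = begin
    poch a (i ℕ.+ suc j)                               ≡⟨ cong (poch a) (ℕₚ.+-suc i j) ⟩
    poch a (i ℕ.+ j) * (a + ι (i ℕ.+ j))               ≡⟨ cong₂ _*_ (poch-+ a i j) (trans (cong (a +_) (ι-+ i j)) (sym (+-assoc a (ι i) (ι j)))) ⟩
    poch a i * poch (a + ι i) j * (a + ι i + ι j)      ≡⟨ *-assoc _ _ _ ⟩
    poch a i * (poch (a + ι i) j * (a + ι i + ι j))    ∎

  poch-1 : ∀ a → poch a 1 ≡ a
  poch-1 a = trans (*-identityˡ _) (+-identityʳ a)

  poch-suc : ∀ a n → poch a (suc n) ≡ a * poch (1# + a) n
  poch-suc a n = trans (poch-+ a 1 n) (cong₂ _*_ (poch-1 a) (cong (λ t → poch t n) (+-comm a 1#)))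

  sumTo : ℕ → (ℕ → K) → K
  sumTo zero    f = 0#
  sumTo (suc n) f = sumTo n f + f n

  sumTo-cong : ∀ n {f f′ : ℕ → K} → (∀ i → i < n → f i ≡ f′ i) → sumTo n f ≡ sumTo n f′
  sumTo-cong zero eq = refl
  sumTo-cong (suc n) eq = cong₂ _+_ (sumTo-cong n (λ i i<n → eq i (ℕₚ.m<n⇒m<1+n i<n))) (eq n ℕₚ.≤-refl)

  sumTo-+ : ∀ m n f → sumTo (m ℕ.+ n) f ≡ sumTo m f + sumTo n (λ i → f (m ℕ.+ i))
  sumTo-+ m zero f = trans (cong (λ t → sumTo t f) (ℕₚ.+-identityʳ m)) (sym (+-identityʳ _))
  sumTo-+ m (suc n) f = begin
    sumTo (m ℕ.+ suc n) f ≡⟨ cong (λ t → sumTo t f) (ℕₚ.+-suc m n) ⟩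
    sumTo (m ℕ.+ n) f + f (m ℕ.+ n) ≡⟨ cong (_+ f (m ℕ.+ n)) (sumTo-+ m n f) ⟩
    sumTo m f + sumTo n (λ i → f (m ℕ.+ i)) + f (m ℕ.+ n) ≡⟨ +-assoc _ _ _ ⟩
    sumTo m f + (sumTo n (λ i → f (m ℕ.+ i)) + f (m ℕ.+ n)) ∎

  sumTo-*ˡ : ∀ n c f → c * sumTo n f ≡ sumTo n (λ i → c * f i)
  sumTo-*ˡ zero c f = zeroʳ c
  sumTo-*ˡ (suc n) c f = trans
    (solve 3 (λ c s x → c :* (s :+ x) := c :* s :+ c :* x) refl c (sumTo n f) (f n))
    (cong (_+ c * f n) (sumTo-*ˡ n c f))

  sumTo-distrib-- : ∀ n f f′ → sumTo n f - sumTo n f′ ≡ sumTo n (λ i → f i - f′ i)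
  sumTo-distrib-- zero f f′ = -‿inverseʳ 0#
  sumTo-distrib-- (suc n) f f′ = trans
    (solve 4 (λ s x s′ x′ → (s :+ x) :- (s′ :+ x′) := (s :- s′) :+ (x :- x′)) refl (sumTo n f) (f n) (sumTo n f′) (f′ n))
    (cong (_+ (f n - f′ n)) (sumTo-distrib-- n f f′))

  sumTo-* : ∀ m n f → sumTo (m ℕ.* n) f ≡ sumTo m (λ j → sumTo n (λ i → f (i ℕ.+ j ℕ.* n)))
  sumTo-* zero n f = refl
  sumTo-* (suc m) n f = begin
    sumTo (n ℕ.+ m ℕ.* n) f ≡⟨ cong (λ t → sumTo t f) (ℕₚ.+-comm n (m ℕ.* n)) ⟩
    sumTo (m ℕ.* n ℕ.+ n) f ≡⟨ sumTo-+ (m ℕ.* n) n f ⟩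
    sumTo (m ℕ.* n) f + sumTo n (λ i → f (m ℕ.* n ℕ.+ i))
      ≡⟨ cong₂ _+_ (sumTo-* m n f) (sumTo-cong n (λ i _ → cong f (ℕₚ.+-comm (m ℕ.* n) i))) ⟩
    sumTo m (λ j → sumTo n (λ i → f (i ℕ.+ j ℕ.* n))) + sumTo n (λ i → f (i ℕ.+ m ℕ.* n)) ∎

  sumTo-reverse : ∀ n f → sumTo n f ≡ sumTo n (λ i → f (n ℕ.∸ suc i))
  sumTo-reverse zero f = refl
  sumTo-reverse (suc n) f = begin
    sumTo n f + f n ≡⟨ +-comm _ _ ⟩
    f n + sumTo n f ≡⟨ cong₂ _+_ (sym (+-identityˡ (f n))) (sumTo-reverse n f) ⟩
    0# + f n + sumTo n (λ i → f (n ℕ.∸ suc i)) ≡⟨ sumTo-+ 1 n (λ i → f (n ℕ.∸ i)) ⟨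
    sumTo (suc n) (λ i → f (n ℕ.∸ i)) ∎

-- Residues of rational functions with simple poles

module ResidueSums (F : CharZeroField) where
  open CharZeroField F
  open FieldAlgebra F

  prodL : K → List K → K
  prodL t []      = 1#
  prodL t (z ∷ Z) = (t - z) * prodL t Z

  -- The sum of f(z) / Π (z - z′) over the nodes z, i.e. the divided difference of f.
  residueSum : (K → K) → List K → K
  residueSum f []      = 0#
  residueSum f (z ∷ Z) = f z * inv (prodL z Z) + residueSum (λ t → f t * inv (t - z)) Z

  residueSum-cong : ∀ {f f′} Z → All (λ z → f z ≡ f′ z) Z → residueSum f Z ≡ residueSum f′ Z
  residueSum-cong [] [] = refl
  residueSum-cong (z ∷ Z) (eq ∷ eqs) =
    cong₂ _+_ (cong (_* inv (prodL z Z)) eq) (residueSum-cong Z (All.map (λ {t} e → cong (_* inv (t - z)) e) eqs))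

  residueSum-ext : ∀ {f f′} → (∀ t → f t ≡ f′ t) → ∀ Z → residueSum f Z ≡ residueSum f′ Z
  residueSum-ext eq Z = residueSum-cong Z (All.universal eq Z)

  residueSum-linear : ∀ f f′ c Z → residueSum (λ t → f t + c * f′ t) Z ≡ residueSum f Z + c * residueSum f′ Z
  residueSum-linear f f′ c [] = solve 1 (λ c → :0 := :0 :+ c :* :0) refl c
  residueSum-linear f f′ c (z ∷ Z) = begin
    (f z + c * f′ z) * i + residueSum (λ t → (f t + c * f′ t) * inv (t - z)) Z
      ≡⟨ cong ((f z + c * f′ z) * i +_) (trans
           (residueSum-ext (λ t → solve 4 (λ x c y i → (x :+ c :* y) :* i := x :* i :+ c :* (y :* i)) refl (f t) c (f′ t) (inv (t - z))) Z)
           (residueSum-linear (λ t → f t * inv (t - z)) (λ t → f′ t * inv (t - z)) c Z)) ⟩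
    (f z + c * f′ z) * i + (r + c * r′)
      ≡⟨ solve 6 (λ x c y i r r′ → (x :+ c :* y) :* i :+ (r :+ c :* r′) := (x :* i :+ r) :+ c :* (y :* i :+ r′)) refl (f z) c (f′ z) i r r′ ⟩
    (f z * i + r) + c * (f′ z * i + r′) ∎
    where
    i = inv (prodL z Z)
    r = residueSum (λ t → f t * inv (t - z)) Z
    r′ = residueSum (λ t → f′ t * inv (t - z)) Z

  residueSum-swap : ∀ f z w Z → residueSum f (z ∷ w ∷ Z) ≡ residueSum f (w ∷ z ∷ Z)
  residueSum-swap f z w Z = begin
    f z * inv ((z - w) * prodL z Z) + (f w * inv (w - z) * inv (prodL w Z) + residueSum (λ t → f t * inv (t - z) * inv (t - w)) Z)
      ≡⟨ cong₂ (λ a r → f z * a + (f w * inv (w - z) * inv (prodL w Z) + r)) (inv-* _ _)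
           (residueSum-ext (λ t → solve 3 (λ a b c → a :* b :* c := a :* c :* b) refl (f t) (inv (t - z)) (inv (t - w))) Z) ⟩
    f z * (inv (z - w) * inv (prodL z Z)) + (f w * inv (w - z) * inv (prodL w Z) + residueSum (λ t → f t * inv (t - w) * inv (t - z)) Z)
      ≡⟨ solve 7 (λ fz fw a b p q r → fz :* (a :* p) :+ (fw :* b :* q :+ r) := fw :* (b :* q) :+ (fz :* a :* p :+ r)) refl
           (f z) (f w) (inv (z - w)) (inv (w - z)) (inv (prodL z Z)) (inv (prodL w Z)) _ ⟩
    f w * (inv (w - z) * inv (prodL w Z)) + (f z * inv (z - w) * inv (prodL z Z) + residueSum (λ t → f t * inv (t - w) * inv (t - z)) Z)
      ≡⟨ cong (λ a → f w * a + (f z * inv (z - w) * inv (prodL z Z) + residueSum (λ t → f t * inv (t - w) * inv (t - z)) Z)) (inv-* _ _) ⟨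
    residueSum f (w ∷ z ∷ Z) ∎

  -- A zero of the numerator at the node z kills the residue there and cancels the factor 1/(t - z)
  -- at the other nodes, all different from z.
  residueSum-cancel : ∀ f z Z → All (z ≢_) Z → residueSum (λ t → (t - z) * f t) (z ∷ Z) ≡ residueSum f Z
  residueSum-cancel f z Z z≢Z = begin
    (z - z) * f z * inv (prodL z Z) + residueSum (λ t → (t - z) * f t * inv (t - z)) Z
      ≡⟨ cong₂ _+_ (solve 3 (λ z f i → (z :- z) :* f :* i := :0) refl z (f z) (inv (prodL z Z)))
           (residueSum-cong Z (All.map cancel z≢Z)) ⟩
    0# + residueSum f Z ≡⟨ +-identityˡ _ ⟩
    residueSum f Z ∎
    where
    cancel : ∀ {t} → z ≢ t → (t - z) * f t * inv (t - z) ≡ f t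
    cancel {t} z≢t = begin
      (t - z) * f t * inv (t - z)   ≡⟨ solve 3 (λ d f i → d :* f :* i := f :* (d :* i)) refl (t - z) (f t) (inv (t - z)) ⟩
      f t * ((t - z) * inv (t - z)) ≡⟨ cong (f t *_) (inv-r (difference-nonzero (λ eq → z≢t (sym eq)))) ⟩
      f t * 1#                      ≡⟨ *-identityʳ _ ⟩
      f t ∎

  -- From t - c = (t - z) + (z - c): the first part cancels the node z, the second is constant. Both
  -- resulting sums have a numerator with one root less.
  residueSum-step : ∀ f c z Z → All (z ≢_) Z →
    residueSum (λ t → (t - c) * f t) (z ∷ Z) ≡ residueSum f Z + (z - c) * residueSum f (z ∷ Z)
  residueSum-step f c z Z z≢Z = begin
    residueSum (λ t → (t - c) * f t) (z ∷ Z)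
      ≡⟨ residueSum-ext (λ t → solve 4 (λ t c z f → (t :- c) :* f := (t :- z) :* f :+ (z :- c) :* f) refl t c z (f t)) (z ∷ Z) ⟩
    residueSum (λ t → (t - z) * f t + (z - c) * f t) (z ∷ Z)
      ≡⟨ residueSum-linear (λ t → (t - z) * f t) f (z - c) (z ∷ Z) ⟩
    residueSum (λ t → (t - z) * f t) (z ∷ Z) + (z - c) * residueSum f (z ∷ Z)
      ≡⟨ cong (_+ (z - c) * residueSum f (z ∷ Z)) (residueSum-cancel f z Z z≢Z) ⟩
    residueSum f Z + (z - c) * residueSum f (z ∷ Z) ∎

  -- The recurrence of divided differences: (z - w) times the sum over z, w, Z is the difference of
  -- the sums over z, Z and over w, Z. By induction both of these vanish, unless Z is empty, when
  -- both are 1.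
  residueSum-1≡0 : ∀ z w Z → Unique (z ∷ w ∷ Z) → residueSum (λ _ → 1#) (z ∷ w ∷ Z) ≡ 0#
  residueSum-1≡0 z w Z ((z≢w ∷ z≢Z) ∷ (w≢Z ∷ uZ)) =
    *≡0 (difference-nonzero z≢w) (trans difference (zero-or-recurse Z z≢Z w≢Z uZ))
    where
    one : K → K
    one _ = 1#
    swapped : residueSum one (w ∷ Z) + (z - w) * residueSum one (z ∷ w ∷ Z) ≡ residueSum one (z ∷ Z)
    swapped = begin
      residueSum one (w ∷ Z) + (z - w) * residueSum one (z ∷ w ∷ Z) ≡⟨ residueSum-step one w z (w ∷ Z) (z≢w ∷ z≢Z) ⟨
      residueSum (λ t → (t - w) * 1#) (z ∷ w ∷ Z) ≡⟨ residueSum-swap (λ t → (t - w) * 1#) z w Z ⟩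
      residueSum (λ t → (t - w) * 1#) (w ∷ z ∷ Z) ≡⟨ residueSum-cancel one w (z ∷ Z) ((λ eq → z≢w (sym eq)) ∷ w≢Z) ⟩
      residueSum one (z ∷ Z) ∎
    difference : (z - w) * residueSum one (z ∷ w ∷ Z) ≡ residueSum one (z ∷ Z) - residueSum one (w ∷ Z)
    difference = begin
      (z - w) * residueSum one (z ∷ w ∷ Z) ≡⟨ solve 2 (λ a b → b := (a :+ b) :- a) refl (residueSum one (w ∷ Z)) _ ⟩
      _ - residueSum one (w ∷ Z) ≡⟨ cong (_- residueSum one (w ∷ Z)) swapped ⟩
      residueSum one (z ∷ Z) - residueSum one (w ∷ Z) ∎
    zero-or-recurse : ∀ Z → All (z ≢_) Z → All (w ≢_) Z → Unique Z → residueSum one (z ∷ Z) - residueSum one (w ∷ Z) ≡ 0#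
    zero-or-recurse [] _ _ _ = -‿inverseʳ _
    zero-or-recurse (v ∷ Z) (z≢v ∷ z≢Z) (w≢v ∷ w≢Z) uZ =
      trans (cong₂ _-_ (residueSum-1≡0 z v Z ((z≢v ∷ z≢Z) ∷ uZ)) (residueSum-1≡0 w v Z ((w≢v ∷ w≢Z) ∷ uZ))) (-‿inverseʳ 0#)

  -- The degree of the numerator is at least two below the number of poles, so there is no residue
  -- at infinity. Each root is removed by `residueSum-step`, at the cost of at most one node.
  residueSum≡0 : ∀ C Z → Unique Z → 2 ℕ.+ length C ≤ length Z → residueSum (λ t → prodL t C) Z ≡ 0#
  residueSum≡0 [] (z ∷ []) _ (s≤s ())
  residueSum≡0 [] (z ∷ w ∷ Z) u _ = residueSum-1≡0 z w Z u
  residueSum≡0 (c ∷ C) (z ∷ Z) u@(z≢Z ∷ uZ) (s≤s len) = begin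
    residueSum (λ t → (t - c) * prodL t C) (z ∷ Z)
      ≡⟨ residueSum-step (λ t → prodL t C) c z Z z≢Z ⟩
    residueSum (λ t → prodL t C) Z + (z - c) * residueSum (λ t → prodL t C) (z ∷ Z)
      ≡⟨ cong₂ (λ a b → a + (z - c) * b) (residueSum≡0 C Z uZ len) (residueSum≡0 C (z ∷ Z) u (ℕₚ.m≤n⇒m≤1+n len)) ⟩
    0# + (z - c) * 0# ≡⟨ trans (+-identityˡ _) (zeroʳ _) ⟩
    0# ∎

  prodL-++ : ∀ t X Y → prodL t (X ++ Y) ≡ prodL t X * prodL t Y
  prodL-++ t [] Y = sym (*-identityˡ _)
  prodL-++ t (x ∷ X) Y = trans (cong ((t - x) *_) (prodL-++ t X Y)) (sym (*-assoc _ _ _))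

  residueSum-++ : ∀ f X Y → residueSum f (X ++ Y) ≡
    residueSum (λ t → f t * inv (prodL t Y)) X + residueSum (λ t → f t * inv (prodL t X)) Y
  residueSum-++ f [] Y = sym (trans (+-identityˡ _)
    (residueSum-ext (λ t → trans (cong (f t *_) inv-1) (*-identityʳ _)) Y))
  residueSum-++ f (x ∷ X) Y = begin
    f x * inv (prodL x (X ++ Y)) + residueSum (λ t → f t * inv (t - x)) (X ++ Y)
      ≡⟨ cong₂ (λ a b → f x * a + b) (trans (cong inv (prodL-++ x X Y)) (inv-* _ _)) (residueSum-++ (λ t → f t * inv (t - x)) X Y) ⟩
    f x * (inv (prodL x X) * inv (prodL x Y)) + (residueSum (λ t → f t * inv (t - x) * inv (prodL t Y)) X + residueSum (λ t → f t * inv (t - x) * inv (prodL t X)) Y)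
      ≡⟨ cong₂ (λ a b → f x * (inv (prodL x X) * inv (prodL x Y)) + (a + b))
           (residueSum-ext (λ t → solve 3 (λ a b c → a :* b :* c := a :* c :* b) refl (f t) (inv (t - x)) (inv (prodL t Y))) X)
           (residueSum-ext (λ t → trans (*-assoc _ _ _) (cong (f t *_) (sym (inv-* _ _)))) Y) ⟩
    f x * (inv (prodL x X) * inv (prodL x Y)) + (residueSum (λ t → f t * inv (prodL t Y) * inv (t - x)) X + residueSum (λ t → f t * inv ((t - x) * prodL t X)) Y)
      ≡⟨ solve 5 (λ f a b r s → f :* (a :* b) :+ (r :+ s) := f :* b :* a :+ r :+ s) refl (f x) (inv (prodL x X)) (inv (prodL x Y)) _ _ ⟩
    residueSum (λ t → f t * inv (prodL t Y)) (x ∷ X) + residueSum (λ t → f t * inv (prodL t (x ∷ X))) Y ∎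

  progression : ℕ → K → List K
  progression zero    s = []
  progression (suc n) s = (ι n + s) ∷ progression n s

  length-progression : ∀ n s → length (progression n s) ≡ n
  length-progression zero    s = refl
  length-progression (suc n) s = cong suc (length-progression n s)

  prodL-progression : ∀ n t s → prodL t (progression n s) ≡ poch (1# + (t - s) - ι n) n
  prodL-progression zero t s = refl
  prodL-progression (suc n) t s = begin
    (t - (ι n + s)) * prodL t (progression n s)
      ≡⟨ cong₂ _*_ head (trans (prodL-progression n t s) (cong (λ u → poch u n) tail)) ⟩
    (1# + (t - s) - ι (suc n)) * poch (1# + (1# + (t - s) - ι (suc n))) n ≡⟨ poch-suc _ n ⟨
    poch (1# + (t - s) - ι (suc n)) (suc n) ∎
    where
    head : t - (ι n + s) ≡ 1# + (t - s) - ι (suc n)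
    head = trans (solve 3 (λ t s n → t :- (n :+ s) := :1 :+ (t :- s) :- (:1 :+ n)) refl t s (ι n))
      (cong (λ x → 1# + (t - s) - x) (sym (ι-suc n)))
    tail : 1# + (t - s) - ι n ≡ 1# + (1# + (t - s) - ι (suc n))
    tail = trans (solve 3 (λ t s n → :1 :+ (t :- s) :- n := :1 :+ (:1 :+ (t :- s) :- (:1 :+ n))) refl t s (ι n))
      (cong (λ u → 1# + (1# + (t - s) - u)) (sym (ι-suc n)))

  -- The product of 1 / (a - l) over 0 ≤ l ≤ n with l ≠ a: the first factor collects l < a, the
  -- second l > a.
  weight : ℕ → ℕ → K
  weight n a = inv (poch 1# a) * inv (poch (- ι (n ℕ.∸ a)) (n ℕ.∸ a))

  ι-∸ : ∀ {m n} → n ≤ m → ι (m ℕ.∸ n) ≡ ι m - ι n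
  ι-∸ {m} {n} n≤m = begin
    ι (m ℕ.∸ n)                  ≡⟨ solve 2 (λ a b → a := a :+ b :- b) refl (ι (m ℕ.∸ n)) (ι n) ⟩
    ι (m ℕ.∸ n) + ι n - ι n      ≡⟨ cong (_- ι n) (ι-+ (m ℕ.∸ n) n) ⟨
    ι (m ℕ.∸ n ℕ.+ n) - ι n      ≡⟨ cong (λ k → ι k - ι n) (ℕₚ.m∸n+n≡m n≤m) ⟩
    ι m - ι n ∎

  weight-suc : ∀ n a → a ≤ n → inv (ι a - ι (suc n)) * weight n a ≡ weight (suc n) a
  weight-suc n a a≤n = begin
    inv (ι a - ι (suc n)) * (inv (poch 1# a) * inv (poch (- ι k) k))
      ≡⟨ solve 3 (λ x y z → x :* (y :* z) := y :* (x :* z)) refl (inv (ι a - ι (suc n))) (inv (poch 1# a)) (inv (poch (- ι k) k)) ⟩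
    inv (poch 1# a) * (inv (ι a - ι (suc n)) * inv (poch (- ι k) k))
      ≡⟨ cong (inv (poch 1# a) *_) (sym (inv-* _ _)) ⟩
    inv (poch 1# a) * inv ((ι a - ι (suc n)) * poch (- ι k) k)
      ≡⟨ cong₂ (λ x y → inv (poch 1# a) * inv (x * poch y k)) head tail ⟩
    inv (poch 1# a) * inv (- ι (suc k) * poch (1# + - ι (suc k)) k)
      ≡⟨ cong (λ x → inv (poch 1# a) * inv x) (sym (poch-suc (- ι (suc k)) k)) ⟩
    inv (poch 1# a) * inv (poch (- ι (suc k)) (suc k))
      ≡⟨ cong (λ j → inv (poch 1# a) * inv (poch (- ι j) j)) (sym (ℕₚ.+-∸-assoc 1 a≤n)) ⟩
    weight (suc n) a ∎
    where
    k = n ℕ.∸ a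
    head : ι a - ι (suc n) ≡ - ι (suc k)
    head = begin
      ι a - ι (suc n) ≡⟨ cong (λ x → ι a - x) (ι-suc n) ⟩
      ι a - (1# + ι n) ≡⟨ solve 2 (λ a n → a :- (:1 :+ n) := :- (:1 :+ (n :- a))) refl (ι a) (ι n) ⟩
      - (1# + (ι n - ι a)) ≡⟨ cong (λ x → - (1# + x)) (ι-∸ a≤n) ⟨
      - (1# + ι k) ≡⟨ cong -_ (ι-suc k) ⟨
      - ι (suc k) ∎
    tail : - ι k ≡ 1# + - ι (suc k)
    tail = trans (solve 1 (λ k → :- k := :1 :- (:1 :+ k)) refl (ι k)) (cong (λ x → 1# + - x) (sym (ι-suc k)))

  residueSum-progression : ∀ n f s → residueSum f (progression (suc n) s) ≡ sumTo (suc n) (λ a → f (ι a + s) * weight n a)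
  residueSum-progression zero f s = begin
    f (ι 0 + s) * inv 1# + 0# ≡⟨ +-comm _ _ ⟩
    0# + f (ι 0 + s) * inv 1# ≡⟨ cong (λ x → 0# + f (ι 0 + s) * x) (trans (sym (*-identityʳ _)) (cong (inv 1# *_) (sym inv-1))) ⟩
    0# + f (ι 0 + s) * (inv 1# * inv 1#) ∎
  residueSum-progression (suc n) f s = begin
    f t * inv (prodL t (progression (suc n) s)) + residueSum (λ u → f u * inv (u - t)) (progression (suc n) s)
      ≡⟨ cong₂ _+_ (cong (f t *_) last) (trans (residueSum-progression n (λ u → f u * inv (u - t)) s) (sumTo-cong (suc n) body)) ⟩
    f t * weight (suc n) (suc n) + sumTo (suc n) (λ a → f (ι a + s) * weight (suc n) a) ≡⟨ +-comm _ _ ⟩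
    sumTo (suc (suc n)) (λ a → f (ι a + s) * weight (suc n) a) ∎
    where
    t = ι (suc n) + s
    last : inv (prodL t (progression (suc n) s)) ≡ weight (suc n) (suc n)
    last = begin
      inv (prodL t (progression (suc n) s)) ≡⟨ cong inv (prodL-progression (suc n) t s) ⟩
      inv (poch (1# + (t - s) - ι (suc n)) (suc n))
        ≡⟨ cong (λ x → inv (poch x (suc n))) (solve 2 (λ n s → :1 :+ (n :+ s :- s) :- n := :1) refl (ι (suc n)) s) ⟩
      inv (poch 1# (suc n)) ≡⟨ trans (sym (*-identityʳ _)) (cong (inv (poch 1# (suc n)) *_) (sym inv-1)) ⟩
      inv (poch 1# (suc n)) * inv (poch (- ι 0) 0)
        ≡⟨ cong (λ k → inv (poch 1# (suc n)) * inv (poch (- ι k) k)) (sym (ℕₚ.n∸n≡0 n)) ⟩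
      weight (suc n) (suc n) ∎
    body : ∀ a → a < suc n → f (ι a + s) * inv (ι a + s - t) * weight n a ≡ f (ι a + s) * weight (suc n) a
    body a (s≤s a≤n) = trans (*-assoc _ _ _) (cong (f (ι a + s) *_)
      (trans (cong (λ x → inv x * weight n a) (solve 3 (λ a s n → a :+ s :- (n :+ s) := a :- n) refl (ι a) s (ι (suc n)))) (weight-suc n a a≤n)))

-- p-integral elements and congruences modulo powers of p

module Valuation (F : CharZeroField) (p : ℕ) (p-prime : Prime p) where
  open CharZeroField F
  open FieldAlgebra F

  record Integral (x : K) : Set where
    constructor integral
    field
      num den : ℤ
      p∤den   : ¬ (p ∣ ℤ.∣ den ∣)
      scaled  : x * ⟦ den ⟧ ≡ ⟦ num ⟧

  p∤* : ∀ i j → ¬ (p ∣ ℤ.∣ i ∣) → ¬ (p ∣ ℤ.∣ j ∣) → ¬ (p ∣ ℤ.∣ i ℤ.* j ∣)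
  p∤* i j p∤i p∤j p∣ij with euclidsLemma ℤ.∣ i ∣ ℤ.∣ j ∣ p-prime (subst (p ∣_) (ℤₚ.abs-* i j) p∣ij)
  ... | inj₁ p∣i = p∤i p∣i
  ... | inj₂ p∣j = p∤j p∣j

  2≤p : 2 ≤ p
  2≤p = ℕ.nonTrivial⇒n>1 p {{prime⇒nonTrivial p-prime}}

  p∤small : ∀ {n} → 1 ≤ n → n < p → ¬ (p ∣ n)
  p∤small {suc n} _ n<p p∣n = ℕₚ.<⇒≱ n<p (ℕ∣.∣⇒≤ p∣n)

  p∤1 : ¬ (p ∣ 1)
  p∤1 = p∤small ℕₚ.≤-refl 2≤p

  integral-⟦⟧ : ∀ i → Integral ⟦ i ⟧
  integral-⟦⟧ i = integral i (ℤ.+ 1) p∤1 (*-identityʳ _)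

  integral-ι : ∀ n → Integral (ι n)
  integral-ι n = integral-⟦⟧ (ℤ.+ n)

  integral-+ : ∀ {x y} → Integral x → Integral y → Integral (x + y)
  integral-+ {x} {y} (integral a b p∤b eq) (integral c d p∤d eq′) =
    integral (a ℤ.* d ℤ.+ c ℤ.* b) (b ℤ.* d) (p∤* b d p∤b p∤d) (begin
      (x + y) * ⟦ b ℤ.* d ⟧     ≡⟨ cong ((x + y) *_) (⟦⟧-* b d) ⟩
      (x + y) * (⟦ b ⟧ * ⟦ d ⟧) ≡⟨ solve 4 (λ x y b d → (x :+ y) :* (b :* d) := x :* b :* d :+ y :* d :* b) refl x y ⟦ b ⟧ ⟦ d ⟧ ⟩
      x * ⟦ b ⟧ * ⟦ d ⟧ + y * ⟦ d ⟧ * ⟦ b ⟧ ≡⟨ cong₂ (λ u v → u * ⟦ d ⟧ + v * ⟦ b ⟧) eq eq′ ⟩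
      ⟦ a ⟧ * ⟦ d ⟧ + ⟦ c ⟧ * ⟦ b ⟧ ≡⟨ sym (trans (⟦⟧-+ (a ℤ.* d) (c ℤ.* b)) (cong₂ _+_ (⟦⟧-* a d) (⟦⟧-* c b))) ⟩
      ⟦ a ℤ.* d ℤ.+ c ℤ.* b ⟧ ∎)

  integral-* : ∀ {x y} → Integral x → Integral y → Integral (x * y)
  integral-* {x} {y} (integral a b p∤b eq) (integral c d p∤d eq′) =
    integral (a ℤ.* c) (b ℤ.* d) (p∤* b d p∤b p∤d) (begin
      x * y * ⟦ b ℤ.* d ⟧     ≡⟨ cong (x * y *_) (⟦⟧-* b d) ⟩
      x * y * (⟦ b ⟧ * ⟦ d ⟧) ≡⟨ solve 4 (λ x y b d → x :* y :* (b :* d) := x :* b :* (y :* d)) refl x y ⟦ b ⟧ ⟦ d ⟧ ⟩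
      x * ⟦ b ⟧ * (y * ⟦ d ⟧) ≡⟨ cong₂ _*_ eq eq′ ⟩
      ⟦ a ⟧ * ⟦ c ⟧ ≡⟨ ⟦⟧-* a c ⟨
      ⟦ a ℤ.* c ⟧ ∎)

  integral-neg : ∀ {x} → Integral x → Integral (- x)
  integral-neg {x} h = subst Integral (trans (cong (_* x) (⟦⟧-neg (ℤ.+ 1))) (solve 1 (λ x → :- :1 :* x := :- x) refl x))
    (integral-* (integral-⟦⟧ (ℤ.- (ℤ.+ 1))) h)

  integral-- : ∀ {x y} → Integral x → Integral y → Integral (x - y)
  integral-- hx hy = integral-+ hx (integral-neg hy)

  π : K
  π = ι p

  π≢0 : π ≢ 0#
  π≢0 eq = ℕₚ.<⇒≢ (ℕₚ.<-trans (s≤s z≤n) 2≤p) (sym (ℤₚ.+-injective (⟦⟧≡0 (ℤ.+ p) eq)))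

  π^ : ℕ → K
  π^ zero    = 1#
  π^ (suc n) = π * π^ n

  π^-+ : ∀ m n → π^ (m ℕ.+ n) ≡ π^ m * π^ n
  π^-+ zero n = sym (*-identityˡ _)
  π^-+ (suc m) n = trans (cong (π *_) (π^-+ m n)) (sym (*-assoc _ _ _))

  integral-π^ : ∀ n → Integral (π^ n)
  integral-π^ zero    = integral-ι 1
  integral-π^ (suc n) = integral-* (integral-ι p) (integral-π^ n)

  record O (n : ℕ) (x : K) : Set where
    constructor mkO
    field
      quotient : K
      quotient-integral : Integral quotient
      factor : x ≡ π^ n * quotient

  O⇒integral : ∀ {n x} → O n x → Integral x
  O⇒integral {n} (mkO q h refl) = integral-* (integral-π^ n) h

  integral⇒O0 : ∀ {x} → Integral x → O 0 x
  integral⇒O0 {x} h = mkO x h (sym (*-identityˡ x))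

  O-0 : ∀ n → O n 0#
  O-0 n = mkO 0# (integral-ι 0) (sym (zeroʳ _))

  O-+ : ∀ {n x y} → O n x → O n y → O n (x + y)
  O-+ {n} (mkO q h refl) (mkO r k refl) = mkO (q + r) (integral-+ h k)
    (solve 3 (λ p q r → p :* q :+ p :* r := p :* (q :+ r)) refl (π^ n) q r)

  O-neg : ∀ {n x} → O n x → O n (- x)
  O-neg {n} (mkO q h refl) = mkO (- q) (integral-neg h) (solve 2 (λ p q → :- (p :* q) := p :* (:- q)) refl (π^ n) q)

  O-- : ∀ {n x y} → O n x → O n y → O n (x - y)
  O-- hx hy = O-+ hx (O-neg hy)

  O-* : ∀ {m n x y} → O m x → O n y → O (m ℕ.+ n) (x * y)
  O-* {m} {n} (mkO q h refl) (mkO r k refl) = mkO (q * r) (integral-* h k)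
    (trans (solve 4 (λ a q b r → a :* q :* (b :* r) := a :* b :* (q :* r)) refl (π^ m) q (π^ n) r) (cong (_* (q * r)) (sym (π^-+ m n))))

  O-*ˡ : ∀ {n x y} → Integral x → O n y → O n (x * y)
  O-*ˡ h k = O-* (integral⇒O0 h) k

  O-*ʳ : ∀ {n x y} → O n x → Integral y → O n (x * y)
  O-*ʳ {n} {x} {y} h k = subst (O n) (*-comm y x) (O-*ˡ k h)

  O-weaken : ∀ {n} m {x} → O (m ℕ.+ n) x → O n x
  O-weaken {n} m (mkO q h refl) = mkO (π^ m * q) (integral-* (integral-π^ m) h)
    (trans (cong (_* q) (π^-+ m n)) (solve 3 (λ a b q → a :* b :* q := b :* (a :* q)) refl (π^ m) (π^ n) q))

  O-π* : ∀ {n x} → O n x → O (suc n) (π * x)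
  O-π* {n} (mkO q h refl) = mkO q h (sym (*-assoc _ _ _))

  O-divide-π : ∀ {n x} → O (suc n) x → O n (x * inv π)
  O-divide-π {n} (mkO q h refl) = mkO q h (trans
    (solve 4 (λ p a q i → p :* a :* q :* i := (a :* q) :* (p :* i)) refl π (π^ n) q (inv π))
    (trans (cong ((π^ n * q) *_) (inv-r π≢0)) (*-identityʳ _)))

  O1-π* : ∀ {x} → Integral x → O 1 (π * x)
  O1-π* h = O-π* (integral⇒O0 h)

  O-sum : ∀ {n} N {f} → (∀ i → i < N → O n (f i)) → O n (sumTo N f)
  O-sum {n} zero h = O-0 n
  O-sum (suc N) h = O-+ (O-sum N (λ i i<N → h i (ℕₚ.m<n⇒m<1+n i<N))) (h N ℕₚ.≤-refl)

  record Unit (x : K) : Set where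
    constructor unit
    field
      nonzero : x ≢ 0#
      integral-self : Integral x
      integral-inv : Integral (inv x)
  open Unit

  unit-1 : Unit 1#
  unit-1 = unit 1≢0 (integral-ι 1) (subst Integral (sym inv-1) (integral-ι 1))

  unit-* : ∀ {x y} → Unit x → Unit y → Unit (x * y)
  unit-* (unit a b c) (unit a′ b′ c′) =
    unit (*-nonzero a a′) (integral-* b b′) (subst Integral (sym (inv-* _ _)) (integral-* c c′))

  unit-inv : ∀ {x} → Unit x → Unit (inv x)
  unit-inv (unit a b c) = unit (inv-nonzero a) c (subst Integral (sym (inv-inv a)) b)

  -- With z = p n / d the sum is (i d + p n) / d. Neither numerator nor denominator is divisible by
  -- p, so swapping them represents the inverse.
  unit-⟦⟧+O1 : ∀ i {z} → ¬ (p ∣ ℤ.∣ i ∣) → O 1 z → Unit (⟦ i ⟧ + z)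
  unit-⟦⟧+O1 i {z} p∤i (mkO q (integral n d p∤d eq) refl) = unit nz (integral c d p∤d scaled) (integral d c p∤c inverse)
    where
    x = ⟦ i ⟧ + z
    c = i ℤ.* d ℤ.+ ℤ.+ p ℤ.* n
    p∤c : ¬ (p ∣ ℤ.∣ c ∣)
    p∤c p∣c = p∤* i d p∤i p∤d (ℤ∣.∣⇒∣ᵤ (ℤ∣.∣m+n∣n⇒∣m {m = i ℤ.* d} {n = ℤ.+ p ℤ.* n} (ℤ∣.∣ᵤ⇒∣ {ℤ.+ p} {c} p∣c) (ℤ∣.∣m⇒∣m*n n (ℤ∣.∣-refl {ℤ.+ p}))))
    scaled : x * ⟦ d ⟧ ≡ ⟦ c ⟧
    scaled = begin
      (⟦ i ⟧ + π * 1# * q) * ⟦ d ⟧ ≡⟨ solve 4 (λ i p q d → (i :+ p :* :1 :* q) :* d := i :* d :+ p :* (q :* d)) refl ⟦ i ⟧ π q ⟦ d ⟧ ⟩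
      ⟦ i ⟧ * ⟦ d ⟧ + π * (q * ⟦ d ⟧) ≡⟨ cong₂ _+_ (sym (⟦⟧-* i d)) (trans (cong (π *_) eq) (sym (⟦⟧-* (ℤ.+ p) n))) ⟩
      ⟦ i ℤ.* d ⟧ + ⟦ ℤ.+ p ℤ.* n ⟧ ≡⟨ ⟦⟧-+ _ _ ⟨
      ⟦ c ⟧ ∎
    c≢0 : c ≢ ℤ.+ 0
    c≢0 c≡0 = p∤c (subst (λ k → p ∣ ℤ.∣ k ∣) (sym c≡0) (p ℕ∣.∣0))
    nz : x ≢ 0#
    nz x≡0 = c≢0 (⟦⟧≡0 c (trans (sym scaled) (trans (cong (_* ⟦ d ⟧) x≡0) (zeroˡ _))))
    inverse : inv x * ⟦ c ⟧ ≡ ⟦ d ⟧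
    inverse = begin
      inv x * ⟦ c ⟧       ≡⟨ cong (inv x *_) scaled ⟨
      inv x * (x * ⟦ d ⟧) ≡⟨ *-assoc _ _ _ ⟨
      inv x * x * ⟦ d ⟧   ≡⟨ cong (_* ⟦ d ⟧) (inv-l nz) ⟩
      1# * ⟦ d ⟧          ≡⟨ *-identityˡ _ ⟩
      ⟦ d ⟧ ∎

  unit-+ : ∀ l {z} → 1 ≤ l → l < p → O 1 z → Unit (ι l + z)
  unit-+ l 1≤l l<p = unit-⟦⟧+O1 (ℤ.+ l) (p∤small 1≤l l<p)

  unit-- : ∀ l {z} → 1 ≤ l → l < p → O 1 z → Unit (z - ι l)
  unit-- l {z} 1≤l l<p h = subst Unit (trans (cong (_+ z) (⟦⟧-neg (ℤ.+ l))) (+-comm _ _))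
    (unit-⟦⟧+O1 (ℤ.- (ℤ.+ l)) (subst (λ k → ¬ (p ∣ k)) (sym (ℤₚ.∣-i∣≡∣i∣ (ℤ.+ l))) (p∤small 1≤l l<p)) h)

  unit-ι : ∀ l → 1 ≤ l → l < p → Unit (ι l)
  unit-ι l 1≤l l<p = subst Unit (+-identityʳ _) (unit-+ l 1≤l l<p (O-0 1))

  -- Clearing denominators in x · (1/x) = 1 would make p divide a product of two denominators prime
  -- to p. This is what separates poles: equal ones would put an integer strictly between 0 and p
  -- into pℤ₍ₚ₎.
  O1-not-unit : ∀ {x} → O 1 x → ¬ Unit x
  O1-not-unit {x} (mkO q (integral n d p∤d eq) refl) (unit nz _ (integral n′ d′ p∤d′ eq′)) =
    p∤* d′ d p∤d′ p∤d (ℤ∣.∣⇒∣ᵤ (ℤ∣.divides (n′ ℤ.* n) (⟦⟧-injective equation)))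
    where
    ⟦⟧-injective : ∀ {i j} → ⟦ i ⟧ ≡ ⟦ j ⟧ → i ≡ j
    ⟦⟧-injective {i} {j} e = ℤₚ.i-j≡0⇒i≡j i j (⟦⟧≡0 _ (trans (⟦⟧-+ i (ℤ.- j)) (trans (cong₂ _+_ e (⟦⟧-neg j)) (-‿inverseʳ _))))
    equation : ⟦ d′ ℤ.* d ⟧ ≡ ⟦ n′ ℤ.* n ℤ.* ℤ.+ p ⟧
    equation = begin
      ⟦ d′ ℤ.* d ⟧ ≡⟨ ⟦⟧-* d′ d ⟩
      ⟦ d′ ⟧ * ⟦ d ⟧ ≡⟨ cong (_* ⟦ d ⟧) (trans (sym (*-identityˡ _)) (cong (_* ⟦ d′ ⟧) (sym (inv-r nz)))) ⟩
      (π * 1# * q) * inv (π * 1# * q) * ⟦ d′ ⟧ * ⟦ d ⟧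
        ≡⟨ solve 5 (λ p q i d′ d → p :* :1 :* q :* i :* d′ :* d := (i :* d′) :* (q :* d) :* p) refl π q (inv (π * 1# * q)) ⟦ d′ ⟧ ⟦ d ⟧ ⟩
      (inv (π * 1# * q) * ⟦ d′ ⟧) * (q * ⟦ d ⟧) * π ≡⟨ cong₂ (λ u v → u * v * π) eq′ eq ⟩
      ⟦ n′ ⟧ * ⟦ n ⟧ * π ≡⟨ sym (trans (⟦⟧-* _ _) (cong (_* π) (⟦⟧-* n′ n))) ⟩
      ⟦ n′ ℤ.* n ℤ.* ℤ.+ p ⟧ ∎

  infix 4 _≈[_]_
  _≈[_]_ : K → ℕ → K → Set
  x ≈[ n ] y = O n (x - y)

  ≡⇒≈ : ∀ {n x y} → x ≡ y → x ≈[ n ] y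
  ≡⇒≈ {n} {x} refl = subst (O n) (sym (-‿inverseʳ x)) (O-0 n)

  ≈-refl : ∀ {n x} → x ≈[ n ] x
  ≈-refl = ≡⇒≈ refl

  ≈-sym : ∀ {n x y} → x ≈[ n ] y → y ≈[ n ] x
  ≈-sym {n} {x} {y} h = subst (O n) (solve 2 (λ x y → :- (x :- y) := y :- x) refl x y) (O-neg h)

  ≈-trans : ∀ {n x y z} → x ≈[ n ] y → y ≈[ n ] z → x ≈[ n ] z
  ≈-trans {n} {x} {y} {z} h k = subst (O n) (solve 3 (λ x y z → (x :- y) :+ (y :- z) := x :- z) refl x y z) (O-+ h k)

  ≈-resp-≡ : ∀ {n x y x′ y′} → x ≡ x′ → y ≡ y′ → x ≈[ n ] y → x′ ≈[ n ] y′
  ≈-resp-≡ refl refl h = h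

  ≈-+ : ∀ {n x y x′ y′} → x ≈[ n ] x′ → y ≈[ n ] y′ → x + y ≈[ n ] x′ + y′
  ≈-+ {n} {x} {y} {x′} {y′} h k =
    subst (O n) (solve 4 (λ x y x′ y′ → (x :- x′) :+ (y :- y′) := (x :+ y) :- (x′ :+ y′)) refl x y x′ y′) (O-+ h k)

  ≈-* : ∀ {n x y x′ y′} → Integral x′ → Integral y → x ≈[ n ] x′ → y ≈[ n ] y′ → x * y ≈[ n ] x′ * y′
  ≈-* {n} {x} {y} {x′} {y′} ix′ iy h k =
    subst (O n) (solve 4 (λ x y x′ y′ → (x :- x′) :* y :+ x′ :* (y :- y′) := x :* y :- x′ :* y′) refl x y x′ y′)
      (O-+ (O-*ʳ h iy) (O-*ˡ ix′ k))

  ≈-*ˡ : ∀ {n c x y} → Integral c → x ≈[ n ] y → c * x ≈[ n ] c * y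
  ≈-*ˡ {n} {c} {x} {y} ic h = subst (O n) (solve 3 (λ c x y → c :* (x :- y) := c :* x :- c :* y) refl c x y) (O-*ˡ ic h)

  ≈-inv : ∀ {n x y} → Unit x → Unit y → x ≈[ n ] y → inv x ≈[ n ] inv y
  ≈-inv {n} {x} {y} ux uy h = subst (O n) eq (O-*ʳ (O-neg h) (integral-* (integral-inv ux) (integral-inv uy)))
    where
    eq : - (x - y) * (inv x * inv y) ≡ inv x - inv y
    eq = begin
      - (x - y) * (inv x * inv y)
        ≡⟨ solve 4 (λ x y a b → :- (x :- y) :* (a :* b) := (y :* b) :* a :- (x :* a) :* b) refl x y (inv x) (inv y) ⟩
      (y * inv y) * inv x - (x * inv x) * inv y ≡⟨ cong₂ (λ u v → u * inv x - v * inv y) (inv-r (nonzero uy)) (inv-r (nonzero ux)) ⟩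
      1# * inv x - 1# * inv y ≡⟨ cong₂ _-_ (*-identityˡ _) (*-identityˡ _) ⟩
      inv x - inv y ∎

  ≈-sum : ∀ {n} N {f f′} → (∀ i → i < N → f i ≈[ n ] f′ i) → sumTo N f ≈[ n ] sumTo N f′
  ≈-sum {n} N {f} {f′} h = subst (O n) (sym (sumTo-distrib-- N f f′)) (O-sum N h)

  O-resp-≈ : ∀ {n x y} → x ≈[ n ] y → O n y → O n x
  O-resp-≈ {n} {x} {y} h k = subst (O n) (solve 2 (λ x y → (x :- y) :+ y := x) refl x y) (O-+ h k)

  integral-resp-≈ : ∀ {n x y} → x ≈[ n ] y → Integral y → Integral x
  integral-resp-≈ {n} {x} {y} h k = subst Integral (solve 2 (λ x y → (x :- y) :+ y := x) refl x y) (integral-+ (O⇒integral h) k)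

  O⇒≈ : ∀ {n x y} → O n x → O n y → x ≈[ n ] y
  O⇒≈ = O--

  unit-≈1 : ∀ {x} → x ≈[ 1 ] 1# → Unit x
  unit-≈1 {x} h = subst Unit (solve 1 (λ x → :1 :+ (x :- :1) := x) refl x) (unit-+ 1 ℕₚ.≤-refl 2≤p h)

  poch-unit : ∀ a n → (∀ i → i < n → Unit (a + ι i)) → Unit (poch a n)
  poch-unit a zero h = unit-1
  poch-unit a (suc n) h = unit-* (poch-unit a n (λ i i<n → h i (ℕₚ.m<n⇒m<1+n i<n))) (h n ℕₚ.≤-refl)

  poch-integral : ∀ {a} n → Integral a → Integral (poch a n)
  poch-integral zero h = integral-ι 1
  poch-integral (suc n) h = integral-* (poch-integral n h) (integral-+ h (integral-ι n))

  poch-O1 : ∀ {a} n i → i < n → Integral a → O 1 (a + ι i) → O 1 (poch a n)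
  poch-O1 {a} (suc n) i i<1+n ia h with i ℕ.≟ n
  ... | yes refl = O-*ˡ (poch-integral n ia) h
  ... | no i≢n = O-*ʳ (poch-O1 n i (ℕₚ.≤∧≢⇒< (ℕₚ.≤-pred i<1+n) i≢n) ia h) (integral-+ ia (integral-ι n))

  poch-≈ : ∀ {k a b} n → Integral a → Integral b → a ≈[ k ] b → poch a n ≈[ k ] poch b n
  poch-≈ zero ia ib h = ≈-refl
  poch-≈ (suc n) ia ib h = ≈-* (poch-integral n ib) (integral-+ ia (integral-ι n)) (poch-≈ n ia ib h) (≈-+ h ≈-refl)

  poch-unit-+ : ∀ l n {z} → 1 ≤ l → l ℕ.+ n ≤ p → O 1 z → Unit (poch (ι l + z) n)
  poch-unit-+ l n {z} 1≤l l+n≤p h = poch-unit _ n λ i i<n →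
    subst Unit (trans (cong (_+ z) (ι-+ l i)) (solve 3 (λ l i z → l :+ i :+ z := l :+ z :+ i) refl (ι l) (ι i) z))
      (unit-+ (l ℕ.+ i) (ℕₚ.≤-trans 1≤l (ℕₚ.m≤m+n l i)) (ℕₚ.<-≤-trans (ℕₚ.+-monoʳ-< l i<n) l+n≤p) h)

  poch-unit-- : ∀ l n {z} → n ≤ l → l < p → O 1 z → Unit (poch (z - ι l) n)
  poch-unit-- l n {z} n≤l l<p h = poch-unit _ n λ i i<n →
    let i≤l = ℕₚ.≤-trans (ℕₚ.<⇒≤ i<n) n≤l in
    subst Unit (begin
        z - ι (l ℕ.∸ i)              ≡⟨ solve 3 (λ z k i → z :- k := z :- (k :+ i) :+ i) refl z (ι (l ℕ.∸ i)) (ι i) ⟩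
        z - (ι (l ℕ.∸ i) + ι i) + ι i ≡⟨ cong (λ k → z - k + ι i) (trans (sym (ι-+ (l ℕ.∸ i) i)) (cong ι (ℕₚ.m∸n+n≡m i≤l))) ⟩
        z - ι l + ι i ∎)
      (unit-- (l ℕ.∸ i) (ℕₚ.m<n⇒0<n∸m (ℕₚ.<-≤-trans i<n n≤l)) (ℕₚ.≤-<-trans (ℕₚ.m∸n≤m l i) l<p) h)

  -- The correction factors in the comparison of term ratios with a rational function:
  -- they do not disturb congruences modulo p³ between terms that agree modulo p.
  record Flat (x y : K) : Set where
    constructor flat
    field
      x≈1 : x ≈[ 2 ] 1#
      y≈1 : y ≈[ 2 ] 1#
      x≈y : x ≈[ 3 ] y

  flat-1 : Flat 1# 1#
  flat-1 = flat ≈-refl ≈-refl ≈-refl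

  ≈1-integral : ∀ {n x} → x ≈[ n ] 1# → Integral x
  ≈1-integral h = integral-resp-≈ h (integral-ι 1)

  ≈1-* : ∀ {n x y} → x ≈[ n ] 1# → y ≈[ n ] 1# → x * y ≈[ n ] 1#
  ≈1-* h k = ≈-trans (≈-* (integral-ι 1) (≈1-integral k) h k) (≡⇒≈ (*-identityˡ 1#))

  flat-* : ∀ {x y x′ y′} → Flat x y → Flat x′ y′ → Flat (x * x′) (y * y′)
  flat-* (flat a b c) (flat a′ b′ c′) =
    flat (≈1-* a a′) (≈1-* b b′) (≈-* (≈1-integral b) (≈1-integral a′) c c′)

  flat-unitˡ : ∀ {x y} → Flat x y → Unit x
  flat-unitˡ f = unit-≈1 (O-weaken 1 (Flat.x≈1 f))

  flat-unitʳ : ∀ {x y} → Flat x y → Unit y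
  flat-unitʳ f = unit-≈1 (O-weaken 1 (Flat.y≈1 f))

  flat-inv : ∀ {x y} → Flat x y → Flat (inv x) (inv y)
  flat-inv f@(flat a b c) = flat (≈-inv-1 (flat-unitˡ f) a) (≈-inv-1 (flat-unitʳ f) b) (≈-inv (flat-unitˡ f) (flat-unitʳ f) c)
    where
    ≈-inv-1 : ∀ {n x} → Unit x → x ≈[ n ] 1# → inv x ≈[ n ] 1#
    ≈-inv-1 u h = ≈-trans (≈-inv u unit-1 h) (≡⇒≈ inv-1)

-- Primes p = 2m + 1 ≥ 7: Wolstenholme's theorem and even ratios

module OddPrime (F : CharZeroField) (m : ℕ) (p-prime : Prime (suc (m ℕ.+ m))) (3≤m : 3 ≤ m) where
  open CharZeroField F
  open FieldAlgebra F
  open ResidueSums F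
  open Valuation F (suc (m ℕ.+ m)) p-prime
  open Unit

  p : ℕ
  p = suc (m ℕ.+ m)

  π≡1+2m : π ≡ 1# + (ι m + ι m)
  π≡1+2m = trans (ι-suc (m ℕ.+ m)) (cong (1# +_) (ι-+ m m))

  O1-π : O 1 π
  O1-π = subst (O 1) (*-identityʳ π) (O1-π* (integral-ι 1))

  -- The sum of 1 / l² over 0 < l < p is congruent to twice, and (splitting by parity) to half,
  -- the sum over 0 < l ≤ m, so all of them vanish modulo p.

  inverseSquare : ℕ → K
  inverseSquare l = inv (ι l * ι l)

  inverseSquare-reflect : ∀ a b → 1 ≤ a → 1 ≤ b → a ℕ.+ b ≡ p → inverseSquare a ≈[ 1 ] inverseSquare b
  inverseSquare-reflect a b 1≤a 1≤b a+b≡p = ≈-inv (unit-* ua ua) (unit-* ub ub)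
    (subst (O 1) eq (O-*ʳ (subst (O 1) (trans (cong ι (sym a+b≡p)) (ι-+ a b)) O1-π) (integral-- (integral-ι a) (integral-ι b))))
    where
    a<p : a < p
    a<p = subst (a <_) a+b≡p (ℕₚ.m<m+n a 1≤b)
    b<p : b < p
    b<p = subst (b <_) a+b≡p (ℕₚ.m<n+m b 1≤a)
    ua = unit-ι a 1≤a a<p
    ub = unit-ι b 1≤b b<p
    eq : (ι a + ι b) * (ι a - ι b) ≡ ι a * ι a - ι b * ι b
    eq = solve 2 (λ a b → (a :+ b) :* (a :- b) := a :* a :- b :* b) refl (ι a) (ι b)

  half-inverseSquares : K
  half-inverseSquares = sumTo m (λ i → inverseSquare (suc i))

  even-inverseSquares : K
  even-inverseSquares = sumTo m (λ i → inverseSquare (suc i ℕ.* 2))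

  all-inverseSquares : K
  all-inverseSquares = sumTo (m ℕ.+ m) (λ i → inverseSquare (suc i))

  reflected : ∀ i → i < m → suc (m ℕ.+ (m ℕ.∸ suc i)) ℕ.+ suc i ≡ p
  reflected i i<m = cong suc (trans (ℕₚ.+-assoc m _ (suc i)) (cong (m ℕ.+_) (ℕₚ.m∸n+n≡m i<m)))

  all≈half+half : all-inverseSquares ≈[ 1 ] half-inverseSquares + half-inverseSquares
  all≈half+half = ≈-trans (≡⇒≈ (trans (sumTo-+ m m (λ i → inverseSquare (suc i))) (cong (half-inverseSquares +_) (sumTo-reverse m (λ i → inverseSquare (suc (m ℕ.+ i)))))))
    (≈-+ ≈-refl (≈-sum m λ i i<m → inverseSquare-reflect _ (suc i) (s≤s z≤n) (s≤s z≤n) (reflected i i<m)))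

  m+m≡m*2 : m ℕ.+ m ≡ m ℕ.* 2
  m+m≡m*2 = trans (cong (m ℕ.+_) (sym (ℕₚ.+-identityʳ m))) (ℕₚ.*-comm 2 m)

  reflected-odd : ∀ i → i < m → suc ((m ℕ.∸ suc i) ℕ.* 2) ℕ.+ suc i ℕ.* 2 ≡ p
  reflected-odd i i<m = cong suc (trans (sym (ℕₚ.*-distribʳ-+ 2 (m ℕ.∸ suc i) (suc i))) (trans (cong (ℕ._* 2) (ℕₚ.m∸n+n≡m i<m)) (sym m+m≡m*2)))

  all≈even+even : all-inverseSquares ≈[ 1 ] even-inverseSquares + even-inverseSquares
  all≈even+even = ≈-trans (≡⇒≈ parity) (≈-+ odd≈even ≈-refl)
    where
    odd : ℕ → K
    odd j = inverseSquare (suc (j ℕ.* 2))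
    even : ℕ → K
    even j = inverseSquare (suc j ℕ.* 2)
    sumTo-distrib : ∀ n → sumTo n (λ j → 0# + odd j + even j) ≡ sumTo n odd + sumTo n even
    sumTo-distrib zero = solve 0 (:0 := :0 :+ :0) refl
    sumTo-distrib (suc n) = trans (cong (_+ (0# + odd n + even n)) (sumTo-distrib n))
      (solve 4 (λ a b x y → a :+ b :+ (:0 :+ x :+ y) := a :+ x :+ (b :+ y)) refl (sumTo n odd) (sumTo n even) (odd n) (even n))
    parity : all-inverseSquares ≡ sumTo m odd + sumTo m even
    parity = trans (cong (λ n → sumTo n (λ i → inverseSquare (suc i))) m+m≡m*2) (trans (sumTo-* m 2 (λ i → inverseSquare (suc i))) (sumTo-distrib m))
    odd≈even : sumTo m odd ≈[ 1 ] sumTo m even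
    odd≈even = ≈-trans (≡⇒≈ (sumTo-reverse m odd)) (≈-sum m λ i i<m → inverseSquare-reflect _ _ (s≤s z≤n) (s≤s z≤n) (reflected-odd i i<m))

  l<p : ∀ {l} → l ≤ m ℕ.+ m → l < p
  l<p = s≤s

  m≤2m : m ≤ m ℕ.+ m
  m≤2m = ℕₚ.m≤m+n m m

  6<p : 6 < p
  6<p = s≤s (ℕₚ.+-mono-≤ 3≤m 3≤m)

  half≡4even : half-inverseSquares ≡ ι 4 * even-inverseSquares
  half≡4even = trans (sumTo-cong m (λ i i<m → termwise (suc i) (ι≢0 i))) (sym (sumTo-*ˡ m (ι 4) (λ i → inverseSquare (suc i ℕ.* 2))))
    where
    termwise : ∀ l → ι l ≢ 0# → inverseSquare l ≡ ι 4 * inverseSquare (l ℕ.* 2)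
    termwise l l≢0 = inv-unique (begin
      ι l * ι l * (ι 4 * inv (ι (l ℕ.* 2) * ι (l ℕ.* 2)))
        ≡⟨ cong (λ x → ι l * ι l * (ι 4 * inv (x * x))) (ι-* l 2) ⟩
      ι l * ι l * (ι 4 * inv (ι l * ι 2 * (ι l * ι 2)))
        ≡⟨ cong (λ x → ι l * ι l * (x * inv (ι l * ι 2 * (ι l * ι 2)))) (ι-* 2 2) ⟩
      ι l * ι l * (ι 2 * ι 2 * inv (ι l * ι 2 * (ι l * ι 2)))
        ≡⟨ solve 3 (λ l t i → l :* l :* (t :* t :* i) := (l :* t :* (l :* t)) :* i) refl (ι l) (ι 2) (inv (ι l * ι 2 * (ι l * ι 2))) ⟩
      (ι l * ι 2 * (ι l * ι 2)) * inv (ι l * ι 2 * (ι l * ι 2))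
        ≡⟨ inv-r (*-nonzero (*-nonzero l≢0 (ι≢0 1)) (*-nonzero l≢0 (ι≢0 1))) ⟩
      1# ∎)

  O1-divide : ∀ {u x} → Unit u → O 1 (u * x) → O 1 x
  O1-divide {u} {x} uu h = subst (O 1)
    (trans (sym (*-assoc _ _ _)) (trans (cong (_* x) (inv-l (nonzero uu))) (*-identityˡ x)))
    (O-*ˡ (integral-inv uu) h)

  half-inverseSquares-O1 : O 1 half-inverseSquares
  half-inverseSquares-O1 = subst (O 1) (sym half≡4even) (O-*ˡ (integral-ι 4) even-O1)
    where
    H = half-inverseSquares
    E = even-inverseSquares
    6E : H + H - (E + E) ≡ ι 6 * E
    6E = trans (cong (λ x → x + x - (E + E)) half≡4even) (solve 1 (λ e → con (ℤ.+ 4) :* e :+ con (ℤ.+ 4) :* e :- (e :+ e) := con (ℤ.+ 6) :* e) refl E)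
    -- H = 4E turns 2H ≡ 2E into 6E ≡ 0, and 6 is invertible because p ≥ 7.
    even-O1 : O 1 E
    even-O1 = O1-divide (unit-ι 6 (s≤s z≤n) 6<p) (subst (O 1) 6E (≈-trans (≈-sym all≈half+half) all≈even+even))

  -- Pairing l with p - l, (z + l)(z + p - l) = l(p - l) + z(z + p) depends on z only through z(z + p) ∈ p²ℤ₍ₚ₎.

  pairConstant : ℕ → K
  pairConstant l = ι l * (π - ι l)

  pairProduct : K → ℕ → K
  pairProduct s zero    = 1#
  pairProduct s (suc n) = pairProduct s n * (pairConstant (suc n) + s)

  poch-pairs : ∀ z n → poch (1# + z) n * poch (z + π - ι n) n ≡ pairProduct (z * (z + π)) n
  poch-pairs z zero = *-identityˡ _
  poch-pairs z (suc n) = begin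
    poch (1# + z) n * (1# + z + ι n) * poch (z + π - ι (suc n)) (suc n)
      ≡⟨ cong (λ x → poch (1# + z) n * (1# + z + ι n) * x) (poch-suc _ n) ⟩
    poch (1# + z) n * (1# + z + ι n) * ((z + π - ι (suc n)) * poch (1# + (z + π - ι (suc n))) n)
      ≡⟨ cong (λ x → poch (1# + z) n * (1# + z + ι n) * ((z + π - x) * poch (1# + (z + π - x)) n)) (ι-suc n) ⟩
    poch (1# + z) n * (1# + z + ι n) * ((z + π - (1# + ι n)) * poch (1# + (z + π - (1# + ι n))) n)
      ≡⟨ cong (λ x → poch (1# + z) n * (1# + z + ι n) * ((z + π - (1# + ι n)) * poch x n))
           (solve 3 (λ z p n → :1 :+ (z :+ p :- (:1 :+ n)) := z :+ p :- n) refl z π (ι n)) ⟩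
    poch (1# + z) n * (1# + z + ι n) * ((z + π - (1# + ι n)) * poch (z + π - ι n) n)
      ≡⟨ solve 5 (λ a b z p n → a :* (:1 :+ z :+ n) :* ((z :+ p :- (:1 :+ n)) :* b)
            := a :* b :* ((:1 :+ n) :* (p :- (:1 :+ n)) :+ z :* (z :+ p))) refl
           (poch (1# + z) n) (poch (z + π - ι n) n) z π (ι n) ⟩
    poch (1# + z) n * poch (z + π - ι n) n * ((1# + ι n) * (π - (1# + ι n)) + z * (z + π))
      ≡⟨ cong₂ (λ x y → x * (y * (π - y) + z * (z + π))) (poch-pairs z n) (sym (ι-suc n)) ⟩
    pairProduct (z * (z + π)) (suc n) ∎

  W : K → K
  W z = poch (1# + z) (m ℕ.+ m)

  W₀ : K
  W₀ = poch 1# (m ℕ.+ m)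

  W≡pairProduct : ∀ z → W z ≡ pairProduct (z * (z + π)) m
  W≡pairProduct z = begin
    poch (1# + z) (m ℕ.+ m) ≡⟨ poch-+ _ m m ⟩
    poch (1# + z) m * poch (1# + z + ι m) m
      ≡⟨ cong (λ x → poch (1# + z) m * poch x m) (trans
           (solve 2 (λ z m → :1 :+ z :+ m := z :+ (:1 :+ (m :+ m)) :- m) refl z (ι m)) (cong (λ x → z + x - ι m) (sym π≡1+2m))) ⟩
    poch (1# + z) m * poch (z + π - ι m) m ≡⟨ poch-pairs z m ⟩
    pairProduct (z * (z + π)) m ∎

  pairConstant-unit : ∀ i → i < m → Unit (pairConstant (suc i))
  pairConstant-unit i i<m = unit-* (unit-ι (suc i) (s≤s z≤n) 1+i<p) (unit-- (suc i) (s≤s z≤n) 1+i<p O1-π)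
    where
    1+i<p : suc i < p
    1+i<p = s≤s (ℕₚ.≤-trans i<m m≤2m)

  pairProduct-integral : ∀ {s} n → Integral s → Integral (pairProduct s n)
  pairProduct-integral zero h = integral-ι 1
  pairProduct-integral (suc n) h = integral-* (pairProduct-integral n h)
    (integral-+ (integral-* (integral-ι (suc n)) (integral-- (integral-ι p) (integral-ι (suc n)))) h)

  pairSum : ℕ → K
  pairSum n = sumTo n (λ i → inv (pairConstant (suc i)))

  -- Expansion to first order in s: what is dropped in each step is a multiple of s², hence of p⁴.
  pairProduct-expand : ∀ {s} n → n ≤ m → O 2 s → pairProduct s n ≈[ 3 ] pairProduct 0# n * (1# + s * pairSum n)
  pairProduct-expand {s} zero _ h = ≡⇒≈ (solve 1 (λ s → :1 := :1 :* (:1 :+ s :* :0)) refl s)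
  pairProduct-expand {s} (suc n) n<m h = ≈-trans
    (≈-* (integral-* iP (integral-+ (integral-ι 1) (integral-* is iS))) (integral-+ (integral-self uc) is) (pairProduct-expand n (ℕₚ.<⇒≤ n<m) h) ≈-refl)
    (subst (O 3) eq (O-*ˡ iP (O-*ʳ (O-weaken 1 (O-* h h)) iS)))
    where
    P = pairProduct 0# n
    S = pairSum n
    c = pairConstant (suc n)
    uc = pairConstant-unit n n<m
    is = O⇒integral h
    iP = pairProduct-integral n (integral-ι 0)
    iS : Integral S
    iS = O⇒integral (O-sum n (λ i i<n → integral⇒O0 (integral-inv (pairConstant-unit i (ℕₚ.<-trans i<n n<m)))))
    eq : P * (s * s * S) ≡ P * (1# + s * S) * (c + s) - P * (c + 0#) * (1# + s * (S + inv c))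
    eq = begin
      P * (s * s * S)
        ≡⟨ solve 4 (λ P s S c → P :* (s :* s :* S) := P :* (:1 :+ s :* S) :* (c :+ s) :- P :* (c :+ c :* s :* S :+ s :* :1)) refl P s S c ⟩
      P * (1# + s * S) * (c + s) - P * (c + c * s * S + s * 1#)
        ≡⟨ cong (λ x → P * (1# + s * S) * (c + s) - P * (c + c * s * S + s * x)) (inv-r (nonzero uc)) ⟨
      P * (1# + s * S) * (c + s) - P * (c + c * s * S + s * (c * inv c))
        ≡⟨ cong (λ x → P * (1# + s * S) * (c + s) - x)
             (solve 5 (λ P s S c i → P :* (c :+ c :* s :* S :+ s :* (c :* i)) := P :* (c :+ :0) :* (:1 :+ s :* (S :+ i))) refl P s S c (inv c)) ⟩
      P * (1# + s * S) * (c + s) - P * (c + 0#) * (1# + s * (S + inv c)) ∎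

  -- Since l (p - l) ≡ -l² modulo p, this is minus the sum of the inverse squares up to m.
  pairSum-O1 : O 1 (pairSum m)
  pairSum-O1 = O-resp-≈ (≈-sum m termwise) (subst (O 1) eq (O-neg half-inverseSquares-O1))
    where
    minusOne : K
    minusOne = ⟦ ℤ.- (ℤ.+ 1) ⟧
    eq : - half-inverseSquares ≡ sumTo m (λ i → minusOne * inverseSquare (suc i))
    eq = trans (solve 1 (λ h → :- h := con (ℤ.- (ℤ.+ 1)) :* h) refl half-inverseSquares) (sumTo-*ˡ m minusOne (λ i → inverseSquare (suc i)))
    termwise : ∀ i → i < m → inv (pairConstant (suc i)) ≈[ 1 ] minusOne * inverseSquare (suc i)
    termwise i i<m = subst (λ x → inv (pairConstant (suc i)) ≈[ 1 ] x) inv-square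
      (≈-inv (pairConstant-unit i i<m) u (subst (O 1) (solve 2 (λ p l → l :* p := l :* (p :- l) :- con (ℤ.- (ℤ.+ 1)) :* (l :* l)) refl π l) (O-*ˡ (integral-ι (suc i)) O1-π)))
      where
      l = ι (suc i)
      ul : Unit l
      ul = unit-ι (suc i) (s≤s z≤n) (s≤s (ℕₚ.≤-trans i<m m≤2m))
      minusOne² : minusOne * minusOne ≡ 1#
      minusOne² = solve 0 (con (ℤ.- (ℤ.+ 1)) :* con (ℤ.- (ℤ.+ 1)) := :1) refl
      u : Unit (minusOne * (l * l))
      u = unit-* (unit (λ eq → 1≢0 (trans (sym minusOne²) (trans (cong (_* minusOne) eq) (zeroˡ _)))) (integral-⟦⟧ _) (subst Integral (sym (inv-unique minusOne²)) (integral-⟦⟧ _))) (unit-* ul ul)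
      inv-square : inv (minusOne * (l * l)) ≡ minusOne * inverseSquare (suc i)
      inv-square = trans (inv-* _ _) (cong (_* inv (l * l)) (inv-unique minusOne²))

  -- Wolstenholme's theorem with a shift. By the pairing, W z is a polynomial in s = z (z + p) ∈
  -- p²ℤ₍ₚ₎, and its linear coefficient W₀ · `pairSum m` is divisible by p.
  W≈W₀ : ∀ {z} → O 1 z → W z ≈[ 3 ] W₀
  W≈W₀ {z} h = ≈-resp-≡ (sym (W≡pairProduct z)) (sym W₀≡pairProduct)
    (≈-trans (pairProduct-expand m ℕₚ.≤-refl hs)
      (subst (O 3) (solve 2 (λ a b → a :* b := a :* (:1 :+ b) :- a) refl (pairProduct 0# m) (s * pairSum m)) (O-*ˡ (pairProduct-integral m (integral-ι 0)) (O-* hs pairSum-O1))))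
    where
    s = z * (z + π)
    hs : O 2 s
    hs = O-* h (O-+ h O1-π)
    W₀≡pairProduct : W₀ ≡ pairProduct 0# m
    W₀≡pairProduct = trans (cong (λ x → poch x (m ℕ.+ m)) (sym (+-identityʳ 1#))) (trans (W≡pairProduct 0#) (cong (λ x → pairProduct x m) (zeroˡ _)))

  poch-unit-1+ : ∀ n {z} → n ≤ m ℕ.+ m → O 1 z → Unit (poch (1# + z) n)
  poch-unit-1+ n n≤2m h = poch-unit-+ 1 n ℕₚ.≤-refl (s≤s n≤2m) h

  W-unit : ∀ {z} → O 1 z → Unit (W z)
  W-unit h = poch-unit-1+ (m ℕ.+ m) ℕₚ.≤-refl h

  W₀-unit : Unit W₀
  W₀-unit = subst (λ x → Unit (poch x (m ℕ.+ m))) (+-identityʳ 1#) (W-unit (O-0 1))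

  -- The product of 1 - δ² / (x + l)² over 1 ≤ l ≤ n.
  evenRatio : ℕ → K → K → K
  evenRatio n x δ = poch (1# + x + δ) n * poch (1# + x - δ) n * inv (poch (1# + x) n * poch (1# + x) n)

  -- In each factor 1 - δ² / (x + l)², the square δ² is divisible by p², and 1 / (x + l)² modulo p
  -- is the same for all x ∈ pℤ₍ₚ₎.
  evenRatio-flat : ∀ n {x y δ} → n ≤ m ℕ.+ m → O 1 x → O 1 y → O 1 δ → Flat (evenRatio n x δ) (evenRatio n y δ)
  evenRatio-flat zero {x} {y} {δ} _ hx hy hδ = subst (λ t → Flat t t) (sym eq) flat-1
    where
    eq : 1# * 1# * inv (1# * 1#) ≡ 1#
    eq = inv-r (λ e → 1≢0 (trans (sym (*-identityˡ 1#)) e))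
  evenRatio-flat (suc n) {x} {y} {δ} n<2m hx hy hδ =
    subst₂ Flat (sym (factorise x)) (sym (factorise y)) (flat-* (evenRatio-flat n (ℕₚ.<⇒≤ n<2m) hx hy hδ) factor-flat)
    where
    factor : K → K
    factor x = (1# + x + δ + ι n) * (1# + x - δ + ι n) * inv ((1# + x + ι n) * (1# + x + ι n))
    factorise : ∀ x → evenRatio (suc n) x δ ≡ evenRatio n x δ * factor x
    factorise x = begin
      a * u * (b * v) * inv (c * w * (c * w))
        ≡⟨ cong (λ i → a * u * (b * v) * i) (trans (cong inv (solve 2 (λ c w → c :* w :* (c :* w) := c :* c :* (w :* w)) refl c w)) (inv-* _ _)) ⟩
      a * u * (b * v) * (inv (c * c) * inv (w * w))
        ≡⟨ solve 6 (λ a u b v i j → a :* u :* (b :* v) :* (i :* j) := a :* b :* i :* (u :* v :* j)) refl a u b v (inv (c * c)) (inv (w * w)) ⟩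
      evenRatio n x δ * factor x ∎
      where
      a = poch (1# + x + δ) n
      b = poch (1# + x - δ) n
      c = poch (1# + x) n
      u = 1# + x + δ + ι n
      v = 1# + x - δ + ι n
      w = 1# + x + ι n
    u : ∀ {x} → O 1 x → Unit (1# + x + ι n)
    u {x} h = subst Unit (trans (cong (_+ x) (ι-suc n)) (solve 2 (λ n x → :1 :+ n :+ x := :1 :+ x :+ n) refl (ι n) x))
      (unit-+ (suc n) (s≤s z≤n) (s≤s n<2m) h)
    factor≡ : ∀ {x} → O 1 x → factor x ≡ 1# - δ * δ * inv ((1# + x + ι n) * (1# + x + ι n))
    factor≡ {x} h = trans
      (solve 4 (λ x d n i → (:1 :+ x :+ d :+ n) :* (:1 :+ x :- d :+ n) :* i
         := (:1 :+ x :+ n) :* (:1 :+ x :+ n) :* i :- d :* d :* i) refl x δ (ι n) (inv ((1# + x + ι n) * (1# + x + ι n))))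
      (cong (_- δ * δ * inv ((1# + x + ι n) * (1# + x + ι n))) (inv-r (nonzero (unit-* (u h) (u h)))))
    factor≈1 : ∀ {x} → O 1 x → factor x ≈[ 2 ] 1#
    factor≈1 {x} h = subst (O 2)
      (trans (solve 1 (λ t → :- t := :1 :- t :- :1) refl _) (cong (_- 1#) (sym (factor≡ h))))
      (O-neg (O-*ʳ (O-* hδ hδ) (integral-inv (unit-* (u h) (u h)))))
    factor-flat : Flat (factor x) (factor y)
    factor-flat = flat (factor≈1 hx) (factor≈1 hy) (≈-resp-≡ (sym (factor≡ hx)) (sym (factor≡ hy))
      (subst (O 3) (solve 3 (λ d i j → :- (d :* (i :- j)) := :1 :- d :* i :- (:1 :- d :* j)) refl (δ * δ) _ _)
        (O-neg (O-* (O-* hδ hδ) (≈-inv (unit-* (u hx) (u hx)) (unit-* (u hy) (u hy)) u≈u)))))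
      where
      shift : 1# + x + ι n ≈[ 1 ] 1# + y + ι n
      shift = ≈-+ (≈-+ ≈-refl (O⇒≈ hx hy)) ≈-refl
      u≈u = ≈-* (integral-self (u hy)) (integral-self (u hx)) shift shift

  -- Factorials and Pochhammer symbols in blocks of p factors

  X : ℕ → K
  X b = ι (b ℕ.* p)

  X-suc : ∀ b → X (suc b) ≡ π + X b
  X-suc b = ι-+ p (b ℕ.* p)

  X≡ : ∀ b → X b ≡ ι b * π
  X≡ b = ι-* b p

  O1-X : ∀ b → O 1 (X b)
  O1-X b = subst (O 1) (trans (*-comm _ _) (sym (X≡ b))) (O1-π* (integral-ι b))

  W₀^ : ℕ → K
  W₀^ zero    = 1#
  W₀^ (suc b) = W₀^ b * W₀

  W₀^-unit : ∀ b → Unit (W₀^ b)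
  W₀^-unit zero    = unit-1
  W₀^-unit (suc b) = unit-* (W₀^-unit b) W₀-unit

  poch-X-suc : ∀ a b → poch a (suc b ℕ.* p) ≡ poch a (b ℕ.* p) * poch (a + X b) p
  poch-X-suc a b = trans (cong (poch a) (ℕₚ.+-comm p (b ℕ.* p))) (poch-+ a (b ℕ.* p) p)

  -- The factors p, 2p, ..., bp of (bp)! make up p^b b!. Before each of them stand p - 1 factors
  -- with product W (X i) for some i < b, which is W₀ modulo p³.
  record FactorialBlock (b : ℕ) : Set where
    field
      B        : K
      B-unit   : Unit B
      factorial : poch 1# (b ℕ.* p) ≡ π^ b * poch 1# b * B
      B≈       : B ≈[ 3 ] W₀^ b

  factorialBlock : ∀ b → FactorialBlock b
  factorialBlock zero = record
    { B = 1# ; B-unit = unit-1 ; factorial = solve 0 (:1 := :1 :* :1 :* :1) refl ; B≈ = ≈-refl }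
  factorialBlock (suc b) = record
    { B = B * W (X b)
    ; B-unit = unit-* B-unit (W-unit (O1-X b))
    ; factorial = begin
        poch 1# (suc b ℕ.* p) ≡⟨ poch-X-suc 1# b ⟩
        poch 1# (b ℕ.* p) * (W (X b) * (1# + X b + ι (m ℕ.+ m)))
          ≡⟨ cong₂ (λ u v → u * (W (X b) * v)) factorial last ⟩
        π^ b * poch 1# b * B * (W (X b) * ((1# + ι b) * π))
          ≡⟨ solve 6 (λ q f B w b p → q :* f :* B :* (w :* ((:1 :+ b) :* p)) := p :* q :* (f :* (:1 :+ b)) :* (B :* w))
               refl (π^ b) (poch 1# b) B (W (X b)) (ι b) π ⟩
        π^ (suc b) * poch 1# (suc b) * (B * W (X b)) ∎
    ; B≈ = ≈-* (integral-self (W₀^-unit b)) (integral-self (W-unit (O1-X b))) B≈ (W≈W₀ (O1-X b))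
    }
    where
    open FactorialBlock (factorialBlock b)
    last : 1# + X b + ι (m ℕ.+ m) ≡ (1# + ι b) * π
    last = begin
      1# + X b + ι (m ℕ.+ m) ≡⟨ solve 2 (λ x y → :1 :+ x :+ y := x :+ (:1 :+ y)) refl (X b) (ι (m ℕ.+ m)) ⟩
      X b + (1# + ι (m ℕ.+ m)) ≡⟨ cong₂ _+_ (X≡ b) (sym (ι-suc (m ℕ.+ m))) ⟩
      ι b * π + π ≡⟨ solve 2 (λ b p → b :* p :+ p := (:1 :+ b) :* p) refl (ι b) π ⟩
      (1# + ι b) * π ∎

  -- Among the first b p factors of (κ - e)_k, where κ = p ρ, the multiples of p make up p^b (ρ)_b,
  -- and similarly for (1 + e - κ)_k and (1 - ρ)_b; the remaining factors telescope modulo p³.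
  module PochhammerBlock (ρ : K) (integral-ρ : Integral ρ) (e f : ℕ) (e+f≡2m : e ℕ.+ f ≡ m ℕ.+ m) where
    κ : K
    κ = π * ρ

    O1-κ : O 1 κ
    O1-κ = O1-π* integral-ρ

    e≤2m : e ≤ m ℕ.+ m
    e≤2m = subst (e ≤_) e+f≡2m (ℕₚ.m≤m+n e f)

    -- Joining the factors after one multiple of p with those before the next gives complete
    -- products W. At the end x = p b there remain, as a surplus, the e factors after the last
    -- multiple in the symbol starting at 1 + e - κ and, as a deficit, the e factors before the next
    -- multiple in the symbol starting at κ - e.
    telescope : K → K
    telescope x = poch (1# + (x - κ)) e * inv (poch (x + κ - ι e) e)

    -- Surplus and deficit at the beginning: the e factors before κ and the e factors after -κ.
    -- Hence its product with `telescope` at 0 is 1.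
    constant : K
    constant = poch (κ - ι e) e * inv (poch (1# - κ) e)

    poch-below-unit : ∀ {z} → O 1 z → Unit (poch (z - ι e) e)
    poch-below-unit = poch-unit-- e e ℕₚ.≤-refl (s≤s e≤2m)

    telescope-unit : ∀ {x} → O 1 x → Unit (telescope x)
    telescope-unit h = unit-* (poch-unit-1+ e e≤2m (O-- h O1-κ)) (unit-inv (poch-below-unit (O-+ h O1-κ)))

    constant-unit : Unit constant
    constant-unit = unit-* (poch-below-unit O1-κ) (unit-inv (poch-unit-1+ e e≤2m (O-neg O1-κ)))

    record Block (b : ℕ) : Set where
      field
        A       : K
        A-unit  : Unit A
        product : poch (κ - ι e) (b ℕ.* p) * poch (1# + ι e - κ) (b ℕ.* p) ≡ π^ b * π^ b * (poch ρ b * poch (1# - ρ) b) * A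
        A≈      : A ≈[ 3 ] W₀^ b * W₀^ b * (constant * telescope (X b))

    ι-e+f : ι e + ι f ≡ ι (m ℕ.+ m)
    ι-e+f = trans (sym (ι-+ e f)) (cong ι e+f≡2m)

    π≡ : π ≡ 1# + (ι e + ι f)
    π≡ = trans (ι-suc (m ℕ.+ m)) (cong (1# +_) (sym ι-e+f))

    p≡suc-f+e : p ≡ suc f ℕ.+ e
    p≡suc-f+e = cong suc (trans (sym e+f≡2m) (ℕₚ.+-comm e f))

    p≡e+suc-f : p ≡ e ℕ.+ suc f
    p≡e+suc-f = trans (cong suc (sym e+f≡2m)) (sym (ℕₚ.+-suc e f))

    lower : ∀ z → poch (z - ι e) p ≡ poch (z - ι e) e * (z * poch (1# + z) f)
    lower z = begin
      poch (z - ι e) p                                 ≡⟨ cong (poch (z - ι e)) p≡e+suc-f ⟩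
      poch (z - ι e) (e ℕ.+ suc f)                     ≡⟨ poch-+ _ e (suc f) ⟩
      poch (z - ι e) e * poch (z - ι e + ι e) (suc f)  ≡⟨ cong (λ u → poch (z - ι e) e * poch u (suc f)) (solve 2 (λ z e → z :- e :+ e := z) refl z (ι e)) ⟩
      poch (z - ι e) e * poch z (suc f)                ≡⟨ cong (poch (z - ι e) e *_) (poch-suc z f) ⟩
      poch (z - ι e) e * (z * poch (1# + z) f)         ∎

    upper : ∀ z → poch (1# + ι e + z) p ≡ poch (1# + ι e + z) f * (z + π) * poch (1# + (z + π)) e
    upper z = begin
      poch (1# + ι e + z) p ≡⟨ cong (poch (1# + ι e + z)) p≡suc-f+e ⟩
      poch (1# + ι e + z) (suc f ℕ.+ e) ≡⟨ poch-+ _ (suc f) e ⟩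
      poch (1# + ι e + z) f * (1# + ι e + z + ι f) * poch (1# + ι e + z + ι (suc f)) e
        ≡⟨ cong₂ (λ u v → poch (1# + ι e + z) f * u * poch v e) eq₁ eq₂ ⟩
      poch (1# + ι e + z) f * (z + π) * poch (1# + (z + π)) e ∎
      where
      eq₁ : 1# + ι e + z + ι f ≡ z + π
      eq₁ = trans (solve 3 (λ e f z → :1 :+ e :+ z :+ f := z :+ (:1 :+ (e :+ f))) refl (ι e) (ι f) z) (cong (z +_) (sym π≡))
      eq₂ : 1# + ι e + z + ι (suc f) ≡ 1# + (z + π)
      eq₂ = trans (cong (1# + ι e + z +_) (ι-suc f))
        (trans (solve 3 (λ e f z → :1 :+ e :+ z :+ (:1 :+ f) := :1 :+ (z :+ (:1 :+ (e :+ f)))) refl (ι e) (ι f) z)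
          (cong (λ u → 1# + (z + u)) (sym π≡)))

    -- The f factors after the multiple z of p are completed by the e factors before z + p, which
    -- belong to the next block.
    W-lower : ∀ z → poch (1# + z) f * poch (π + z - ι e) e ≡ W z
    W-lower z = begin
      poch (1# + z) f * poch (π + z - ι e) e ≡⟨ cong (λ u → poch (1# + z) f * poch u e) eq ⟩
      poch (1# + z) f * poch (1# + z + ι f) e ≡⟨ poch-+ _ f e ⟨
      poch (1# + z) (f ℕ.+ e) ≡⟨ cong (poch (1# + z)) (trans (ℕₚ.+-comm f e) e+f≡2m) ⟩
      W z ∎
      where
      eq : π + z - ι e ≡ 1# + z + ι f
      eq = trans (cong (λ u → u + z - ι e) π≡) (solve 3 (λ e f z → :1 :+ (e :+ f) :+ z :- e := :1 :+ z :+ f) refl (ι e) (ι f) z)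

    W-upper : ∀ z → poch (1# + z) e * poch (1# + ι e + z) f ≡ W z
    W-upper z = begin
      poch (1# + z) e * poch (1# + ι e + z) f ≡⟨ cong (λ u → poch (1# + z) e * poch u f) (solve 2 (λ e z → :1 :+ e :+ z := :1 :+ z :+ e) refl (ι e) z) ⟩
      poch (1# + z) e * poch (1# + z + ι e) f ≡⟨ poch-+ _ e f ⟨
      poch (1# + z) (e ℕ.+ f) ≡⟨ cong (poch (1# + z)) e+f≡2m ⟩
      W z ∎

    block : ∀ b → Block b
    block zero = record
      { A = 1#
      ; A-unit = unit-1
      ; product = solve 0 (:1 :* :1 := :1 :* :1 :* (:1 :* :1) :* :1) refl
      ; A≈ = ≡⇒≈ (sym normalised)
      }
      where
      c₁ = poch (κ - ι e) e
      c₂ = poch (1# - κ) e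
      normalised : 1# * 1# * (constant * telescope (X 0)) ≡ 1#
      normalised = begin
        1# * 1# * (c₁ * inv c₂ * (poch (1# + (0# - κ)) e * inv (poch (0# + κ - ι e) e)))
          ≡⟨ cong₂ (λ u v → 1# * 1# * (c₁ * inv c₂ * (poch u e * inv (poch v e))))
               (solve 1 (λ k → :1 :+ (:0 :- k) := :1 :- k) refl κ)
               (solve 2 (λ k e → :0 :+ k :- e := k :- e) refl κ (ι e)) ⟩
        1# * 1# * (c₁ * inv c₂ * (c₂ * inv c₁))
          ≡⟨ solve 4 (λ a i b j → :1 :* :1 :* (a :* i :* (b :* j)) := a :* j :* (b :* i)) refl c₁ (inv c₂) c₂ (inv c₁) ⟩
        c₁ * inv c₁ * (c₂ * inv c₂)
          ≡⟨ cong₂ _*_ (inv-r (nonzero (poch-below-unit O1-κ))) (inv-r (nonzero (poch-unit-1+ e e≤2m (O-neg O1-κ)))) ⟩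
        1# * 1# ≡⟨ *-identityˡ _ ⟩
        1# ∎
    block (suc b) = record
      { A = A * ratio
      ; A-unit = unit-* A-unit ratio-unit
      ; product = product-suc
      ; A≈ = ≈-trans (≈-* (integral-* (integral-* iV iV) (integral-* (integral-self constant-unit) (integral-self (telescope-unit hx)))) (integral-self ratio-unit) A≈ ≈-refl)
          (≈-trans (≡⇒≈ regroup)
            (≈-trans (≈-* (integral-* iW₀ iW₀) iR (≈-* iW₀ (integral-self (W-unit hz′)) (W≈W₀ hz) (W≈W₀ hz′)) ≈-refl)
              (≡⇒≈ (solve 4 (λ w v c t → w :* w :* (v :* v :* (c :* t)) := v :* w :* (v :* w) :* (c :* t)) refl W₀ (W₀^ b) constant (telescope (X (suc b)))))))
      }
      where
      open Block (block b)
      x = X b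
      z = x + κ
      z′ = x - κ
      hx = O1-X b
      hz = O-+ hx O1-κ
      hz′ = O-- hx O1-κ
      iV = integral-self (W₀^-unit b)
      iW₀ = integral-self W₀-unit
      p₁ = poch (z - ι e) e
      p₂ = poch (1# + z) f
      p₃ = poch (1# + ι e + z′) f
      p₄ = poch (1# + (z′ + π)) e
      ratio = p₁ * p₂ * (p₃ * p₄)
      iR : Integral (W₀^ b * W₀^ b * (constant * telescope (X (suc b))))
      iR = integral-* (integral-* iV iV) (integral-* (integral-self constant-unit) (integral-self (telescope-unit (O1-X (suc b)))))
      f≤2m : f ≤ m ℕ.+ m
      f≤2m = subst (f ≤_) e+f≡2m (ℕₚ.m≤n+m f e)
      ratio-unit : Unit ratio
      ratio-unit = unit-* (unit-* (poch-below-unit hz) (poch-unit-1+ f f≤2m hz))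
        (unit-* (subst (λ u → Unit (poch (u + z′) f)) (ι-suc e) (poch-unit-+ (suc e) f (s≤s z≤n) (ℕₚ.≤-reflexive (cong suc e+f≡2m)) hz′))
          (poch-unit-1+ e e≤2m (O-+ hz′ O1-π)))
      product-suc : poch (κ - ι e) (suc b ℕ.* p) * poch (1# + ι e - κ) (suc b ℕ.* p)
        ≡ π^ (suc b) * π^ (suc b) * (poch ρ (suc b) * poch (1# - ρ) (suc b)) * (A * ratio)
      product-suc = begin
        poch (κ - ι e) (suc b ℕ.* p) * poch (1# + ι e - κ) (suc b ℕ.* p)
          ≡⟨ cong₂ _*_
               (trans (poch-X-suc _ b) (cong (l₀ *_) (trans (cong (λ u → poch u p) (solve 3 (λ k e x → k :- e :+ x := x :+ k :- e) refl κ (ι e) x)) (lower z))))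
               (trans (poch-X-suc _ b) (cong (u₀ *_) (trans (cong (λ u → poch u p) (solve 3 (λ k e x → :1 :+ e :- k :+ x := :1 :+ e :+ (x :- k)) refl κ (ι e) x)) (upper z′)))) ⟩
        l₀ * (p₁ * (z * p₂)) * (u₀ * (p₃ * (z′ + π) * p₄))
          ≡⟨ cong₂ (λ v w → l₀ * (p₁ * (v * p₂)) * (u₀ * (p₃ * w * p₄)))
               (trans (cong (_+ κ) (X≡ b)) (solve 3 (λ b p r → b :* p :+ p :* r := p :* (r :+ b)) refl (ι b) π ρ))
               (trans (cong (λ v → v - κ + π) (X≡ b)) (solve 3 (λ b p r → b :* p :- p :* r :+ p := p :* (:1 :- r :+ b)) refl (ι b) π ρ)) ⟩
        l₀ * (p₁ * (π * (ρ + ι b) * p₂)) * (u₀ * (p₃ * (π * (1# - ρ + ι b)) * p₄))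
          ≡⟨ solve 9 (λ l u a b c d p r s → l :* (a :* (p :* r :* b)) :* (u :* (c :* (p :* s) :* d)) := l :* u :* (p :* p :* r :* s :* (a :* b :* (c :* d))))
               refl l₀ u₀ p₁ p₂ p₃ p₄ π (ρ + ι b) (1# - ρ + ι b) ⟩
        l₀ * u₀ * (π * π * (ρ + ι b) * (1# - ρ + ι b) * ratio)
          ≡⟨ cong (_* (π * π * (ρ + ι b) * (1# - ρ + ι b) * ratio)) product ⟩
        π^ b * π^ b * (poch ρ b * poch (1# - ρ) b) * A * (π * π * (ρ + ι b) * (1# - ρ + ι b) * ratio)
          ≡⟨ solve 8 (λ q v w a p r s t → q :* q :* (v :* w) :* a :* (p :* p :* r :* s :* t) := p :* q :* (p :* q) :* (v :* r :* (w :* s)) :* (a :* t))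
               refl (π^ b) (poch ρ b) (poch (1# - ρ) b) A π (ρ + ι b) (1# - ρ + ι b) ratio ⟩
        π^ (suc b) * π^ (suc b) * (poch ρ (suc b) * poch (1# - ρ) (suc b)) * (A * ratio) ∎
        where
        l₀ = poch (κ - ι e) (b ℕ.* p)
        u₀ = poch (1# + ι e - κ) (b ℕ.* p)
      q₁ = poch (1# + z′) e
      q₂ = poch (π + z - ι e) e
      telescope-suc : telescope (X (suc b)) ≡ p₄ * inv q₂
      telescope-suc = cong₂ (λ u v → poch u e * inv (poch v e))
        (trans (cong (λ v → 1# + (v - κ)) (X-suc b)) (solve 3 (λ x k p → :1 :+ (p :+ x :- k) := :1 :+ (x :- k :+ p)) refl x κ π))
        (trans (cong (λ v → v + κ - ι e) (X-suc b)) (solve 4 (λ x k p e → p :+ x :+ k :- e := p :+ (x :+ k) :- e) refl x κ π (ι e)))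
      q₂-unit : Unit q₂
      q₂-unit = poch-below-unit (O-+ O1-π hz)
      -- Here p₁ pays back the deficit at x, p₃ completes the surplus q₁ of the earlier blocks to W
      -- z′, and p₂ becomes W z by borrowing q₂, the deficit at the next boundary. The surplus there
      -- is p₄.
      regroup : W₀^ b * W₀^ b * (constant * telescope x) * ratio ≡ W z * W z′ * (W₀^ b * W₀^ b * (constant * telescope (X (suc b))))
      regroup = begin
        V * (c * (q₁ * inv p₁)) * (p₁ * p₂ * (p₃ * p₄))
          ≡⟨ solve 8 (λ V c q i p₁ p₂ p₃ p₄ → V :* (c :* (q :* i)) :* (p₁ :* p₂ :* (p₃ :* p₄)) := p₁ :* i :* (p₂ :* (q :* p₃) :* (V :* (c :* p₄))))
               refl V c q₁ (inv p₁) p₁ p₂ p₃ p₄ ⟩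
        p₁ * inv p₁ * (p₂ * (q₁ * p₃) * (V * (c * p₄)))
          ≡⟨ cong₂ (λ u v → u * (p₂ * v * (V * (c * p₄)))) (trans (inv-r (nonzero (poch-below-unit hz))) (sym (inv-r (nonzero q₂-unit)))) (W-upper z′) ⟩
        q₂ * inv q₂ * (p₂ * W z′ * (V * (c * p₄)))
          ≡⟨ solve 7 (λ q i p₂ w V c p₄ → q :* i :* (p₂ :* w :* (V :* (c :* p₄))) := p₂ :* q :* w :* (V :* (c :* (p₄ :* i))))
               refl q₂ (inv q₂) p₂ (W z′) V c p₄ ⟩
        p₂ * q₂ * W z′ * (V * (c * (p₄ * inv q₂)))
          ≡⟨ cong₂ (λ u v → u * W z′ * (V * (c * v))) (W-lower z) (sym telescope-suc) ⟩
        W z * W z′ * (V * (c * telescope (X (suc b)))) ∎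
        where
        V = W₀^ b * W₀^ b
        c = constant

  -- The rational function R and its residues

  poch-zero : ∀ n a → n < a → poch (0# - ι n) a ≡ 0#
  poch-zero n (suc a) (s≤s n≤a) with n ℕ.≟ a
  ... | yes refl = trans (cong (poch (0# - ι n) n *_) (solve 1 (λ n → :0 :- n :+ n := :0) refl (ι n))) (zeroʳ _)
  ... | no n≢a = trans (cong (_* (0# - ι n + ι a)) (poch-zero n a (ℕₚ.≤∧≢⇒< n≤a n≢a))) (zeroˡ _)

  -- z / Π (t + … - l) over 0 ≤ l ≤ n in a form without the removable singularity at z = 0.
  cancelled : ℕ → ℕ → K → K
  cancelled n a z = poch (z - ι n) a * inv (poch (z - ι n) n) * inv (poch (1# + z) a)

  -- Splitting the symbol of length a + n + 1 starting at z - n once after a and once after n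
  -- factors expresses the denominator by units and the single factor z.
  cancelled≡ : ∀ n a {z} → n ≤ m ℕ.+ m → a ≤ m ℕ.+ m → O 1 z → z ≢ 0# →
    z * inv (poch (ι a + z - ι n) (suc n)) ≡ cancelled n a z
  cancelled≡ n a {z} n≤2m a≤2m hz z≢0 = trans (fraction-≡ P≢0 (*-nonzero u≢0 v≢0) cross) (trans (cong (poch (z - ι n) a *_) (inv-* _ _)) (sym (*-assoc _ _ _)))
    where
    P = poch (ι a + z - ι n) (suc n)
    u = poch (z - ι n) n
    v = poch (1# + z) a
    u≢0 : u ≢ 0#
    u≢0 = nonzero (poch-unit-- n n ℕₚ.≤-refl (s≤s n≤2m) hz)
    v≢0 : v ≢ 0#
    v≢0 = nonzero (poch-unit-1+ a a≤2m hz)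
    both : poch (z - ι n) a * P ≡ u * (z * v)
    both = begin
      poch (z - ι n) a * P ≡⟨ cong (λ w → poch (z - ι n) a * poch w (suc n)) (solve 3 (λ a z n → a :+ z :- n := z :- n :+ a) refl (ι a) z (ι n)) ⟩
      poch (z - ι n) a * poch (z - ι n + ι a) (suc n) ≡⟨ poch-+ _ a (suc n) ⟨
      poch (z - ι n) (a ℕ.+ suc n) ≡⟨ cong (poch (z - ι n)) (trans (ℕₚ.+-suc a n) (trans (cong suc (ℕₚ.+-comm a n)) (sym (ℕₚ.+-suc n a)))) ⟩
      poch (z - ι n) (n ℕ.+ suc a) ≡⟨ poch-+ _ n (suc a) ⟩
      u * poch (z - ι n + ι n) (suc a) ≡⟨ cong (λ w → u * poch w (suc a)) (solve 2 (λ z n → z :- n :+ n := z) refl z (ι n)) ⟩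
      u * poch z (suc a) ≡⟨ cong (u *_) (poch-suc z a) ⟩
      u * (z * v) ∎
    P≢0 : P ≢ 0#
    P≢0 P≡0 = *-nonzero u≢0 (*-nonzero z≢0 v≢0) (trans (sym both) (trans (cong (poch (z - ι n) a *_) P≡0) (zeroʳ _)))
    cross : z * (u * v) ≡ poch (z - ι n) a * P
    cross = trans (solve 3 (λ z u v → z :* (u :* v) := u :* (z :* v)) refl z u v) (sym both)

  -- At z = 0 the cancelled quotient is what the residue at a pole picks up from the other poles of
  -- its own progression. This is how residues become values of `Y`.
  weight≡cancelled : ∀ n a → a ≤ n → n ≤ m ℕ.+ m → weight n a ≡ cancelled n a 0#
  weight≡cancelled n a a≤n n≤2m = begin
    inv (poch 1# a) * inv q
      ≡⟨ cong₂ (λ u v → inv (poch u a) * v) (sym (+-identityʳ 1#)) inv-q ⟩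
    inv (poch (1# + 0#) a) * (w * inv (poch (0# - ι n) n))
      ≡⟨ *-comm _ _ ⟩
    cancelled n a 0# ∎
    where
    k = n ℕ.∸ a
    q = poch (- ι k) k
    w = poch (0# - ι n) a
    wq : poch (0# - ι n) n ≡ w * q
    wq = begin
      poch (0# - ι n) n ≡⟨ cong (poch (0# - ι n)) (sym (ℕₚ.m+[n∸m]≡n a≤n)) ⟩
      poch (0# - ι n) (a ℕ.+ k) ≡⟨ poch-+ _ a k ⟩
      w * poch (0# - ι n + ι a) k ≡⟨ cong (λ u → w * poch u k)
         (trans (solve 2 (λ n a → :0 :- n :+ a := :- (n :- a)) refl (ι n) (ι a)) (cong -_ (sym (ι-∸ a≤n)))) ⟩
      w * q ∎
    nz : w * q ≢ 0#
    nz = subst (_≢ 0#) wq (nonzero (poch-unit-- n n ℕₚ.≤-refl (s≤s n≤2m) (O-0 1)))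
    w≢0 : w ≢ 0#
    w≢0 = factorˡ-nonzero nz
    inv-q : inv q ≡ w * inv (poch (0# - ι n) n)
    inv-q = begin
      inv q ≡⟨ *-identityˡ _ ⟨
      1# * inv q ≡⟨ cong (_* inv q) (inv-r w≢0) ⟨
      w * inv w * inv q ≡⟨ *-assoc _ _ _ ⟩
      w * (inv w * inv q) ≡⟨ cong (w *_) (trans (sym (inv-* w q)) (cong inv (sym wq))) ⟩
      w * inv (poch (0# - ι n) n) ∎

  All-progression : ∀ {P : K → Set} n s → (∀ j → j < n → P (ι j + s)) → All P (progression n s)
  All-progression zero    s h = []
  All-progression (suc n) s h = h n ℕₚ.≤-refl ∷ All-progression n s (λ j j<n → h j (ℕₚ.m<n⇒m<1+n j<n))

  ι-difference : ∀ {i j} → j < i → ι i - ι j ≡ ι (suc (i ℕ.∸ suc j))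
  ι-difference {i} {j} j<i = trans (sym (ι-∸ (ℕₚ.<⇒≤ j<i))) (cong ι (ℕₚ.+-∸-assoc 1 j<i))

  Unique-progression : ∀ n s → Unique (progression n s)
  Unique-progression zero    s = []
  Unique-progression (suc n) s = All-progression n s distinct ∷ Unique-progression n s
    where
    distinct : ∀ j → j < n → ι n + s ≢ ι j + s
    distinct j j<n eq = ι≢0 _ (begin
      ι (suc (n ℕ.∸ suc j)) ≡⟨ ι-difference j<n ⟨
      ι n - ι j ≡⟨ solve 3 (λ n s j → n :- j := n :+ s :- (j :+ s)) refl (ι n) s (ι j) ⟩
      ι n + s - (ι j + s) ≡⟨ cong (_- (ι j + s)) eq ⟩
      ι j + s - (ι j + s) ≡⟨ -‿inverseʳ _ ⟩
      0# ∎)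

  -- The rational function of t = a + x in the header: h and κ are free perturbations of
  -- the poles, and the factor (x + h)(x + κ) removes the poles at x = - h and x = - κ.
  module RationalSummand (e g′ : ℕ) (e≤m : e ≤ m) (g≤e : suc g′ ≤ e) (κ θ : K) (O1-κ : O 1 κ) (O1-θ : O 1 θ) where
    g : ℕ
    g = suc g′

    e≤2m : e ≤ m ℕ.+ m
    e≤2m = ℕₚ.≤-trans e≤m m≤2m

    poleFactor : ℕ → ℕ → K → K → K
    poleFactor n a η x = poch (1# + (ι a + x) - η) n * cancelled n a (x + η)

    zeroFactor : ℕ → K → K
    zeroFactor a x = poch (1# + (ι a + x + θ) - ι g) g * inv (poch (1# + (ι a + x) - θ) g)

    Y : K → ℕ → K → K
    Y h a x = poleFactor m a h x * poleFactor e a κ x * zeroFactor a x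

    module _ (h : K) (O1-h : O 1 h) (h≢κ : h ≢ κ) where
      roots poles₁ poles₂ poles₃ : List K
      roots = progression m (h - ι m) ++ (progression e (κ - ι e) ++ progression g (- θ))
      poles₁ = progression (suc m) (- h)
      poles₂ = progression (suc e) (- κ)
      poles₃ = progression g (θ - ι g)

      N P₁ P₂ P₃ : K → K
      N t = poch (1# + t - h) m * (poch (1# + t - κ) e * poch (1# + (t + θ) - ι g) g)
      P₁ t = poch (t + h - ι m) (suc m)
      P₂ t = poch (t + κ - ι e) (suc e)
      P₃ t = poch (1# + t - θ) g

      roots≡ : ∀ t → prodL t roots ≡ N t
      roots≡ t = begin
        prodL t roots ≡⟨ trans (prodL-++ t (progression m (h - ι m)) _) (cong (prodL t (progression m (h - ι m)) *_) (prodL-++ t (progression e (κ - ι e)) (progression g (- θ)))) ⟩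
        prodL t (progression m (h - ι m)) * (prodL t (progression e (κ - ι e)) * prodL t (progression g (- θ)))
          ≡⟨ cong₂ _*_ (trans (prodL-progression m t _) (cong (λ u → poch u m) (shift h m)))
               (cong₂ _*_ (trans (prodL-progression e t _) (cong (λ u → poch u e) (shift κ e)))
                 (trans (prodL-progression g t _) (cong (λ u → poch u g) (solve 3 (λ t θ g → :1 :+ (t :- (:- θ)) :- g := :1 :+ (t :+ θ) :- g) refl t θ (ι g))))) ⟩
        N t ∎
        where
        shift : ∀ η n → 1# + (t - (η - ι n)) - ι n ≡ 1# + t - η
        shift η n = solve 3 (λ t η n → :1 :+ (t :- (η :- n)) :- n := :1 :+ t :- η) refl t η (ι n)

      pole≡ : ∀ n η t → prodL t (progression (suc n) (- η)) ≡ poch (t + η - ι n) (suc n)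
      pole≡ n η t = trans (prodL-progression (suc n) t _) (cong (λ u → poch u (suc n))
        (trans (cong (λ u → 1# + (t - (- η)) - u) (ι-suc n)) (solve 3 (λ t η n → :1 :+ (t :- (:- η)) :- (:1 :+ n) := t :+ η :- n) refl t η (ι n))))

      poles₃≡ : ∀ t → prodL t poles₃ ≡ P₃ t
      poles₃≡ t = trans (prodL-progression g t _) (cong (λ u → poch u g)
        (solve 3 (λ t θ g → :1 :+ (t :- (θ :- g)) :- g := :1 :+ t :- θ) refl t θ (ι g)))

      -- Poles of one progression differ by nonzero integers. For poles of different progressions,
      -- equality would place a nonzero integer of absolute value below p in pℤ₍ₚ₎; only i - h = i -
      -- κ escapes this argument, and it is excluded by h ≢ κ.
      poles-distinct : Unique (poles₁ ++ (poles₂ ++ poles₃))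
      poles-distinct = AllPairsₚ.++⁺ (Unique-progression (suc m) _)
        (AllPairsₚ.++⁺ (Unique-progression (suc e) _) (Unique-progression g _)
          (All-progression (suc e) _ λ i i≤e → All-progression g _ λ j j<g → far O1-κ i j (ℕₚ.≤-trans (ℕₚ.≤-pred i≤e) e≤m) j<g))
        (All-progression (suc m) _ λ i i≤m → Allₚ.++⁺
          (All-progression (suc e) _ λ j j≤e → near i j (ℕₚ.≤-pred i≤m) (ℕₚ.≤-trans (ℕₚ.≤-pred j≤e) e≤m))
          (All-progression g _ λ j j<g → far O1-h i j (ℕₚ.≤-pred i≤m) j<g))
        where
        far : ∀ {η} → O 1 η → ∀ i j → i ≤ m → j < g → ι i + - η ≢ ι j + (θ - ι g)
        far {η} hη i j i≤m j<g eq = O1-not-unit (O-+ hη O1-θ) (subst Unit total (unit-ι (i ℕ.+ suc k) (ℕₚ.≤-trans (s≤s z≤n) (ℕₚ.m≤n+m (suc k) i)) (s≤s (ℕₚ.+-mono-≤ i≤m k<m))))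
          where
          k = g ℕ.∸ suc j
          k<m : suc k ≤ m
          k<m = ℕₚ.≤-trans (s≤s (ℕₚ.m∸n≤m g′ j)) (ℕₚ.≤-trans g≤e e≤m)
          total : ι (i ℕ.+ suc k) ≡ η + θ
          total = begin
            ι (i ℕ.+ suc k) ≡⟨ ι-+ i (suc k) ⟩
            ι i + ι (suc k) ≡⟨ cong (ι i +_) (sym (ι-difference j<g)) ⟩
            ι i + (ι g - ι j) ≡⟨ solve 4 (λ i g j η → i :+ (g :- j) := (i :- η) :+ (g :- j :+ η)) refl (ι i) (ι g) (ι j) η ⟩
            ι i - η + (ι g - ι j + η) ≡⟨ cong (_+ (ι g - ι j + η)) eq ⟩
            ι j + (θ - ι g) + (ι g - ι j + η) ≡⟨ solve 4 (λ g j η θ → j :+ (θ :- g) :+ (g :- j :+ η) := η :+ θ) refl (ι g) (ι j) η θ ⟩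
            η + θ ∎
        apart : ∀ {η η′} → O 1 η → O 1 η′ → ∀ i j → j < i → i ≤ m → ι i + - η ≢ ι j + - η′
        apart {η} {η′} hη hη′ i j j<i i≤m eq = O1-not-unit (O-- hη hη′) (subst Unit total (unit-ι (suc (i ℕ.∸ suc j)) (s≤s z≤n)
          (s≤s (ℕₚ.≤-trans (ℕₚ.≤-reflexive (sym (ℕₚ.+-∸-assoc 1 j<i))) (ℕₚ.≤-trans (ℕₚ.m∸n≤m i j) (ℕₚ.≤-trans i≤m m≤2m))))))
          where
          total : ι (suc (i ℕ.∸ suc j)) ≡ η - η′
          total = begin
            ι (suc (i ℕ.∸ suc j)) ≡⟨ ι-difference j<i ⟨
            ι i - ι j ≡⟨ solve 3 (λ i j η → i :- j := (i :- η) :+ (η :- j)) refl (ι i) (ι j) η ⟩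
            ι i - η + (η - ι j) ≡⟨ cong (_+ (η - ι j)) eq ⟩
            ι j - η′ + (η - ι j) ≡⟨ solve 3 (λ j η η′ → j :- η′ :+ (η :- j) := η :- η′) refl (ι j) η η′ ⟩
            η - η′ ∎
        near : ∀ i j → i ≤ m → j ≤ m → ι i + - h ≢ ι j + - κ
        near i j i≤m j≤m eq with ℕₚ.<-cmp i j
        ... | tri< i<j _ _ = apart O1-κ O1-h j i i<j j≤m (sym eq)
        ... | tri> _ _ j<i = apart O1-h O1-κ i j j<i i≤m eq
        ... | tri≈ _ refl _ = h≢κ (begin
          h ≡⟨ solve 2 (λ h i → h := i :- (i :- h)) refl h (ι i) ⟩
          ι i - (ι i - h) ≡⟨ cong (λ u → ι i - u) eq ⟩
          ι i - (ι i - κ) ≡⟨ solve 2 (λ h i → i :- (i :- h) := h) refl κ (ι i) ⟩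
          κ ∎)

      poles-enough : 2 ℕ.+ length roots ≤ length (poles₁ ++ (poles₂ ++ poles₃))
      poles-enough = ℕₚ.≤-reflexive (begin
        2 ℕ.+ length roots ≡⟨ cong (2 ℕ.+_) (trans (length-++ (progression m (h - ι m))) (cong₂ ℕ._+_ (length-progression m _) (trans (length-++ (progression e (κ - ι e))) (cong₂ ℕ._+_ (length-progression e _) (length-progression g _))))) ⟩
        2 ℕ.+ (m ℕ.+ (e ℕ.+ g)) ≡⟨ cong suc (ℕₚ.+-suc m (e ℕ.+ g)) ⟨
        suc m ℕ.+ (suc e ℕ.+ g) ≡⟨ sym (trans (length-++ poles₁) (cong₂ ℕ._+_ (length-progression (suc m) _) (trans (length-++ poles₂) (cong₂ ℕ._+_ (length-progression (suc e) _) (length-progression g _))))) ⟩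
        length (poles₁ ++ (poles₂ ++ poles₃)) ∎)

      residues₁ residues₂ residues₃ : ℕ → K
      residues₁ a = N (ι a + - h) * inv (P₂ (ι a + - h) * P₃ (ι a + - h)) * weight m a
      residues₂ a = N (ι a + - κ) * inv (P₁ (ι a + - κ)) * inv (P₃ (ι a + - κ)) * weight e a
      residues₃ a = N (ι a + (θ - ι g)) * inv (P₁ (ι a + (θ - ι g))) * inv (P₂ (ι a + (θ - ι g))) * weight g′ a

      residue-theorem : sumTo (suc m) residues₁ + (sumTo (suc e) residues₂ + sumTo g residues₃) ≡ 0#
      residue-theorem = begin
        sumTo (suc m) residues₁ + (sumTo (suc e) residues₂ + sumTo g residues₃)
          ≡⟨ cong₂ _+_ (sym (residueSum-progression m (λ t → N t * inv (P₂ t * P₃ t)) (- h)))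
               (cong₂ _+_ (sym (residueSum-progression e (λ t → N t * inv (P₁ t) * inv (P₃ t)) (- κ)))
                 (sym (residueSum-progression g′ (λ t → N t * inv (P₁ t) * inv (P₂ t)) (θ - ι g)))) ⟩
        residueSum (λ t → N t * inv (P₂ t * P₃ t)) poles₁ + (residueSum (λ t → N t * inv (P₁ t) * inv (P₃ t)) poles₂ + residueSum (λ t → N t * inv (P₁ t) * inv (P₂ t)) poles₃)
          ≡⟨ cong₂ _+_
               (residueSum-ext (λ t → cong₂ (λ u v → u * inv v) (sym (roots≡ t)) (sym (trans (prodL-++ t poles₂ poles₃) (cong₂ _*_ (pole≡ e κ t) (poles₃≡ t))))) poles₁)
               (trans (cong₂ _+_
                 (residueSum-ext (λ t → cong₂ (λ u v → u * inv v) (cong₂ (λ u v → u * inv v) (sym (roots≡ t)) (sym (pole≡ m h t))) (sym (poles₃≡ t))) poles₂)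
                 (residueSum-ext (λ t → cong₂ (λ u v → u * inv v) (cong₂ (λ u v → u * inv v) (sym (roots≡ t)) (sym (pole≡ m h t))) (sym (pole≡ e κ t))) poles₃))
                 (sym (residueSum-++ (λ t → prodL t roots * inv (prodL t poles₁)) poles₂ poles₃))) ⟩
        residueSum (λ t → prodL t roots * inv (prodL t (poles₂ ++ poles₃))) poles₁ + residueSum (λ t → prodL t roots * inv (prodL t poles₁)) (poles₂ ++ poles₃)
          ≡⟨ residueSum-++ (λ t → prodL t roots) poles₁ (poles₂ ++ poles₃) ⟨
        residueSum (λ t → prodL t roots) (poles₁ ++ (poles₂ ++ poles₃))
          ≡⟨ residueSum≡0 roots _ poles-distinct poles-enough ⟩
        0# ∎

      cancelled-value : ∀ n a {η η′} → n ≤ m → a ≤ m → O 1 η → O 1 η′ → η ≢ η′ →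
        (η - η′) * inv (poch (ι a + - η′ + η - ι n) (suc n)) ≡ cancelled n a (- η′ + η)
      cancelled-value n a {η} {η′} n≤m a≤m hη hη′ η≢η′ = begin
        (η - η′) * inv (poch (ι a + - η′ + η - ι n) (suc n))
          ≡⟨ cong₂ (λ u v → u * inv (poch v (suc n))) (+-comm _ _) (solve 4 (λ a h k n → a :+ (:- h) :+ k :- n := a :+ (:- h :+ k) :- n) refl (ι a) η′ η (ι n)) ⟩
        (- η′ + η) * inv (poch (ι a + (- η′ + η) - ι n) (suc n))
          ≡⟨ cancelled≡ n a (ℕₚ.≤-trans n≤m m≤2m) (ℕₚ.≤-trans a≤m m≤2m) (O-+ (O-neg hη′) hη)
               (λ eq → difference-nonzero η≢η′ (trans (+-comm _ _) eq)) ⟩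
        cancelled n a (- η′ + η) ∎

      cancelled-at-0 : ∀ n a η → a ≤ n → n ≤ m → weight n a ≡ cancelled n a (- η + η)
      cancelled-at-0 n a η a≤n n≤m = trans (weight≡cancelled n a a≤n (ℕₚ.≤-trans n≤m m≤2m)) (cong (cancelled n a) (solve 1 (λ η → :0 := :- η :+ η) refl η))

      residues₁≡ : ∀ a → a ≤ m → (κ - h) * residues₁ a ≡ Y h a (- h)
      residues₁≡ a a≤m = begin
        (κ - h) * (n₁ * (n₂ * n₃) * inv (P₂ t * P₃ t) * weight m a)
          ≡⟨ cong (λ u → (κ - h) * (n₁ * (n₂ * n₃) * u * weight m a)) (inv-* _ _) ⟩
        (κ - h) * (n₁ * (n₂ * n₃) * (inv (P₂ t) * inv (P₃ t)) * weight m a)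
          ≡⟨ solve 7 (λ d n₁ n₂ n₃ i j w → d :* (n₁ :* (n₂ :* n₃) :* (i :* j) :* w) := n₁ :* w :* (n₂ :* (d :* i)) :* (n₃ :* j)) refl (κ - h) n₁ n₂ n₃ (inv (P₂ t)) (inv (P₃ t)) (weight m a) ⟩
        n₁ * weight m a * (n₂ * ((κ - h) * inv (P₂ t))) * (n₃ * inv (P₃ t))
          ≡⟨ cong₂ (λ u v → n₁ * u * (n₂ * v) * (n₃ * inv (P₃ t))) (cancelled-at-0 m a h a≤m ℕₚ.≤-refl)
               (cancelled-value e a e≤m a≤m O1-κ O1-h (λ eq → h≢κ (sym eq))) ⟩
        Y h a (- h) ∎
        where
        t = ι a + - h
        n₁ = poch (1# + t - h) m
        n₂ = poch (1# + t - κ) e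
        n₃ = poch (1# + (t + θ) - ι g) g

      residues₂≡ : ∀ a → a ≤ e → (h - κ) * residues₂ a ≡ Y h a (- κ)
      residues₂≡ a a≤e = begin
        (h - κ) * (n₁ * (n₂ * n₃) * inv (P₁ t) * inv (P₃ t) * weight e a)
          ≡⟨ solve 7 (λ d n₁ n₂ n₃ i j w → d :* (n₁ :* (n₂ :* n₃) :* i :* j :* w) := n₁ :* (d :* i) :* (n₂ :* w) :* (n₃ :* j)) refl (h - κ) n₁ n₂ n₃ (inv (P₁ t)) (inv (P₃ t)) (weight e a) ⟩
        n₁ * ((h - κ) * inv (P₁ t)) * (n₂ * weight e a) * (n₃ * inv (P₃ t))
          ≡⟨ cong₂ (λ u v → n₁ * u * (n₂ * v) * (n₃ * inv (P₃ t))) (cancelled-value m a ℕₚ.≤-refl (ℕₚ.≤-trans a≤e e≤m) O1-h O1-κ h≢κ)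
               (cancelled-at-0 e a κ a≤e e≤m) ⟩
        Y h a (- κ) ∎
        where
        t = ι a + - κ
        n₁ = poch (1# + t - h) m
        n₂ = poch (1# + t - κ) e
        n₃ = poch (1# + (t + θ) - ι g) g

      -- Beyond e the point a - κ is no pole, so nothing cancels the factor x + κ; formally, the
      -- symbol of length a starting at -e contains 0. The sum over all a ≤ m at x = -κ thus
      -- collects only the residues with a ≤ e.
      Y-beyond : ∀ a → e < a → Y h a (- κ) ≡ 0#
      Y-beyond a e<a = begin
        y₁ * (y₂ * (poch (- κ + κ - ι e) a * y₃ * y₄)) * y₅
          ≡⟨ cong (λ u → y₁ * (y₂ * (u * y₃ * y₄)) * y₅) (trans (cong (λ u → poch (u - ι e) a) (solve 1 (λ k → :- k :+ k := :0) refl κ)) (poch-zero e a e<a)) ⟩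
        y₁ * (y₂ * (0# * y₃ * y₄)) * y₅
          ≡⟨ solve 5 (λ a b c d e → a :* (b :* (:0 :* c :* d)) :* e := :0) refl y₁ y₂ y₃ y₄ y₅ ⟩
        0# ∎
        where
        y₁ = poleFactor m a h (- κ)
        y₂ = poch (1# + (ι a + - κ) - κ) e
        y₃ = inv (poch (- κ + κ - ι e) e)
        y₄ = inv (poch (1# + (- κ + κ)) a)
        y₅ = zeroFactor a (- κ)

      sum-Y-κ : sumTo (suc m) (λ a → Y h a (- κ)) ≡ (h - κ) * sumTo (suc e) residues₂
      sum-Y-κ = begin
        sumTo (suc m) f ≡⟨ cong (λ n → sumTo n f) (cong suc (ℕₚ.m+[n∸m]≡n e≤m)) ⟨
        sumTo (suc e ℕ.+ (m ℕ.∸ e)) f ≡⟨ sumTo-+ (suc e) (m ℕ.∸ e) f ⟩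
        sumTo (suc e) f + sumTo (m ℕ.∸ e) (λ i → f (suc e ℕ.+ i))
          ≡⟨ cong₂ _+_ (sym (trans (sumTo-*ˡ (suc e) (h - κ) residues₂) (sumTo-cong (suc e) λ a a≤e → residues₂≡ a (ℕₚ.≤-pred a≤e))))
               (trans (sumTo-cong (m ℕ.∸ e) (λ i _ → trans (Y-beyond (suc e ℕ.+ i) (s≤s (ℕₚ.m≤m+n e i))) (sym (zeroˡ 0#))))
                 (trans (sym (sumTo-*ˡ (m ℕ.∸ e) 0# (λ _ → 0#))) (zeroˡ _))) ⟩
        (h - κ) * sumTo (suc e) residues₂ + 0# ≡⟨ +-identityʳ _ ⟩
        (h - κ) * sumTo (suc e) residues₂ ∎
        where
        f : ℕ → K
        f a = Y h a (- κ)

      -- At t = θ - l with 1 ≤ l ≤ g the numerator contains θ - h and θ - κ, since l ≤ g ≤ e ≤ m.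
      -- The denominators are units because l + m < p.
      residues₃-O2 : ∀ a → a < g → O 2 (residues₃ a)
      residues₃-O2 a a<g = O-*ʳ (O-*ʳ (O-*ʳ (O-* (root-O1 m (ℕₚ.≤-trans l≤g (ℕₚ.≤-trans g≤e e≤m)) O1-h)
          (O-*ʳ (root-O1 e (ℕₚ.≤-trans l≤g g≤e) O1-κ) (poch-integral g (integral-- (integral-+ (integral-ι 1) (integral-+ it (O⇒integral O1-θ))) (integral-ι g)))))
          (integral-inv (pole-unit m ℕₚ.≤-refl O1-h))) (integral-inv (pole-unit e e≤m O1-κ)))
          (integral-* (integral-inv (subst (λ u → Unit (poch u a)) (+-identityʳ 1#) (poch-unit-1+ a (ℕₚ.≤-trans (ℕₚ.<⇒≤ a<g) (ℕₚ.≤-trans g≤e e≤2m)) (O-0 1))))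
            (integral-inv (subst (λ u → Unit (poch u k)) (+-identityˡ _) (poch-unit-- k k ℕₚ.≤-refl (s≤s (ℕₚ.≤-trans (ℕₚ.n≤1+n k) (ℕₚ.≤-trans l≤g (ℕₚ.≤-trans g≤e e≤2m)))) (O-0 1)))))
        where
        k = g′ ℕ.∸ a
        t = ι a + (θ - ι g)
        l≤g : suc k ≤ g
        l≤g = s≤s (ℕₚ.m∸n≤m g′ a)
        it : Integral t
        it = integral-+ (integral-ι a) (integral-- (O⇒integral O1-θ) (integral-ι g))
        t≡ : t ≡ θ - ι (suc k)
        t≡ = trans (solve 3 (λ a θ g → a :+ (θ :- g) := θ :- (g :- a)) refl (ι a) θ (ι g)) (cong (λ u → θ - u) (ι-difference a<g))
        root-O1 : ∀ n {η} → suc k ≤ n → O 1 η → O 1 (poch (1# + t - η) n)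
        root-O1 n {η} k<n hη = poch-O1 n k k<n (integral-- (integral-+ (integral-ι 1) it) (O⇒integral hη)) (subst (O 1) eq (O-- O1-θ hη))
          where
          eq : θ - η ≡ 1# + t - η + ι k
          eq = sym (trans (cong (λ u → 1# + u - η + ι k) (trans t≡ (cong (λ u → θ - u) (ι-suc k))))
            (solve 3 (λ θ η k → :1 :+ (θ :- (:1 :+ k)) :- η :+ k := θ :- η) refl θ η (ι k)))
        pole-unit : ∀ n {η} → n ≤ m → O 1 η → Unit (poch (t + η - ι n) (suc n))
        pole-unit n {η} n≤m hη = subst (λ u → Unit (poch u (suc n))) eq
          (poch-unit-- (suc k ℕ.+ n) (suc n) (s≤s (ℕₚ.m≤n+m n k)) (s≤s (ℕₚ.+-mono-≤ (ℕₚ.≤-trans l≤g (ℕₚ.≤-trans g≤e e≤m)) n≤m)) (O-+ O1-θ hη))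
          where
          eq : θ + η - ι (suc k ℕ.+ n) ≡ t + η - ι n
          eq = trans (cong (λ u → θ + η - u) (ι-+ (suc k) n)) (trans (solve 4 (λ θ η k n → θ :+ η :- (k :+ n) := θ :- k :+ η :- n) refl θ η (ι (suc k)) (ι n)) (cong (λ u → u + η - ι n) (sym t≡)))

      -- Since the residues add up to zero, the difference is h - κ times the sum of the residues at
      -- θ - l. The third factor p comes from h - κ.
      sum-Y≈ : sumTo (suc m) (λ a → Y h a (- h)) ≈[ 3 ] sumTo (suc m) (λ a → Y h a (- κ))
      sum-Y≈ = subst (O 3) (sym difference) (O-* (O-- O1-h O1-κ) (O-sum g residues₃-O2))
        where
        S₁ = sumTo (suc m) residues₁
        S₂ = sumTo (suc e) residues₂
        S₃ = sumTo g residues₃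
        difference : sumTo (suc m) (λ a → Y h a (- h)) - sumTo (suc m) (λ a → Y h a (- κ)) ≡ (h - κ) * S₃
        difference = begin
          sumTo (suc m) (λ a → Y h a (- h)) - sumTo (suc m) (λ a → Y h a (- κ))
            ≡⟨ cong₂ _-_ (sym (trans (sumTo-*ˡ (suc m) (κ - h) residues₁) (sumTo-cong (suc m) λ a a≤m → residues₁≡ a (ℕₚ.≤-pred a≤m)))) sum-Y-κ ⟩
          (κ - h) * S₁ - (h - κ) * S₂
            ≡⟨ solve 5 (λ h k a b c → (k :- h) :* a :- (h :- k) :* b := (h :- k) :* c :- (h :- k) :* (a :+ (b :+ c))) refl h κ S₁ S₂ S₃ ⟩
          (h - κ) * S₃ - (h - κ) * (S₁ + (S₂ + S₃))
            ≡⟨ cong (λ u → (h - κ) * S₃ - (h - κ) * u) residue-theorem ⟩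
          (h - κ) * S₃ - (h - κ) * 0#
            ≡⟨ solve 2 (λ d s → d :* s :- d :* :0 := d :* s) refl (h - κ) S₃ ⟩
          (h - κ) * S₃ ∎

  -- Moving the centre of the pair with r₁ = 1/2

  h₀ : K
  h₀ = π * inv (ι 2)

  2<p : 2 < p
  2<p = ℕₚ.≤-trans (s≤s (s≤s (s≤s z≤n))) 6<p

  O1-h₀ : O 1 h₀
  O1-h₀ = O1-π* (integral-inv (unit-ι 2 (s≤s z≤n) 2<p))

  h₀+h₀ : h₀ + h₀ ≡ π
  h₀+h₀ = begin
    π * inv (ι 2) + π * inv (ι 2) ≡⟨ solve 2 (λ p i → p :* i :+ p :* i := p :* (con (ℤ.+ 2) :* i)) refl π (inv (ι 2)) ⟩
    π * (ι 2 * inv (ι 2))         ≡⟨ cong (π *_) (inv-r (ι≢0 1)) ⟩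
    π * 1#                        ≡⟨ *-identityʳ π ⟩
    π ∎

  square : K → K
  square x = x * x

  -- For n = e and η = κ: the boundary factor `telescope` of the pair starting at κ - e and 1 + e -
  -- κ, times the a factors that follow in both symbols, relative to the square of the a factors
  -- after x. The pair with r₁ = 1/2 is the case n = m, η = h₀.
  pairFactor : ℕ → ℕ → K → K → K
  pairFactor n a η x =
    poch (1# + x - η) n * poch (1# + ι n + x - η) a * (poch (x + η - ι n) a * inv (poch (x + η - ι n) n)) * inv (square (poch (1# + x) a))

  pairFactor-split : ∀ n a η x → poch (1# + x - η) n * poch (1# + ι n + x - η) a ≡ poch (1# + x - η) (n ℕ.+ a)
  pairFactor-split n a η x = trans
    (cong (λ u → poch (1# + x - η) n * poch u a) (solve 3 (λ n x η → :1 :+ n :+ x :- η := :1 :+ x :- η :+ n) refl (ι n) x η))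
    (sym (poch-+ _ n a))

  pairFactor-split′ : ∀ n a η x → poch (1# + x - η) n * poch (1# + ι n + x - η) a ≡ poch (1# + x - η) a * poch (1# + (ι a + x) - η) n
  pairFactor-split′ n a η x = begin
    poch (1# + x - η) n * poch (1# + ι n + x - η) a ≡⟨ pairFactor-split n a η x ⟩
    poch (1# + x - η) (n ℕ.+ a) ≡⟨ cong (poch (1# + x - η)) (ℕₚ.+-comm n a) ⟩
    poch (1# + x - η) (a ℕ.+ n) ≡⟨ poch-+ _ a n ⟩
    poch (1# + x - η) a * poch (1# + x - η + ι a) n
      ≡⟨ cong (λ u → poch (1# + x - η) a * poch u n) (solve 3 (λ a x η → :1 :+ x :- η :+ a := :1 :+ (a :+ x) :- η) refl (ι a) x η) ⟩
    poch (1# + x - η) a * poch (1# + (ι a + x) - η) n ∎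

  -- The two halves of (1/2 + x)_k² are centred at p/2; any symmetric displacement η of the
  -- centre changes the product by a flat factor only.
  module _ (a : ℕ) (a≤m : a ≤ m) where
    private
      n = m ℕ.+ a

      n≤2m : n ≤ m ℕ.+ m
      n≤2m = ℕₚ.+-monoʳ-≤ m a≤m

    centred : K → K
    centred x = square (poch (1# + (x - h₀)) n) * (inv W₀ * inv (square (poch (1# + x) a)))

    displacement : K → K → K
    displacement η x = evenRatio n (x - h₀) (h₀ - η)

    -- Completing the lower symbol to W (x + η - p) ≡ W₀ leaves two symbols of length m + a,
    -- starting at 1 + x - η and 1 + x + η - p. The equal lengths come from splitting p - 1 into m +
    -- m. Both starting points lie symmetrically about 1 + x - p/2, so the product is a square times
    -- an expression even in h₀ - η.
    pairFactor≈centred : ∀ {η x} → O 1 η → O 1 x → pairFactor m a η x ≈[ 3 ] centred x * displacement η x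
    pairFactor≈centred {η} {x} hη hx = ≈-trans (≡⇒≈ exact) (≈-trans
      (≈-* (integral-* (integral-self iD) iW) (integral-inv (unit-* uS uS)) (≈-*ˡ (integral-self iD) (≈-inv (W-unit hz) W₀-unit (W≈W₀ hz))) ≈-refl)
      (≡⇒≈ (trans (cong (λ u → u * inv W₀ * inv (square S)) product) (solve 4 (λ c e w s → c :* e :* w :* s := c :* (w :* s) :* e) refl (square C) (displacement η x) (inv W₀) (inv (square S))))))
      where
      z = x + η
      hz : O 1 (z - π)
      hz = O-- (O-+ hx hη) O1-π
      S = poch (1# + x) a
      C = poch (1# + (x - h₀)) n
      D₁ = poch (1# + x - η) n
      D₂ = poch (1# + (z - π)) n
      L = poch (1# + (z - π)) m
      uS : Unit S
      uS = poch-unit-1+ a (ℕₚ.≤-trans a≤m m≤2m) hx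
      uC : Unit C
      uC = poch-unit-1+ n n≤2m (O-- hx O1-h₀)
      iW : Integral (inv W₀)
      iW = integral-inv W₀-unit
      iD : Unit (D₁ * D₂)
      iD = unit-* (subst (λ u → Unit (poch u n)) (sym (+-assoc 1# x (- η))) (poch-unit-1+ n n≤2m (O-- hx hη))) (poch-unit-1+ n n≤2m hz)
      shift : 1# + (z - π) + ι m ≡ z - ι m
      shift = trans (cong (λ u → 1# + (z - u) + ι m) π≡1+2m) (solve 2 (λ z m → :1 :+ (z :- (:1 :+ (m :+ m))) :+ m := z :- m) refl z (ι m))
      D₂≡ : D₂ ≡ L * poch (z - ι m) a
      D₂≡ = trans (poch-+ _ m a) (cong (λ u → L * poch u a) shift)
      W≡ : W (z - π) ≡ L * poch (z - ι m) m
      W≡ = trans (poch-+ _ m m) (cong (λ u → L * poch u m) shift)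
      lower-part : poch (z - ι m) a * inv (poch (z - ι m) m) ≡ D₂ * inv (W (z - π))
      lower-part = fraction-≡ (nonzero (poch-unit-- m m ℕₚ.≤-refl (s≤s m≤2m) (O-+ hx hη))) (nonzero (W-unit hz))
        (trans (cong (poch (z - ι m) a *_) W≡) (trans (solve 3 (λ a l m → a :* (l :* m) := l :* a :* m) refl _ L _) (cong (_* poch (z - ι m) m) (sym D₂≡))))
      exact : pairFactor m a η x ≡ D₁ * D₂ * inv (W (z - π)) * inv (square S)
      exact = cong (_* inv (square S)) (trans (cong₂ _*_ (pairFactor-split m a η x) lower-part) (sym (*-assoc D₁ D₂ _)))
      product : D₁ * D₂ ≡ square C * displacement η x
      product = begin
        D₁ * D₂ ≡⟨ cong₂ (λ u v → poch u n * poch v n)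
            (solve 3 (λ x h η → :1 :+ x :- η := :1 :+ (x :- h) :+ (h :- η)) refl x h₀ η)
            (trans (cong (λ u → 1# + (x + η - u)) (sym h₀+h₀)) (solve 3 (λ x h η → :1 :+ (x :+ η :- (h :+ h)) := :1 :+ (x :- h) :- (h :- η)) refl x h₀ η)) ⟩
        q ≡⟨ *-identityˡ q ⟨
        1# * q ≡⟨ cong (_* q) (inv-r (nonzero (unit-* uC uC))) ⟨
        square C * inv (square C) * q ≡⟨ solve 3 (λ c i q → c :* i :* q := c :* (q :* i)) refl (square C) (inv (square C)) q ⟩
        square C * displacement η x ∎
        where
        q = poch (1# + (x - h₀) + (h₀ - η)) n * poch (1# + (x - h₀) - (h₀ - η)) n

    centred-integral : ∀ {x} → O 1 x → Integral (centred x)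
    centred-integral hx = integral-* (integral-* iC iC) (integral-* (integral-inv W₀-unit) (integral-inv (unit-* uS uS)))
      where
      iC = integral-self (poch-unit-1+ n n≤2m (O-- hx O1-h₀))
      uS = poch-unit-1+ a (ℕₚ.≤-trans a≤m m≤2m) hx

    displacement-flat : ∀ {η x y} → O 1 η → O 1 x → O 1 y → Flat (displacement η x) (displacement η y)
    displacement-flat hη hx hy = evenRatio-flat n n≤2m (O-- hx O1-h₀) (O-- hy O1-h₀) (O-- O1-h₀ hη)

    recentre : K → K → K
    recentre η x = displacement h₀ x * inv (displacement η x)

    -- Both centres are compared with the same `centred` product; only the quotient of their
    -- displacements remains, and it is flat.
    pairFactor-recentre : ∀ {η x} → O 1 η → O 1 x → pairFactor m a h₀ x ≈[ 3 ] pairFactor m a η x * recentre η x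
    pairFactor-recentre {η} {x} hη hx = ≈-trans (pairFactor≈centred O1-h₀ hx) (≈-sym (≈-trans
      (≈-* (integral-* (centred-integral hx) (integral-self uη)) (integral-* (integral-self u₀) (integral-inv uη)) (pairFactor≈centred hη hx) ≈-refl)
      (≡⇒≈ (trans (solve 4 (λ c d z i → c :* d :* (z :* i) := c :* z :* (d :* i)) refl (centred x) (displacement η x) (displacement h₀ x) (inv (displacement η x)))
        (trans (cong (centred x * displacement h₀ x *_) (inv-r (nonzero uη))) (*-identityʳ _))))))
      where
      u₀ = flat-unitˡ (displacement-flat O1-h₀ hx hx)
      uη = flat-unitˡ (displacement-flat hη hx hx)

  -- Comparing the sums at x = p b and x = 0

  module Comparison (e g′ : ℕ) (e≤m : e ≤ m) (g≤e : suc g′ ≤ e) (g<m : suc g′ < m) (κ θ : K) (O1-κ : O 1 κ) (O1-θ : O 1 θ) where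
    open RationalSummand e g′ e≤m g≤e κ θ O1-κ O1-θ

    g≤2m : g ≤ m ℕ.+ m
    g≤2m = ℕₚ.≤-trans g≤e e≤2m

    -- Each of the two `pairFactor`s divides by the square of `poch (1# + x) a`, but the factorials
    -- in the term account for one such division only. The other is undone here, so that every
    -- perturbed symbol of length a faces an unperturbed one.
    denominatorFactor : ℕ → K → K
    denominatorFactor a x =
      poch (1# + (ι a + x + θ) - ι g) g * inv (poch (1# + (x + θ)) a)
        * (inv (poch (1# + x - θ) g) * inv (poch (1# + ι g + x - θ) a)) * square (poch (1# + x) a)

    v : ℕ → K → K
    v a x = pairFactor m a h₀ x * pairFactor e a κ x * denominatorFactor a x

    module _ (a : ℕ) (a≤m : a ≤ m) where
      a≤2m : a ≤ m ℕ.+ m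
      a≤2m = ℕₚ.≤-trans a≤m m≤2m

      -- Reading n + a consecutive factors as a + n leaves the symbols of length a at 1 + x + η and
      -- 1 + x - η over the square of the one at 1 + x, which is even in η.
      pairFactor≡ : ∀ n {η x} → O 1 η → O 1 x → pairFactor n a η x ≡ poleFactor n a η x * evenRatio a x η
      pairFactor≡ n {η} {x} hη hx = begin
        poch (1# + x - η) n * poch (1# + ι n + x - η) a * (r * i) * s
          ≡⟨ cong (λ u → u * (r * i) * s) (pairFactor-split′ n a η x) ⟩
        A * B * (r * i) * s
          ≡⟨ *-identityˡ _ ⟨
        1# * (A * B * (r * i) * s)
          ≡⟨ cong (_* (A * B * (r * i) * s)) (inv-r (nonzero (poch-unit-1+ a a≤2m (O-+ hx hη)))) ⟨
        E * inv E * (A * B * (r * i) * s)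
          ≡⟨ solve 7 (λ E j A B r i s → E :* j :* (A :* B :* (r :* i) :* s) := B :* (r :* i :* j) :* (E :* A :* s)) refl E (inv E) A B r i s ⟩
        poleFactor n a η x * (E * A * s)
          ≡⟨ cong (λ u → poleFactor n a η x * (poch u a * A * s)) (sym (+-assoc 1# x η)) ⟩
        poleFactor n a η x * evenRatio a x η ∎
        where
        r = poch (x + η - ι n) a
        i = inv (poch (x + η - ι n) n)
        s = inv (square (poch (1# + x) a))
        A = poch (1# + x - η) a
        B = poch (1# + (ι a + x) - η) n
        E = poch (1# + (x + η)) a

      denominatorFactor≡ : ∀ {x} → O 1 x → denominatorFactor a x ≡ zeroFactor a x * inv (evenRatio a x θ)
      denominatorFactor≡ {x} hx = begin
        G * inv E * (inv (poch (1# + x - θ) g) * inv (poch (1# + ι g + x - θ) a)) * s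
          ≡⟨ cong (λ u → G * inv E * u * s) (trans (sym (inv-* _ _)) (trans (cong inv (pairFactor-split′ g a θ x)) (inv-* A B))) ⟩
        G * inv E * (inv A * inv B) * s
          ≡⟨ solve 5 (λ G i j k s → G :* i :* (j :* k) :* s := G :* k :* (i :* j :* s)) refl G (inv E) (inv A) (inv B) s ⟩
        zeroFactor a x * (inv E * inv A * s)
          ≡⟨ cong (zeroFactor a x *_) (sym inverse) ⟩
        zeroFactor a x * inv (evenRatio a x θ) ∎
        where
        G = poch (1# + (ι a + x + θ) - ι g) g
        s = square (poch (1# + x) a)
        A = poch (1# + x - θ) a
        B = poch (1# + (ι a + x) - θ) g
        E = poch (1# + (x + θ)) a
        us = poch-unit-1+ a a≤2m hx
        inverse : inv (evenRatio a x θ) ≡ inv E * inv A * s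
        inverse = trans (inv-* _ _) (cong₂ _*_ (trans (inv-* _ _) (cong (λ u → inv (poch u a) * inv A) (+-assoc 1# x θ))) (inv-inv (nonzero (unit-* us us))))

      module _ {x : K} (hx : O 1 x) where
        poleFactor-integral : ∀ n {η} → n ≤ m → O 1 η → Integral (poleFactor n a η x)
        poleFactor-integral n n≤m hη = integral-* (poch-integral n (integral-- (integral-+ (integral-ι 1) (integral-+ (integral-ι a) (O⇒integral hx))) (O⇒integral hη)))
          (integral-* (integral-* (poch-integral a (integral-- (O⇒integral (O-+ hx hη)) (integral-ι n)))
            (integral-inv (poch-unit-- n n ℕₚ.≤-refl (s≤s (ℕₚ.≤-trans n≤m m≤2m)) (O-+ hx hη))))
            (integral-inv (poch-unit-1+ a a≤2m (O-+ hx hη))))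

        zero-unit : Unit (poch (1# + (ι a + x) - θ) g)
        zero-unit = subst (λ u → Unit (poch u g)) (trans (cong (_+ (x - θ)) (ι-suc a)) (solve 3 (λ a x θ → :1 :+ a :+ (x :- θ) := :1 :+ (a :+ x) :- θ) refl (ι a) x θ))
          (poch-unit-+ (suc a) g (s≤s z≤n) (s≤s (ℕₚ.+-mono-≤ a≤m (ℕₚ.<⇒≤ g<m))) (O-- hx O1-θ))

        integral-top : Integral (1# + (ι a + x + θ) - ι g)
        integral-top = integral-- (integral-+ (integral-ι 1) (integral-+ (integral-+ (integral-ι a) (O⇒integral hx)) (O⇒integral O1-θ))) (integral-ι g)

        zeroFactor-integral : Integral (zeroFactor a x)
        zeroFactor-integral = integral-* (poch-integral g integral-top) (integral-inv zero-unit)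

        Y-integral : ∀ {h} → O 1 h → Integral (Y h a x)
        Y-integral hh = integral-* (integral-* (poleFactor-integral m ℕₚ.≤-refl hh) (poleFactor-integral e e≤m O1-κ)) zeroFactor-integral

      module _ {x y : K} (hx : O 1 x) (hy : O 1 y) where
        x≈y : x ≈[ 1 ] y
        x≈y = O⇒≈ hx hy

        poleFactor≈ : ∀ n {η} → n ≤ m → O 1 η → poleFactor n a η x ≈[ 1 ] poleFactor n a η y
        poleFactor≈ n {η} n≤m hη = ≈-* (poch-integral n (integral-start hy)) (integral-* (integral-* (poch-integral a (integral-below hx)) (integral-inv (u hx))) (integral-inv (w hx)))
          (poch-≈ n (integral-start hx) (integral-start hy) (≈-+ (≈-+ ≈-refl (≈-+ ≈-refl x≈y)) ≈-refl))
          (≈-* (integral-* (poch-integral a (integral-below hy)) (integral-inv (u hy))) (integral-inv (w hx))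
            (≈-* (poch-integral a (integral-below hy)) (integral-inv (u hx)) (poch-≈ a (integral-below hx) (integral-below hy) below≈)
              (≈-inv (u hx) (u hy) (poch-≈ n (integral-below hx) (integral-below hy) below≈)))
            (≈-inv (w hx) (w hy) (poch-≈ a (i1 hx) (i1 hy) (≈-+ ≈-refl (≈-+ x≈y ≈-refl)))))
          where
          integral-start : ∀ {x} → O 1 x → Integral (1# + (ι a + x) - η)
          integral-start hx = integral-- (integral-+ (integral-ι 1) (integral-+ (integral-ι a) (O⇒integral hx))) (O⇒integral hη)
          integral-below : ∀ {x} → O 1 x → Integral (x + η - ι n)
          integral-below hx = integral-- (O⇒integral (O-+ hx hη)) (integral-ι n)
          i1 : ∀ {x} → O 1 x → Integral (1# + (x + η))
          i1 hx = integral-+ (integral-ι 1) (O⇒integral (O-+ hx hη))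
          u : ∀ {x} → O 1 x → Unit (poch (x + η - ι n) n)
          u hx = poch-unit-- n n ℕₚ.≤-refl (s≤s (ℕₚ.≤-trans n≤m m≤2m)) (O-+ hx hη)
          w : ∀ {x} → O 1 x → Unit (poch (1# + (x + η)) a)
          w hx = poch-unit-1+ a a≤2m (O-+ hx hη)
          below≈ : x + η - ι n ≈[ 1 ] y + η - ι n
          below≈ = ≈-+ (≈-+ x≈y ≈-refl) ≈-refl

        zeroFactor≈ : zeroFactor a x ≈[ 1 ] zeroFactor a y
        zeroFactor≈ = ≈-* (poch-integral g (integral-top hy)) (integral-inv (zero-unit hx))
          (poch-≈ g (integral-top hx) (integral-top hy) (≈-+ (≈-+ ≈-refl (≈-+ (≈-+ ≈-refl x≈y) ≈-refl)) ≈-refl))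
          (≈-inv (zero-unit hx) (zero-unit hy) (poch-≈ g (i hx) (i hy) (≈-+ (≈-+ ≈-refl (≈-+ ≈-refl x≈y)) ≈-refl)))
          where
          i : ∀ {x} → O 1 x → Integral (1# + (ι a + x) - θ)
          i hx = integral-- (integral-+ (integral-ι 1) (integral-+ (integral-ι a) (O⇒integral hx))) (O⇒integral O1-θ)

        Y≈ : ∀ {h} → O 1 h → Y h a x ≈[ 1 ] Y h a y
        Y≈ hh = ≈-* (integral-* (poleFactor-integral hy m ℕₚ.≤-refl hh) (poleFactor-integral hy e e≤m O1-κ)) (zeroFactor-integral hx)
          (≈-* (poleFactor-integral hy m ℕₚ.≤-refl hh) (poleFactor-integral hx e e≤m O1-κ) (poleFactor≈ m ℕₚ.≤-refl hh) (poleFactor≈ e e≤m O1-κ))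
          zeroFactor≈

      correction : K → K → K
      correction h x = evenRatio a x h * recentre a a≤m h x * evenRatio a x κ * inv (evenRatio a x θ)

      correction-flat : ∀ {h x y} → O 1 h → O 1 x → O 1 y → Flat (correction h x) (correction h y)
      correction-flat hh hx hy = flat-* (flat-* (flat-* (evenRatio-flat a a≤2m hx hy hh)
        (flat-* (displacement-flat a a≤m O1-h₀ hx hy) (flat-inv (displacement-flat a a≤m hh hx hy))))
        (evenRatio-flat a a≤2m hx hy O1-κ)) (flat-inv (evenRatio-flat a a≤2m hx hy O1-θ))

      v≈ : ∀ {h x} → O 1 h → O 1 x → v a x ≈[ 3 ] Y h a x * correction h x
      v≈ {h} {x} hh hx = ≈-trans
        (≈-* (integral-* iA iB) iC (≈-* iA iB (pairFactor-recentre a a≤m hh hx) ≈-refl) ≈-refl)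
        (≡⇒≈ (begin
          pairFactor m a h x * recentre a a≤m h x * pairFactor e a κ x * denominatorFactor a x
            ≡⟨ cong₂ (λ u w → u * recentre a a≤m h x * w * denominatorFactor a x) (pairFactor≡ m hh hx) (pairFactor≡ e O1-κ hx) ⟩
          y₁ * c₁ * r * (y₂ * c₂) * denominatorFactor a x
            ≡⟨ cong (y₁ * c₁ * r * (y₂ * c₂) *_) (denominatorFactor≡ hx) ⟩
          y₁ * c₁ * r * (y₂ * c₂) * (y₃ * c₃)
            ≡⟨ solve 7 (λ y₁ c₁ r y₂ c₂ y₃ c₃ → y₁ :* c₁ :* r :* (y₂ :* c₂) :* (y₃ :* c₃) := y₁ :* y₂ :* y₃ :* (c₁ :* r :* c₂ :* c₃)) refl y₁ c₁ r y₂ c₂ y₃ c₃ ⟩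
          Y h a x * correction h x ∎))
        where
        y₁ = poleFactor m a h x
        y₂ = poleFactor e a κ x
        y₃ = zeroFactor a x
        c₁ = evenRatio a x h
        c₂ = evenRatio a x κ
        c₃ = inv (evenRatio a x θ)
        r = recentre a a≤m h x
        flat-integral : ∀ {x y} → Flat x y → Integral x
        flat-integral f = integral-self (flat-unitˡ f)
        iA : Integral (pairFactor m a h x * r)
        iA = integral-* (subst Integral (sym (pairFactor≡ m hh hx)) (integral-* (poleFactor-integral hx m ℕₚ.≤-refl hh) (flat-integral (evenRatio-flat a a≤2m hx hx hh))))
          (flat-integral (flat-* (displacement-flat a a≤m O1-h₀ hx hx) (flat-inv (displacement-flat a a≤m hh hx hx))))
        iB : Integral (pairFactor e a κ x)
        iB = subst Integral (sym (pairFactor≡ e O1-κ hx)) (integral-* (poleFactor-integral hx e e≤m O1-κ) (flat-integral (evenRatio-flat a a≤2m hx hx O1-κ)))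
        iC : Integral (denominatorFactor a x)
        iC = subst Integral (sym (denominatorFactor≡ hx)) (integral-* (zeroFactor-integral hx) (flat-integral (flat-inv (evenRatio-flat a a≤2m hx hx O1-θ))))

      v-integral : ∀ {x} → O 1 x → Integral (v a x)
      v-integral hx = integral-resp-≈ (v≈ O1-h₀ hx) (integral-* (Y-integral hx O1-h₀) (integral-self (flat-unitˡ (correction-flat O1-h₀ hx hx))))

      -- With c the correction, Y(x) c(x) - Y(y) c(y) - (Y(x) - Y(y)) equals (Y(x) - Y(y)) (c(x) -
      -- 1) + Y(y) (c(x) - c(y)). The first product is divisible by p · p², the second by p³.
      v-difference : ∀ {h x y} → O 1 h → O 1 x → O 1 y → v a x - v a y ≈[ 3 ] Y h a x - Y h a y
      v-difference {h} {x} {y} hh hx hy = ≈-trans (≈-+ (v≈ hh hx) (subst (O 3) (solve 2 (λ a b → :- (a :- b) := :- a :- (:- b)) refl _ _) (O-neg (v≈ hh hy))))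
        (subst (O 3) (solve 4 (λ a b c d → (a :- b) :* (c :- :1) :+ b :* (c :- d) := a :* c :- b :* d :- (a :- b)) refl (Y h a x) (Y h a y) (correction h x) (correction h y))
          (O-+ (O-* (Y≈ hx hy hh) (Flat.x≈1 f)) (O-*ˡ (Y-integral hy hh) (Flat.x≈y f))))
        where
        f = correction-flat hh hx hy

    module _ (κ-not-multiple : ∀ b → X b + κ ≢ 0#) where
      sum-v≈κ : ∀ b → sumTo (suc m) (λ a → v a (X b)) ≈[ 3 ] sumTo (suc m) (λ a → v a (- κ))
      sum-v≈κ b = subst (O 3) (sym (sumTo-distrib-- (suc m) _ _))
        (O-resp-≈ (≈-sum (suc m) λ a a≤m → v-difference a (ℕₚ.≤-pred a≤m) hh (O1-X b) (O-neg O1-κ))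
          (subst (O 3) (trans (cong (λ u → sumTo (suc m) (λ a → Y h a u) - sumTo (suc m) (λ a → Y h a (- κ))) (solve 1 (λ x → :- (:- x) := x) refl (X b))) (sumTo-distrib-- (suc m) _ _))
            (sum-Y≈ h hh h≢κ)))
        where
        h = - X b
        hh : O 1 h
        hh = O-neg (O1-X b)
        h≢κ : h ≢ κ
        h≢κ eq = κ-not-multiple b (trans (cong (X b +_) (sym eq)) (-‿inverseʳ _))

      sum-v≈0 : ∀ b → sumTo (suc m) (λ a → v a (X b)) ≈[ 3 ] sumTo (suc m) (λ a → v a (X 0))
      sum-v≈0 b = ≈-trans (sum-v≈κ b) (≈-sym (sum-v≈κ 0))

  -- The quotient p · term(a + p b) / term(b)

  poch-nonzero : ∀ a n → (∀ i → a + ι i ≢ 0#) → poch a n ≢ 0#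
  poch-nonzero a zero    h = 1≢0
  poch-nonzero a (suc n) h = *-nonzero (poch-nonzero a n h) (h n)

  poch-blocks : ∀ c a b → poch c (a ℕ.+ b ℕ.* p) ≡ poch c (b ℕ.* p) * poch (c + X b) a
  poch-blocks c a b = trans (cong (poch c) (ℕₚ.+-comm a (b ℕ.* p))) (poch-+ c (b ℕ.* p) a)

  ½ : K
  ½ = inv (ι 2)

  ½+½ : ½ + ½ ≡ 1#
  ½+½ = trans (solve 1 (λ i → i :+ i := con (ℤ.+ 2) :* i) refl ½) (inv-r (ι≢0 1))

  term : K → K → ℕ → K
  term ρ γ k = poch ½ k * poch (1# - ½) k * poch ρ k * poch (1# - ρ) k
    * inv (poch 1# k * poch 1# k * poch (1# + γ) k * poch (1# - γ) k)

  module Terms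
    (ρ γ : K) (integral-ρ : Integral ρ) (unit-γ : Unit γ) (unit-1-γ : Unit (1# - γ))
    (e fₑ g′ f : ℕ) (e+f≡2m : e ℕ.+ fₑ ≡ m ℕ.+ m) (g+f≡2m : suc g′ ℕ.+ f ≡ m ℕ.+ m)
    (e≤m : e ≤ m) (g≤e : suc g′ ≤ e) (g<m : suc g′ < m)
    (ρ-residue : (π * ρ - ι e ≡ ρ) ⊎ (π * ρ - ι e ≡ 1# - ρ))
    (γ-residue : (π * γ - ι (suc g′) ≡ γ) ⊎ (π * γ - ι (suc g′) ≡ - γ))
    (ρ+b≢0 : ∀ b → ρ + ι b ≢ 0#) (γ+b≢0 : ∀ b → γ + ι b ≢ 0#) (1-γ+b≢0 : ∀ b → 1# - γ + ι b ≢ 0#)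
    where

    module M = PochhammerBlock ½ (integral-inv (unit-ι 2 (s≤s z≤n) 2<p)) m m refl
    module E = PochhammerBlock ρ integral-ρ e fₑ e+f≡2m
    module G = PochhammerBlock γ (integral-self unit-γ) (suc g′) f g+f≡2m

    κ θ : K
    κ = E.κ
    θ = G.κ

    O1-κ : O 1 κ
    O1-κ = E.O1-κ
    O1-θ : O 1 θ
    O1-θ = G.O1-κ

    open Comparison e g′ e≤m g≤e g<m κ θ O1-κ O1-θ
    open RationalSummand e g′ e≤m g≤e κ θ O1-κ O1-θ using (g; e≤2m)

    num den : ℕ → K
    num k = poch ½ k * poch (1# - ½) k * poch ρ k * poch (1# - ρ) k
    den k = poch 1# k * poch 1# k * poch (1# + γ) k * poch (1# - γ) k

    den-nonzero : ∀ k → den k ≢ 0#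
    den-nonzero k = *-nonzero (*-nonzero (*-nonzero k!≢0 k!≢0)
      (poch-nonzero _ k (λ i eq → γ+b≢0 (suc i) (trans (cong (γ +_) (ι-suc i)) (trans (solve 2 (λ γ i → γ :+ (:1 :+ i) := :1 :+ γ :+ i) refl γ (ι i)) eq)))))
      (poch-nonzero _ k 1-γ+b≢0)
      where
      k!≢0 : poch 1# k ≢ 0#
      k!≢0 = poch-nonzero 1# k (λ i eq → ι≢0 i (trans (ι-suc i) eq))

    h₀-m≡½ : h₀ - ι m ≡ ½
    h₀-m≡½ = trans (cong (λ u → u * ½ - ι m) π≡1+2m)
      (trans (solve 2 (λ h m → (:1 :+ (m :+ m)) :* h :- m := h :+ (h :+ h :- :1) :* m) refl ½ (ι m))
        (trans (cong (λ u → ½ + (u - 1#) * ι m) ½+½) (solve 2 (λ h m → h :+ (:1 :- :1) :* m := h) refl ½ (ι m))))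

    reflect : ∀ η n → 1# - (η - ι n) ≡ 1# + ι n - η
    reflect η n = solve 2 (λ η n → :1 :- (η :- n) := :1 :+ n :- η) refl η (ι n)

    ½-pair : ∀ k → poch ½ k * poch (1# - ½) k ≡ poch (h₀ - ι m) k * poch (1# + ι m - h₀) k
    ½-pair k = cong₂ (λ u w → poch u k * poch w k) (sym h₀-m≡½) (trans (cong (λ u → 1# - u) (sym h₀-m≡½)) (reflect h₀ m))

    ρ-pair : ∀ k → poch ρ k * poch (1# - ρ) k ≡ poch (κ - ι e) k * poch (1# + ι e - κ) k
    ρ-pair k = by-residue ρ-residue
      where
      by-residue : (κ - ι e ≡ ρ) ⊎ (κ - ι e ≡ 1# - ρ) → poch ρ k * poch (1# - ρ) k ≡ poch (κ - ι e) k * poch (1# + ι e - κ) k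
      by-residue (inj₁ eq) = cong₂ (λ u w → poch u k * poch w k) (sym eq) (trans (cong (λ u → 1# - u) (sym eq)) (reflect κ e))
      by-residue (inj₂ eq) = trans (*-comm _ _) (cong₂ (λ u w → poch u k * poch w k) (sym eq)
          (trans (trans (solve 1 (λ r → r := :1 :- (:1 :- r)) refl ρ) (cong (λ u → 1# - u) (sym eq))) (reflect κ e)))

    γ-pair : ∀ k → poch (1# + γ) k * poch (1# - γ) k ≡ poch (1# + (θ - ι g)) k * poch (1# + ι g - θ) k
    γ-pair k = by-residue γ-residue
      where
      by-residue : (θ - ι g ≡ γ) ⊎ (θ - ι g ≡ - γ) → poch (1# + γ) k * poch (1# - γ) k ≡ poch (1# + (θ - ι g)) k * poch (1# + ι g - θ) k
      by-residue (inj₁ eq) = cong₂ (λ u w → poch u k * poch w k) (cong (1# +_) (sym eq)) (trans (cong (λ u → 1# - u) (sym eq)) (reflect θ g))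
      by-residue (inj₂ eq) = trans (*-comm _ _) (cong₂ (λ u w → poch u k * poch w k) (cong (1# +_) (sym eq))
          (trans (trans (solve 1 (λ r → :1 :+ r := :1 :- (:- r)) refl γ) (cong (λ u → 1# - u) (sym eq))) (reflect θ g)))

    module Ratio (b : ℕ) where
      x z w : K
      x = X b
      z = x + θ
      w = 1# - γ + ι b

      hx = O1-X b

      hz : O 1 z
      hz = O-+ hx O1-θ

      open FactorialBlock (factorialBlock b)
      open M.Block (M.block b) using () renaming (A to Aₘ; A-unit to Aₘ-unit; product to productₘ)
      open E.Block (E.block b) using () renaming (A to Aₑ; A-unit to Aₑ-unit; product to productₑ)
      open G.Block (G.block b) using () renaming (A to Aᵍ; A-unit to Aᵍ-unit; product to productᵍ)

      z≡ : z ≡ π * (γ + ι b)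
      z≡ = trans (cong (_+ θ) (X≡ b)) (solve 3 (λ b p r → b :* p :+ p :* r := p :* (r :+ b)) refl (ι b) π γ)

      z≢0 : z ≢ 0#
      z≢0 eq = *-nonzero π≢0 (γ+b≢0 b) (trans (sym z≡) eq)

      x-θ+π≡ : x - θ + π ≡ π * w
      x-θ+π≡ = trans (cong (λ u → u - θ + π) (X≡ b)) (solve 3 (λ b p r → b :* p :- p :* r :+ p := p :* (:1 :- r :+ b)) refl (ι b) π γ)

      pairNum : ℕ → ℕ → K → K
      pairNum n a η = poch (x + η - ι n) a * poch (1# + ι n + x - η) a

      -- `gp a` is z / `P a` (see `gp≡`) with the multiple z of p cancelled: only units remain in
      -- its denominator, whether or not z occurs in `P a`.
      s u P top gp : ℕ → K
      s a = square (poch (1# + x) a)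
      u a = poch (1# + ι g + x - θ) a
      P a = poch (z - ι g) (suc a)
      top a = poch (1# + (ι a + x + θ) - ι g) g
      gp a = top a * inv (poch (z - ι g) g) * inv (poch (1# + z) a)

      blockUnit : K
      blockUnit = Aₘ * Aₑ * inv (square B * Aᵍ)

      -- For a < p this is p · term(a + p b) / term(b), by `term-block`, arranged so that `u a` is
      -- the only part of the denominator that can be divisible by p.
      V : ℕ → K
      V a = (θ - ι g) * inv γ * blockUnit * (pairNum m a h₀ * pairNum e a κ) * inv (s a) * inv (u a) * gp a

      poch-z-unit : Unit (poch (z - ι g) g)
      poch-z-unit = poch-unit-- g g ℕₚ.≤-refl (s≤s g≤2m) hz

      gp≡ : ∀ a → a ≤ m ℕ.+ m → z * inv (P a) ≡ gp a
      gp≡ a a≤2m = trans (fraction-≡ P≢0 (*-nonzero (nonzero poch-z-unit) (nonzero unit-a)) (trans rearranged (sym both))) (trans (cong (top a *_) (inv-* _ _)) (sym (*-assoc _ _ _)))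
        where
        unit-a : Unit (poch (1# + z) a)
        unit-a = poch-unit-1+ a a≤2m hz
        both : top a * P a ≡ poch (z - ι g) g * (z * poch (1# + z) a)
        both = begin
          top a * P a ≡⟨ *-comm _ _ ⟩
          P a * top a ≡⟨ cong (λ t → P a * poch t g) (trans (solve 4 (λ a x θ g → :1 :+ (a :+ x :+ θ) :- g := x :+ θ :- g :+ (:1 :+ a)) refl (ι a) x θ (ι g)) (cong (z - ι g +_) (sym (ι-suc a)))) ⟩
          P a * poch (z - ι g + ι (suc a)) g ≡⟨ poch-+ _ (suc a) g ⟨
          poch (z - ι g) (suc a ℕ.+ g) ≡⟨ cong (poch (z - ι g)) (ℕₚ.+-comm (suc a) g) ⟩
          poch (z - ι g) (g ℕ.+ suc a) ≡⟨ poch-+ _ g (suc a) ⟩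
          poch (z - ι g) g * poch (z - ι g + ι g) (suc a) ≡⟨ cong (λ t → poch (z - ι g) g * poch t (suc a)) (solve 2 (λ z g → z :- g :+ g := z) refl z (ι g)) ⟩
          poch (z - ι g) g * poch z (suc a) ≡⟨ cong (poch (z - ι g) g *_) (poch-suc z a) ⟩
          poch (z - ι g) g * (z * poch (1# + z) a) ∎
        P≢0 : P a ≢ 0#
        P≢0 eq = *-nonzero (nonzero poch-z-unit) (*-nonzero z≢0 (nonzero unit-a)) (trans (sym both) (trans (cong (top a *_) eq) (zeroʳ _)))
        rearranged : z * (poch (z - ι g) g * poch (1# + z) a) ≡ poch (z - ι g) g * (z * poch (1# + z) a)
        rearranged = solve 3 (λ z q r → z :* (q :* r) := q :* (z :* r)) refl z (poch (z - ι g) g) (poch (1# + z) a)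

      Q⁴ : K
      Q⁴ = square (square (π^ b))

      num-block : ∀ a → num (a ℕ.+ b ℕ.* p) ≡ Q⁴ * num b * (Aₘ * Aₑ) * (pairNum m a h₀ * pairNum e a κ)
      num-block a = begin
        poch ½ k * poch (1# - ½) k * poch ρ k * poch (1# - ρ) k
          ≡⟨ trans (*-assoc _ _ _) (cong₂ _*_ (trans (½-pair k) (pair m h₀ productₘ)) (trans (ρ-pair k) (pair e κ productₑ))) ⟩
        (q * q * (poch ½ b * poch (1# - ½) b) * Aₘ * pairNum m a h₀) * (q * q * (poch ρ b * poch (1# - ρ) b) * Aₑ * pairNum e a κ)
          ≡⟨ solve 9 (λ q a₁ a₂ a₃ a₄ A B c d → (q :* q :* (a₁ :* a₂) :* A :* c) :* (q :* q :* (a₃ :* a₄) :* B :* d)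
                := (q :* q) :* (q :* q) :* (a₁ :* a₂ :* a₃ :* a₄) :* (A :* B) :* (c :* d)) refl
               q (poch ½ b) (poch (1# - ½) b) (poch ρ b) (poch (1# - ρ) b) Aₘ Aₑ (pairNum m a h₀) (pairNum e a κ) ⟩
        Q⁴ * num b * (Aₘ * Aₑ) * (pairNum m a h₀ * pairNum e a κ) ∎
        where
        k = a ℕ.+ b ℕ.* p
        q = π^ b
        pair : ∀ n η {r} → poch (η - ι n) (b ℕ.* p) * poch (1# + ι n - η) (b ℕ.* p) ≡ r →
          poch (η - ι n) k * poch (1# + ι n - η) k ≡ r * pairNum n a η
        pair n η {r} eq = begin
          poch (η - ι n) k * poch (1# + ι n - η) k ≡⟨ cong₂ _*_ (poch-blocks _ a b) (poch-blocks _ a b) ⟩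
          l₁ * poch (η - ι n + x) a * (l₂ * poch (1# + ι n - η + x) a)
            ≡⟨ solve 4 (λ a b c d → a :* b :* (c :* d) := a :* c :* (b :* d)) refl l₁ (poch (η - ι n + x) a) l₂ (poch (1# + ι n - η + x) a) ⟩
          l₁ * l₂ * (poch (η - ι n + x) a * poch (1# + ι n - η + x) a)
            ≡⟨ cong₂ (λ u v → u * v) eq (cong₂ (λ u v → poch u a * poch v a)
                 (solve 3 (λ x η n → η :- n :+ x := x :+ η :- n) refl x η (ι n)) (solve 3 (λ x η n → :1 :+ n :- η :+ x := :1 :+ n :+ x :- η) refl x η (ι n))) ⟩
          r * pairNum n a η ∎
          where
          l₁ = poch (η - ι n) (b ℕ.* p)
          l₂ = poch (1# + ι n - η) (b ℕ.* p)

      N : ℕ → K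
      N a = γ * (square B * Aᵍ) * s a * u a * P a

      -- Blocks are available for the pair γ, 1 - γ, but the denominator has 1 + γ. The factor θ - g
      -- lengthens the symbol at 1 + θ - g to one starting at θ - g, and z = p (γ + b) lengthens the
      -- symbol of length b at γ, which becomes γ times the one at 1 + γ. The p in z is the one in p
      -- · term(k).
      den-block : ∀ a → den (a ℕ.+ b ℕ.* p) * ((θ - ι g) * z) ≡ π * (den b * (Q⁴ * N a))
      den-block a = begin
        poch 1# k * poch 1# k * poch (1# + γ) k * poch (1# - γ) k * ((θ - ι g) * z)
          ≡⟨ cong (_* ((θ - ι g) * z)) (trans (*-assoc _ _ _) (cong₂ _*_ (cong square (trans (poch-blocks 1# a b) (cong (_* poch (1# + x) a) factorial))) (γ-pair k))) ⟩
        square (q * φ * B * S) * (poch (1# + (θ - ι g)) k * poch (1# + ι g - θ) k) * ((θ - ι g) * z)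
          ≡⟨ solve 5 (λ f a b t z → f :* (a :* b) :* (t :* z) := f :* (t :* a :* b) :* z) refl (square (q * φ * B * S)) (poch (1# + (θ - ι g)) k) (poch (1# + ι g - θ) k) (θ - ι g) z ⟩
        square (q * φ * B * S) * ((θ - ι g) * poch (1# + (θ - ι g)) k * poch (1# + ι g - θ) k) * z
          ≡⟨ cong (λ t → square (q * φ * B * S) * t * z) γ-block ⟩
        square (q * φ * B * S) * (q * q * (poch γ b * poch (1# - γ) b) * Aᵍ * (P a * u a)) * z
          ≡⟨ cong (square (q * φ * B * S) * (q * q * (poch γ b * poch (1# - γ) b) * Aᵍ * (P a * u a)) *_) z≡ ⟩
        square (q * φ * B * S) * (q * q * (poch γ b * poch (1# - γ) b) * Aᵍ * (P a * u a)) * (π * (γ + ι b))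
          ≡⟨ solve 11 (λ q φ B S c c′ A P u p t → (q :* φ :* B :* S) :* (q :* φ :* B :* S) :* (q :* q :* (c :* c′) :* A :* (P :* u)) :* (p :* t)
               := p :* (φ :* φ :* (c :* t) :* c′ :* (q :* q :* (q :* q) :* ((B :* B :* A) :* (S :* S) :* u :* P)))) refl
               q φ B S (poch γ b) (poch (1# - γ) b) Aᵍ (P a) (u a) π (γ + ι b) ⟩
        π * (φ * φ * (poch γ (suc b)) * poch (1# - γ) b * (Q⁴ * (square B * Aᵍ * s a * u a * P a)))
          ≡⟨ cong (λ t → π * (φ * φ * t * poch (1# - γ) b * (Q⁴ * (square B * Aᵍ * s a * u a * P a)))) (poch-suc γ b) ⟩
        π * (φ * φ * (γ * poch (1# + γ) b) * poch (1# - γ) b * (Q⁴ * (square B * Aᵍ * s a * u a * P a)))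
          ≡⟨ solve 9 (λ p φ γ c c′ Q A s r → p :* (φ :* φ :* (γ :* c) :* c′ :* (Q :* (A :* s :* r))) := p :* (φ :* φ :* c :* c′ :* (Q :* (γ :* A :* s :* r)))) refl
               π φ γ (poch (1# + γ) b) (poch (1# - γ) b) Q⁴ (square B * Aᵍ * s a) (u a) (P a) ⟩
        π * (den b * (Q⁴ * (γ * (square B * Aᵍ * s a) * u a * P a)))
          ≡⟨ cong (λ t → π * (den b * (Q⁴ * (t * u a * P a)))) (sym (*-assoc γ (square B * Aᵍ) (s a))) ⟩
        π * (den b * (Q⁴ * N a)) ∎
        where
        k = a ℕ.+ b ℕ.* p
        q = π^ b
        φ = poch 1# b
        S = poch (1# + x) a
        γ-block : (θ - ι g) * poch (1# + (θ - ι g)) k * poch (1# + ι g - θ) k ≡ q * q * (poch γ b * poch (1# - γ) b) * Aᵍ * (P a * u a)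
        γ-block = begin
          (θ - ι g) * poch (1# + (θ - ι g)) k * poch (1# + ι g - θ) k
            ≡⟨ cong₂ _*_ (trans (sym (poch-suc _ k)) (poch-blocks _ (suc a) b)) (poch-blocks _ a b) ⟩
          l₁ * poch (θ - ι g + x) (suc a) * (l₂ * poch (1# + ι g - θ + x) a)
            ≡⟨ solve 4 (λ a b c d → a :* b :* (c :* d) := a :* c :* (b :* d)) refl l₁ (poch (θ - ι g + x) (suc a)) l₂ (poch (1# + ι g - θ + x) a) ⟩
          l₁ * l₂ * (poch (θ - ι g + x) (suc a) * poch (1# + ι g - θ + x) a)
            ≡⟨ cong₂ (λ u v → u * v) productᵍ (cong₂ (λ u v → poch u (suc a) * poch v a)
                 (solve 3 (λ x η n → η :- n :+ x := x :+ η :- n) refl x θ (ι g)) (solve 3 (λ x η n → :1 :+ n :- η :+ x := :1 :+ n :+ x :- η) refl x θ (ι g))) ⟩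
          q * q * (poch γ b * poch (1# - γ) b) * Aᵍ * (P a * u a) ∎
          where
          l₁ = poch (θ - ι g) (b ℕ.* p)
          l₂ = poch (1# + ι g - θ) (b ℕ.* p)

      θ-g-unit : Unit (θ - ι g)
      θ-g-unit = unit-- g (s≤s z≤n) (s≤s g≤2m) O1-θ

      term-block : ∀ a → a ≤ m ℕ.+ m → π * term ρ γ (a ℕ.+ b ℕ.* p) ≡ term ρ γ b * V a
      term-block a a≤2m = begin
        π * (num k * inv (den k)) ≡⟨ *-assoc _ _ _ ⟨
        π * num k * inv (den k)   ≡⟨ fraction-≡ (den-nonzero k) (*-nonzero (den-nonzero b) N≢0) cross ⟩
        num b * R * inv (den b * N a) ≡⟨ cong (num b * R *_) (inv-* _ _) ⟩
        num b * R * (inv (den b) * inv (N a)) ≡⟨ solve 4 (λ a b c d → a :* b :* (c :* d) := a :* c :* (b :* d)) refl (num b) R (inv (den b)) (inv (N a)) ⟩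
        term ρ γ b * (R * inv (N a)) ≡⟨ cong (term ρ γ b *_) R/N ⟩
        term ρ γ b * V a ∎
        where
        k = a ℕ.+ b ℕ.* p
        c = pairNum m a h₀ * pairNum e a κ
        R = Aₘ * Aₑ * c * ((θ - ι g) * z)
        N≢0 : N a ≢ 0#
        N≢0 eq = *-nonzero (den-nonzero k) (*-nonzero (nonzero θ-g-unit) z≢0)
          (trans (den-block a) (trans (cong (λ t → π * (den b * (Q⁴ * t))) eq) (solve 3 (λ p d q → p :* (d :* (q :* :0)) := :0) refl π (den b) Q⁴)))
        cross : π * num k * (den b * N a) ≡ num b * R * den k
        cross = begin
          π * num k * (den b * N a) ≡⟨ cong (λ t → π * t * (den b * N a)) (num-block a) ⟩
          π * (Q⁴ * num b * (Aₘ * Aₑ) * c) * (den b * N a)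
            ≡⟨ solve 7 (λ p Q n A c d N → p :* (Q :* n :* A :* c) :* (d :* N) := n :* A :* c :* (p :* (d :* (Q :* N)))) refl π Q⁴ (num b) (Aₘ * Aₑ) c (den b) (N a) ⟩
          num b * (Aₘ * Aₑ) * c * (π * (den b * (Q⁴ * N a)))
            ≡⟨ cong (num b * (Aₘ * Aₑ) * c *_) (sym (den-block a)) ⟩
          num b * (Aₘ * Aₑ) * c * (den k * ((θ - ι g) * z))
            ≡⟨ solve 5 (λ n A c d t → n :* A :* c :* (d :* t) := n :* (A :* c :* t) :* d) refl (num b) (Aₘ * Aₑ) c (den k) ((θ - ι g) * z) ⟩
          num b * R * den k ∎
        R/N : R * inv (N a) ≡ V a
        R/N = begin
          R * inv (N a)
            ≡⟨ cong (R *_) (trans (inv-* _ _) (cong (_* inv (P a)) (trans (inv-* _ _) (cong (_* inv (u a)) (trans (inv-* _ _) (cong (_* inv (s a)) (inv-* _ _))))))) ⟩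
          Aₘ * Aₑ * c * ((θ - ι g) * z) * (inv γ * inv (square B * Aᵍ) * inv (s a) * inv (u a) * inv (P a))
            ≡⟨ solve 9 (λ A c t z i j s u P → A :* c :* (t :* z) :* (i :* j :* s :* u :* P) := t :* i :* (A :* j) :* c :* s :* u :* (z :* P)) refl
                 (Aₘ * Aₑ) c (θ - ι g) z (inv γ) (inv (square B * Aᵍ)) (inv (s a)) (inv (u a)) (inv (P a)) ⟩
          (θ - ι g) * inv γ * blockUnit * c * inv (s a) * inv (u a) * (z * inv (P a))
            ≡⟨ cong ((θ - ι g) * inv γ * blockUnit * c * inv (s a) * inv (u a) *_) (gp≡ a a≤2m) ⟩
          V a ∎

      integral-below : ∀ n {η} → O 1 η → Integral (x + η - ι n)
      integral-below n hη = integral-- (O⇒integral (O-+ hx hη)) (integral-ι n)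

      integral-above : ∀ n {η} → O 1 η → Integral (1# + ι n + x - η)
      integral-above n hη = integral-- (integral-+ (integral-+ (integral-ι 1) (integral-ι n)) (O⇒integral hx)) (O⇒integral hη)

      pairNum-integral : ∀ n a {η} → O 1 η → Integral (pairNum n a η)
      pairNum-integral n a hη = integral-* (poch-integral a (integral-below n hη)) (poch-integral a (integral-above n hη))

      below-O1 : ∀ n a {η} → n < a → O 1 η → O 1 (poch (x + η - ι n) a)
      below-O1 n a {η} n<a hη = poch-O1 a n n<a (integral-below n hη)
        (subst (O 1) (solve 3 (λ x η n → x :+ η := x :+ η :- n :+ n) refl x η (ι n)) (O-+ hx hη))

      above-O1 : ∀ n n′ a {η} → n ℕ.+ n′ ≡ m ℕ.+ m → n′ < a → O 1 η → O 1 (poch (1# + ι n + x - η) a)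
      above-O1 n n′ a {η} n+n′≡2m n′<a hη = poch-O1 a n′ n′<a (integral-above n hη)
        (subst (O 1) eq (O-+ O1-π (O-- hx hη)))
        where
        eq : π + (x - η) ≡ 1# + ι n + x - η + ι n′
        eq = trans (cong (_+ (x - η)) (trans (ι-suc (m ℕ.+ m)) (cong (1# +_) (trans (cong ι (sym n+n′≡2m)) (ι-+ n n′)))))
          (solve 4 (λ x η n n′ → :1 :+ (n :+ n′) :+ (x :- η) := :1 :+ n :+ x :- η :+ n′) refl x η (ι n) (ι n′))

      module _ (a : ℕ) (a≤2m : a ≤ m ℕ.+ m) where
        s-unit : Unit (s a)
        s-unit = unit-* us us where us = poch-unit-1+ a a≤2m hx

        gp-integral : Integral (gp a)
        gp-integral = integral-* (integral-* (poch-integral g (integral-- (integral-+ (integral-ι 1) (integral-+ (integral-+ (integral-ι a) (O⇒integral hx)) (O⇒integral O1-θ))) (integral-ι g)))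
          (integral-inv poch-z-unit)) (integral-inv (poch-unit-1+ a a≤2m hz))

        prefix : K
        prefix = (θ - ι g) * inv γ * blockUnit

        prefix-integral : Integral prefix
        prefix-integral = integral-* (integral-* (integral-self θ-g-unit) (integral-inv unit-γ))
          (integral-self (unit-* (unit-* Aₘ-unit Aₑ-unit) (unit-inv (unit-* (unit-* B-unit B-unit) Aᵍ-unit))))

        u-unit : g ℕ.+ a ≤ m ℕ.+ m → Unit (u a)
        u-unit g+a≤2m = subst (λ t → Unit (poch t a)) (trans (cong (_+ (x - θ)) (ι-suc g)) (solve 3 (λ g x θ → :1 :+ g :+ (x :- θ) := :1 :+ g :+ x :- θ) refl (ι g) x θ))
          (poch-unit-+ (suc g) a (s≤s z≤n) (s≤s g+a≤2m) (O-- hx O1-θ))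

        pairNum-O1 : m < a → O 2 (pairNum m a h₀)
        pairNum-O1 m<a = O-* (below-O1 m a m<a O1-h₀) (above-O1 m m a refl m<a O1-h₀)

        -- Both symbols of the pair with r₁ = 1/2 have their multiple of p at index m, and the one
        -- starting at κ - e has it at index e ≤ m. The bound on g + a keeps `u a` a unit.
        V-O3 : m < a → g ℕ.+ a ≤ m ℕ.+ m → O 3 (V a)
        V-O3 m<a g+a≤2m = O-*ʳ (O-*ʳ (O-*ʳ (O-*ˡ prefix-integral (O-* (pairNum-O1 m<a)
            (O-*ʳ (below-O1 e a (ℕₚ.≤-<-trans e≤m m<a) O1-κ) (poch-integral a (integral-above e O1-κ)))))
          (integral-inv s-unit)) (integral-inv (u-unit g+a≤2m))) gp-integral

        -- For a ≥ p - g the denominator contains p (1 - γ + b), and the numerator a fourth multiple of p.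
        V*w-O3 : m < a → O 3 (V a * w)
        V*w-O3 m<a with g ℕ.+ a ℕ.≤? m ℕ.+ m
        ... | yes g+a≤2m = O-*ʳ (V-O3 m<a g+a≤2m) (integral-+ (integral-self unit-1-γ) (integral-ι b))
        ... | no g+a≰2m = subst (O 3) eq (O-divide-π (O-*ʳ (O-*ʳ (O-*ʳ (O-*ˡ prefix-integral (O-* (pairNum-O1 m<a)
              (O-* (below-O1 e a (ℕₚ.≤-<-trans e≤m m<a) O1-κ) (above-O1 e fₑ a e+f≡2m fₑ<a O1-κ)))) (integral-inv s-unit))
              gp-integral) (integral-* (integral-inv u₁) (integral-inv u₂))))
          where
          f<a : f < a
          f<a = ℕₚ.+-cancelˡ-< g f a (subst (ℕ._< g ℕ.+ a) (sym g+f≡2m) (ℕₚ.≰⇒> g+a≰2m))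
          -- By g ≤ e, the numerator reaches its fourth multiple of p, at index fₑ, no later than
          -- `u a` reaches its own, at index f.
          fₑ≤f : fₑ ≤ f
          fₑ≤f = ℕₚ.+-cancelˡ-≤ g fₑ f (ℕₚ.≤-trans (ℕₚ.+-monoˡ-≤ fₑ g≤e) (ℕₚ.≤-reflexive (trans e+f≡2m (sym g+f≡2m))))
          fₑ<a : fₑ < a
          fₑ<a = ℕₚ.≤-<-trans fₑ≤f f<a
          r = a ℕ.∸ suc f
          c₁ = poch (1# + ι g + (x - θ)) f
          c₂ = poch (1# + (x - θ + π)) r
          r≤2m : r ≤ m ℕ.+ m
          r≤2m = ℕₚ.≤-trans (ℕₚ.m∸n≤m a (suc f)) a≤2m
          u₁ : Unit c₁
          u₁ = subst (λ t → Unit (poch t f)) (cong (_+ (x - θ)) (ι-suc g)) (poch-unit-+ (suc g) f (s≤s z≤n) (ℕₚ.≤-reflexive (cong suc g+f≡2m)) (O-- hx O1-θ))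
          u₂ : Unit c₂
          u₂ = poch-unit-1+ r r≤2m (O-+ (O-- hx O1-θ) O1-π)
          u≡ : u a ≡ c₁ * (π * w) * c₂
          u≡ = begin
            u a ≡⟨ cong₂ poch (+-assoc (1# + ι g) x (- θ)) (sym (ℕₚ.m+[n∸m]≡n f<a)) ⟩
            poch (1# + ι g + (x - θ)) (suc f ℕ.+ r) ≡⟨ poch-+ _ (suc f) r ⟩
            c₁ * (1# + ι g + (x - θ) + ι f) * poch (1# + ι g + (x - θ) + ι (suc f)) r
              ≡⟨ cong₂ (λ t t′ → c₁ * t * poch t′ r) (trans at-f x-θ+π≡)
                   (trans (cong (1# + ι g + (x - θ) +_) (ι-suc f)) (trans (solve 3 (λ g t f → :1 :+ g :+ t :+ (:1 :+ f) := :1 :+ (:1 :+ g :+ t :+ f)) refl (ι g) (x - θ) (ι f)) (cong (1# +_) at-f))) ⟩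
            c₁ * (π * w) * c₂ ∎
            where
            at-f : 1# + ι g + (x - θ) + ι f ≡ x - θ + π
            at-f = trans (solve 3 (λ g t f → :1 :+ g :+ t :+ f := t :+ (:1 :+ (g :+ f))) refl (ι g) (x - θ) (ι f)) (cong (x - θ +_) (sym G.π≡))
          w≢0 : w ≢ 0#
          w≢0 = 1-γ+b≢0 b
          inv-u : inv (u a) * w ≡ inv c₁ * inv c₂ * inv π
          inv-u = begin
            inv (u a) * w ≡⟨ cong (_* w) (trans (cong inv u≡) (trans (inv-* _ _) (cong (_* inv c₂) (trans (inv-* _ _) (cong (inv c₁ *_) (inv-* _ _)))))) ⟩
            inv c₁ * (inv π * inv w) * inv c₂ * w ≡⟨ solve 5 (λ a b c d e → a :* (b :* c) :* d :* e := a :* d :* b :* (c :* e)) refl (inv c₁) (inv π) (inv w) (inv c₂) w ⟩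
            inv c₁ * inv c₂ * inv π * (inv w * w) ≡⟨ trans (cong (inv c₁ * inv c₂ * inv π *_) (inv-l w≢0)) (*-identityʳ _) ⟩
            inv c₁ * inv c₂ * inv π ∎
          c = pairNum m a h₀ * pairNum e a κ
          eq : prefix * c * inv (s a) * gp a * (inv c₁ * inv c₂) * inv π ≡ V a * w
          eq = begin
            prefix * c * inv (s a) * gp a * (inv c₁ * inv c₂) * inv π
              ≡⟨ *-assoc _ _ _ ⟩
            prefix * c * inv (s a) * gp a * (inv c₁ * inv c₂ * inv π)
              ≡⟨ cong (prefix * c * inv (s a) * gp a *_) (sym inv-u) ⟩
            prefix * c * inv (s a) * gp a * (inv (u a) * w)
              ≡⟨ solve 4 (λ A g u w → A :* g :* (u :* w) := A :* u :* g :* w) refl (prefix * c * inv (s a)) (gp a) (inv (u a)) w ⟩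
            V a * w ∎

    scale : K
    scale = (θ - ι g) * inv γ * (M.constant * E.constant * inv G.constant)

    scale-integral : Integral scale
    scale-integral = integral-* (integral-* (integral-self (unit-- g (s≤s z≤n) (s≤s g≤2m) O1-θ)) (integral-inv unit-γ))
      (integral-* (integral-* (integral-self M.constant-unit) (integral-self E.constant-unit)) (integral-inv G.constant-unit))

    module _ (b : ℕ) where
      open Ratio b
      open FactorialBlock (factorialBlock b)
      open M.Block (M.block b) using () renaming (A≈ to Aₘ≈)
      open E.Block (E.block b) using () renaming (A-unit to Aₑ-unit; A≈ to Aₑ≈)
      open G.Block (G.block b) using () renaming (A-unit to Aᵍ-unit; A≈ to Aᵍ≈)

      -- Numerator and denominator both carry the power 4b of W₀. It cancels, and only the boundary
      -- factors remain.
      blockUnit≈ : blockUnit ≈[ 3 ] M.constant * E.constant * inv G.constant * (M.telescope x * E.telescope x * inv (G.telescope x))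
      blockUnit≈ = ≈-trans (≈-* (integral-self (unit-* Uₘ Uₑ)) (integral-inv (unit-* (unit-* B-unit B-unit) Aᵍ-unit))
          (≈-* (integral-self Uₘ) (integral-self Aₑ-unit) Aₘ≈ Aₑ≈)
          (≈-inv (unit-* (unit-* B-unit B-unit) Aᵍ-unit) (unit-* Q Uᵍ) (≈-* (integral-self Q) (integral-self Aᵍ-unit) (≈-* (integral-self (W₀^-unit b)) (integral-self B-unit) B≈ B≈) Aᵍ≈)))
        (≡⇒≈ (begin
          q * q * (cₘ * tₘ) * (q * q * (cₑ * tₑ)) * inv (q * q * (q * q * (cᵍ * tᵍ)))
            ≡⟨ cong (q * q * (cₘ * tₘ) * (q * q * (cₑ * tₑ)) *_)
                 (trans (cong inv (solve 3 (λ q c t → q :* q :* (q :* q :* (c :* t)) := q :* q :* (q :* q) :* (c :* t)) refl q cᵍ tᵍ))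
                   (trans (inv-* _ _) (cong (inv (q * q * (q * q)) *_) (inv-* _ _)))) ⟩
          q * q * (cₘ * tₘ) * (q * q * (cₑ * tₑ)) * (inv (q * q * (q * q)) * (inv cᵍ * inv tᵍ))
            ≡⟨ solve 8 (λ q cₘ tₘ cₑ tₑ i j k → q :* q :* (cₘ :* tₘ) :* (q :* q :* (cₑ :* tₑ)) :* (i :* (j :* k)) := (q :* q :* (q :* q)) :* i :* (cₘ :* cₑ :* j :* (tₘ :* tₑ :* k))) refl
                 q cₘ tₘ cₑ tₑ (inv (q * q * (q * q))) (inv cᵍ) (inv tᵍ) ⟩
          (q * q * (q * q)) * inv (q * q * (q * q)) * (cₘ * cₑ * inv cᵍ * (tₘ * tₑ * inv tᵍ))
            ≡⟨ trans (cong (_* (cₘ * cₑ * inv cᵍ * (tₘ * tₑ * inv tᵍ))) (inv-r (nonzero (unit-* Q Q)))) (*-identityˡ _) ⟩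
          cₘ * cₑ * inv cᵍ * (tₘ * tₑ * inv tᵍ) ∎))
        where
        q = W₀^ b
        Q : Unit (q * q)
        Q = unit-* (W₀^-unit b) (W₀^-unit b)
        cₘ = M.constant
        cₑ = E.constant
        cᵍ = G.constant
        tₘ = M.telescope x
        tₑ = E.telescope x
        tᵍ = G.telescope x
        Uₘ : Unit (q * q * (cₘ * tₘ))
        Uₘ = unit-* Q (unit-* M.constant-unit (M.telescope-unit hx))
        Uₑ : Unit (q * q * (cₑ * tₑ))
        Uₑ = unit-* Q (unit-* E.constant-unit (E.telescope-unit hx))
        Uᵍ : Unit (q * q * (cᵍ * tᵍ))
        Uᵍ = unit-* Q (unit-* G.constant-unit (G.telescope-unit hx))

      V≈v : ∀ a → a ≤ m → V a ≈[ 3 ] scale * v a x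
      V≈v a a≤m = ≈-trans
        (≡⇒≈ (solve 7 (λ t i B c s u g → t :* i :* B :* c :* s :* u :* g := B :* (t :* i :* c :* s :* u :* g)) refl (θ - ι g) (inv γ) blockUnit c (inv (s a)) (inv (u a)) (gp a)))
        (≈-trans (≈-* iC iR blockUnit≈ ≈-refl) (≡⇒≈ main))
        where
        a≤2m′ = ℕₚ.≤-trans a≤m m≤2m
        c = pairNum m a h₀ * pairNum e a κ
        rest = (θ - ι g) * inv γ * c * inv (s a) * inv (u a) * gp a
        iR : Integral rest
        iR = integral-* (integral-* (integral-* (integral-* (integral-* (integral-self θ-g-unit) (integral-inv unit-γ)) (integral-* (pairNum-integral m a O1-h₀) (pairNum-integral e a O1-κ)))
          (integral-inv (s-unit a a≤2m′))) (integral-inv (u-unit a a≤2m′ (ℕₚ.+-mono-≤ (ℕₚ.<⇒≤ g<m) a≤m)))) (gp-integral a a≤2m′)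
        iC : Integral (M.constant * E.constant * inv G.constant * (M.telescope x * E.telescope x * inv (G.telescope x)))
        iC = integral-* (integral-* (integral-* (integral-self M.constant-unit) (integral-self E.constant-unit)) (integral-inv G.constant-unit))
          (integral-* (integral-* (integral-self (M.telescope-unit hx)) (integral-self (E.telescope-unit hx))) (integral-inv (G.telescope-unit hx)))
        C = M.constant * E.constant * inv G.constant
        qᵍ = poch (z - ι g) g
        iᵍ = poch (1# + (x - θ)) g
        inv-telescope : inv (G.telescope x) ≡ inv iᵍ * qᵍ
        inv-telescope = trans (inv-* _ _) (cong (inv iᵍ *_) (inv-inv (nonzero poch-z-unit)))
        pair≡ : ∀ n η → poch (1# + (x - η)) n * inv (poch (x + η - ι n) n) * pairNum n a η * inv (s a) ≡ pairFactor n a η x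
        pair≡ n η = trans (cong (λ t → poch t n * inv (poch (x + η - ι n) n) * pairNum n a η * inv (s a)) (sym (+-assoc 1# x (- η))))
          (solve 5 (λ a i b c s → a :* i :* (b :* c) :* s := a :* c :* (b :* i) :* s) refl (poch (1# + x - η) n) (inv (poch (x + η - ι n) n)) (poch (x + η - ι n) a) (poch (1# + ι n + x - η) a) (inv (s a)))
        tₘ = M.telescope x
        tₑ = E.telescope x
        nₘ = pairNum m a h₀
        nₑ = pairNum e a κ
        iz = inv (poch (1# + z) a)
        main : C * (tₘ * tₑ * inv (G.telescope x)) * rest ≡ scale * v a x
        main = begin
          C * (tₘ * tₑ * inv (G.telescope x)) * rest
            ≡⟨ cong (λ t → C * (tₘ * tₑ * t) * rest) inv-telescope ⟩
          C * (tₘ * tₑ * (inv iᵍ * qᵍ)) * ((θ - ι g) * inv γ * (nₘ * nₑ) * inv (s a) * inv (u a) * (top a * inv qᵍ * iz))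
            ≡⟨ cong (λ t → C * (tₘ * tₑ * (inv iᵍ * qᵍ)) * ((θ - ι g) * inv γ * (nₘ * nₑ) * inv (s a) * inv (u a) * t))
                 (solve 3 (λ T r i → T :* r :* i := T :* i :* r) refl (top a) (inv qᵍ) iz) ⟩
          C * (tₘ * tₑ * (inv iᵍ * qᵍ)) * ((θ - ι g) * inv γ * (nₘ * nₑ) * inv (s a) * inv (u a) * (top a * iz * inv qᵍ))
            ≡⟨ solve 12 (λ C tₘ tₑ i q k nₘ nₑ S u T r → C :* (tₘ :* tₑ :* (i :* q)) :* (k :* (nₘ :* nₑ) :* S :* u :* (T :* r))
                 := q :* r :* (k :* C :* (tₘ :* nₘ :* (tₑ :* nₑ :* S) :* (T :* (i :* u))))) refl
                 C tₘ tₑ (inv iᵍ) qᵍ ((θ - ι g) * inv γ) nₘ nₑ (inv (s a)) (inv (u a)) (top a * iz) (inv qᵍ) ⟩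
          qᵍ * inv qᵍ * D
            -- The quotient q/q left over from the γ-pair is traded for s/s: each `pairFactor` needs
            -- its own 1/s, and `denominatorFactor` contains s.
            ≡⟨ cong (_* D) (trans (inv-r (nonzero poch-z-unit)) (sym (inv-r (nonzero (s-unit a a≤2m′))))) ⟩
          s a * inv (s a) * D
            ≡⟨ solve 8 (λ s S k tnₘ tnₑ T i u → s :* S :* (k :* (tnₘ :* (tnₑ :* S) :* (T :* (i :* u)))) := k :* (tnₘ :* S :* (tnₑ :* S) :* (T :* (i :* u) :* s))) refl
                 (s a) (inv (s a)) scale (tₘ * nₘ) (tₑ * nₑ) (top a * iz) (inv iᵍ) (inv (u a)) ⟩
          scale * (tₘ * nₘ * inv (s a) * (tₑ * nₑ * inv (s a)) * (top a * iz * (inv iᵍ * inv (u a)) * s a))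
            ≡⟨ cong₂ (λ y y′ → scale * (y * y′ * (top a * iz * (inv iᵍ * inv (u a)) * s a))) (pair≡ m h₀) (pair≡ e κ) ⟩
          scale * (pairFactor m a h₀ x * pairFactor e a κ x * (top a * iz * (inv iᵍ * inv (u a)) * s a))
            ≡⟨ cong (λ y → scale * (pairFactor m a h₀ x * pairFactor e a κ x * (top a * iz * (inv (poch y g) * inv (u a)) * s a))) (sym (+-assoc 1# x (- θ))) ⟩
          scale * v a x ∎
          where
          D = scale * (tₘ * nₘ * (tₑ * nₑ * inv (s a)) * (top a * iz * (inv iᵍ * inv (u a))))

    -- Integrality along base-p digits, and the summation

    V : ℕ → ℕ → K
    V b a = Ratio.V b a

    ω : ℕ → K
    ω b = 1# - γ + ι b

    ω-integral : ∀ b → Integral (ω b)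
    ω-integral b = integral-+ (integral-self unit-1-γ) (integral-ι b)

    V-integral : ∀ b a → a ≤ m → Integral (V b a)
    V-integral b a a≤m = integral-resp-≈ (V≈v b a a≤m) (integral-* scale-integral (v-integral a a≤m (O1-X b)))

    ωV-integral : ∀ b a → a ≤ m ℕ.+ m → Integral (ω b * V b a)
    ωV-integral b a a≤2m with a ℕ.≤? m
    ... | yes a≤m = integral-* (ω-integral b) (V-integral b a a≤m)
    ... | no a≰m = subst Integral (*-comm _ _) (O⇒integral (Ratio.V*w-O3 b a a≤2m (ℕₚ.≰⇒> a≰m)))

    -- ω (a + b p) is a unit except for one residue a, where its factor p is compensated by V b a.
    ω-step : ∀ b a → a ≤ m ℕ.+ m → Unit (ω (a ℕ.+ b ℕ.* p)) ⊎ Integral (ω b * (V b a * inv (ω (a ℕ.+ b ℕ.* p))))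
    ω-step b a a≤2m = by-residue γ-residue
      where
      open Ratio b using (x; z; hx; hz; z≢0; x-θ+π≡; w; s; u; s-unit; u-unit; prefix; prefix-integral; pairNum; pairNum-integral; poch-z-unit; top; V-O3)
      k = a ℕ.+ b ℕ.* p
      by-residue : (θ - ι g ≡ γ) ⊎ (θ - ι g ≡ - γ) → Unit (ω k) ⊎ Integral (ω b * (V b a * inv (ω k)))
      by-residue (inj₁ θ-g≡γ) with ℕₚ.<-cmp (suc (g ℕ.+ a)) p
      ... | tri< lt _ _ = inj₁ (subst Unit (sym Wk≡) (unit-+ (suc (g ℕ.+ a)) (s≤s z≤n) lt (O-- hx O1-θ)))
        where
        Wk≡ : ω k ≡ ι (suc (g ℕ.+ a)) + (x - θ)
        Wk≡ = trans (cong₂ (λ t t′ → 1# - t + t′) (sym θ-g≡γ) (ι-+ a (b ℕ.* p)))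
          (trans (solve 4 (λ θ g a x → :1 :- (θ :- g) :+ (a :+ x) := :1 :+ (g :+ a) :+ (x :- θ)) refl θ (ι g) (ι a) x)
            (cong (_+ (x - θ)) (sym (trans (ι-suc (g ℕ.+ a)) (cong (1# +_) (ι-+ g a))))))
      -- Here g + a = p - 1, so g < m forces a > m and V b a is divisible by p³. One factor p is
      -- spent on 1 - γ + k = p (1 - γ + b).
      ... | tri≈ _ eq _ = inj₂ (subst Integral (sym value) (O⇒integral (O-divide-π (V-O3 a a≤2m m<a (ℕₚ.≤-reflexive (ℕₚ.suc-injective eq))))))
        where
        m<a : m < a
        m<a = ℕₚ.+-cancelˡ-< m m a (subst (ℕ._< m ℕ.+ a) (ℕₚ.suc-injective eq) (ℕₚ.+-monoˡ-< a g<m))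
        Wk≡ : ω k ≡ π * w
        Wk≡ = begin
          ω k ≡⟨ cong₂ (λ t t′ → 1# - t + t′) (sym θ-g≡γ) (ι-+ a (b ℕ.* p)) ⟩
          1# - (θ - ι g) + (ι a + x) ≡⟨ solve 4 (λ θ g a x → :1 :- (θ :- g) :+ (a :+ x) := x :- θ :+ (:1 :+ (g :+ a))) refl θ (ι g) (ι a) x ⟩
          x - θ + (1# + (ι g + ι a)) ≡⟨ cong (x - θ +_) (trans (cong (1# +_) (sym (ι-+ g a))) (trans (sym (ι-suc (g ℕ.+ a))) (cong ι eq))) ⟩
          x - θ + π ≡⟨ x-θ+π≡ ⟩
          π * w ∎
        value : ω b * (V b a * inv (ω k)) ≡ V b a * inv π
        value = begin
          w * (V b a * inv (ω k)) ≡⟨ cong (λ t → w * (V b a * t)) (trans (cong inv Wk≡) (inv-* _ _)) ⟩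
          w * (V b a * (inv π * inv w)) ≡⟨ solve 4 (λ w V p i → w :* (V :* (p :* i)) := V :* p :* (w :* i)) refl w (V b a) (inv π) (inv w) ⟩
          V b a * inv π * (w * inv w) ≡⟨ trans (cong (V b a * inv π *_) (inv-r (1-γ+b≢0 b))) (*-identityʳ _) ⟩
          V b a * inv π ∎
      ... | tri> _ _ gt = inj₁ (subst Unit (sym Wk≡) (unit-+ j (ℕₚ.m<n⇒0<n∸m gt) j<p (O-+ (O-- hx O1-θ) O1-π)))
        where
        j = suc (g ℕ.+ a) ℕ.∸ p
        j+p≡ : j ℕ.+ p ≡ suc (g ℕ.+ a)
        j+p≡ = ℕₚ.m∸n+n≡m (ℕₚ.<⇒≤ gt)
        j<p : j < p
        j<p = s≤s (ℕₚ.+-cancelʳ-≤ p j (m ℕ.+ m) (subst (ℕ._≤ (m ℕ.+ m) ℕ.+ p) (sym j+p≡) (ℕₚ.≤-trans (ℕₚ.≤-reflexive (sym (ℕₚ.+-suc g a))) (ℕₚ.+-mono-≤ g≤2m (s≤s a≤2m)))))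
        Wk≡ : ω k ≡ ι j + (x - θ + π)
        Wk≡ = begin
          ω k ≡⟨ cong₂ (λ t t′ → 1# - t + t′) (sym θ-g≡γ) (ι-+ a (b ℕ.* p)) ⟩
          1# - (θ - ι g) + (ι a + x) ≡⟨ solve 4 (λ θ g a x → :1 :- (θ :- g) :+ (a :+ x) := :1 :+ (g :+ a) :+ (x :- θ)) refl θ (ι g) (ι a) x ⟩
          1# + (ι g + ι a) + (x - θ) ≡⟨ cong (_+ (x - θ)) (trans (cong (1# +_) (sym (ι-+ g a))) (trans (sym (ι-suc (g ℕ.+ a))) (trans (cong ι (sym j+p≡)) (ι-+ j p)))) ⟩
          ι j + π + (x - θ) ≡⟨ solve 3 (λ j p t → j :+ p :+ t := j :+ (t :+ p)) refl (ι j) π (x - θ) ⟩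
          ι j + (x - θ + π) ∎
      by-residue (inj₂ θ-g≡-γ) = by-position (ℕₚ.<-cmp (suc a) g)
        where
        Wk≡ : ω k ≡ z + (ι (suc a) - ι g)
        Wk≡ = trans (cong₂ (λ t t′ → 1# + t + t′) (sym θ-g≡-γ) (ι-+ a (b ℕ.* p)))
          (trans (solve 4 (λ θ g a x → :1 :+ (θ :- g) :+ (a :+ x) := x :+ θ :+ (:1 :+ a :- g)) refl θ (ι g) (ι a) x)
            (cong (λ t → z + (t - ι g)) (sym (ι-suc a))))
        by-position : _ → Unit (ω k) ⊎ Integral (ω b * (V b a * inv (ω k)))
        by-position (tri< lt _ _) = inj₁ (subst Unit (sym (trans Wk≡ (trans (solve 3 (λ z a g → z :+ (a :- g) := z :- (g :- a)) refl z (ι (suc a)) (ι g)) (cong (λ t → z - t) (sym (ι-∸ (ℕₚ.<⇒≤ lt)))))))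
          (unit-- (g ℕ.∸ suc a) (ℕₚ.m<n⇒0<n∸m lt) (s≤s (ℕₚ.≤-trans (ℕₚ.m∸n≤m g (suc a)) g≤2m)) hz))
        by-position (tri> _ _ gt) = inj₁ (subst Unit (sym (trans Wk≡ (trans (+-comm _ _) (cong (_+ z) (sym (ι-∸ (ℕₚ.<⇒≤ gt)))))))
          (unit-+ (suc a ℕ.∸ g) (ℕₚ.m<n⇒0<n∸m gt) (s≤s (ℕₚ.≤-trans (ℕₚ.m∸n≤m a g′) a≤2m)) hz))
        by-position (tri≈ _ eq _) = inj₂ (integral-* (ω-integral b) (subst Integral (sym value)
          (integral-* (integral-* (integral-* (integral-* (prefix-integral a a≤2m) (integral-* (pairNum-integral m a O1-h₀) (pairNum-integral e a O1-κ))) (integral-inv (s-unit a a≤2m)))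
            (integral-inv (u-unit a a≤2m (ℕₚ.+-mono-≤ (ℕₚ.<⇒≤ g<m) a≤m)))) integral-tail)))
          where
          a≤m : a ≤ m
          a≤m = ℕₚ.≤-trans (ℕₚ.n≤1+n a) (ℕₚ.≤-trans (ℕₚ.≤-reflexive eq) (ℕₚ.<⇒≤ g<m))
          tail = poch (1# + z) g′ * inv (poch (z - ι g) g) * inv (poch (1# + z) a)
          integral-tail : Integral tail
          integral-tail = integral-* (integral-* (poch-integral g′ (integral-+ (integral-ι 1) (O⇒integral hz))) (integral-inv poch-z-unit))
            (integral-inv (poch-unit-1+ a a≤2m hz))
          c = prefix a a≤2m * (pairNum m a h₀ * pairNum e a κ) * inv (s a) * inv (u a)
          -- For a = g - 1, the element 1 - γ + k is z itself, and z is the first factor of `top a`.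
          top≡ : top a ≡ z * poch (1# + z) g′
          top≡ = trans (cong (λ t → poch t g) (trans (solve 4 (λ a x θ g → :1 :+ (a :+ x :+ θ) :- g := x :+ θ :+ (:1 :+ a) :- g) refl (ι a) x θ (ι g)) (trans (cong (λ t → z + t - ι g) (trans (sym (ι-suc a)) (cong ι eq))) (solve 2 (λ z g → z :+ g :- g := z) refl z (ι g)))))
            (poch-suc z g′)
          value : V b a * inv (ω k) ≡ c * tail
          value = begin
            c * (top a * q * r) * inv (ω k) ≡⟨ cong₂ (λ t t′ → c * (t * q * r) * inv t′) top≡ (trans Wk≡ (trans (cong (λ t → z + (ι t - ι g)) eq) (trans (cong (z +_) (-‿inverseʳ _)) (+-identityʳ z)))) ⟩
            c * (z * y * q * r) * inv z ≡⟨ solve 6 (λ c z y q r i → c :* (z :* y :* q :* r) :* i := c :* (y :* q :* r) :* (z :* i)) refl c z y q r (inv z) ⟩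
            c * tail * (z * inv z) ≡⟨ trans (cong (c * tail *_) (inv-r z≢0)) (*-identityʳ _) ⟩
            c * tail ∎
            where
            q = inv (poch (z - ι g) g)
            r = inv (poch (1# + z) a)
            y = poch (1# + z) g′

    τ : ℕ → K
    τ = term ρ γ

    τ-0 : τ 0 ≡ 1#
    τ-0 = trans (cong₂ _*_ one (trans (cong inv one) inv-1)) (*-identityˡ 1#)
      where
      one : 1# * 1# * 1# * 1# ≡ 1#
      one = solve 0 (:1 :* :1 :* :1 :* :1 := :1) refl

    τ-integral-step : ∀ s b a → a ≤ m ℕ.+ m → Integral (π^ s * (τ b * inv (ω b))) →
      Integral (π^ (suc s) * (τ (a ℕ.+ b ℕ.* p) * inv (ω (a ℕ.+ b ℕ.* p))))
    τ-integral-step s b a a≤2m h = subst Integral (sym eq) (integral-* h (integral-part (ω-step b a a≤2m)))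
      where
      k = a ℕ.+ b ℕ.* p
      integral-part : Unit (ω k) ⊎ Integral (ω b * (V b a * inv (ω k))) → Integral (ω b * (V b a * inv (ω k)))
      integral-part (inj₂ i) = i
      integral-part (inj₁ uk) = subst Integral (*-assoc _ _ _) (integral-* (ωV-integral b a a≤2m) (integral-inv uk))
      eq : π * π^ s * (τ k * inv (ω k)) ≡ π^ s * (τ b * inv (ω b)) * (ω b * (V b a * inv (ω k)))
      eq = begin
        π * π^ s * (τ k * inv (ω k)) ≡⟨ solve 4 (λ p q t i → p :* q :* (t :* i) := q :* (p :* t) :* i) refl π (π^ s) (τ k) (inv (ω k)) ⟩
        π^ s * (π * τ k) * inv (ω k) ≡⟨ cong (λ t → π^ s * t * inv (ω k)) (Ratio.term-block b a a≤2m) ⟩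
        π^ s * (τ b * V b a) * inv (ω k) ≡⟨ *-identityʳ _ ⟨
        π^ s * (τ b * V b a) * inv (ω k) * 1# ≡⟨ cong (π^ s * (τ b * V b a) * inv (ω k) *_) (inv-r (1-γ+b≢0 b)) ⟨
        π^ s * (τ b * V b a) * inv (ω k) * (ω b * inv (ω b))
          ≡⟨ solve 6 (λ q t V i w j → q :* (t :* V) :* i :* (w :* j) := q :* (t :* j) :* (w :* (V :* i))) refl (π^ s) (τ b) (V b a) (inv (ω k)) (ω b) (inv (ω b)) ⟩
        π^ s * (τ b * inv (ω b)) * (ω b * (V b a * inv (ω k))) ∎

    -- The divisor 1 - γ + b strengthens the integrality of p^s term(b) to a statement that passes
    -- through the induction: V b a is known to be integral only after multiplication by 1 - γ + b.
    τ-integral : ∀ s b → b < p ℕ.^ s → Integral (π^ s * (τ b * inv (ω b)))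
    τ-integral zero zero _ = subst Integral (sym (trans (*-identityˡ _) (trans (cong₂ _*_ τ-0 (cong inv (+-identityʳ (1# - γ)))) (*-identityˡ _)))) (integral-inv unit-1-γ)
    τ-integral zero (suc b) (s≤s ())
    τ-integral (suc s) k k<p^1+s = subst (λ k → Integral (π^ (suc s) * (τ k * inv (ω k)))) (sym (ℕ÷.m≡m%n+[m/n]*n k p))
      (τ-integral-step s (k ℕ÷./ p) (k ℕ÷.% p) (ℕₚ.≤-pred (ℕ÷.m%n<n k p))
        (τ-integral s (k ℕ÷./ p) (ℕ÷.m<n*o⇒m/o<n (subst (k <_) (ℕₚ.*-comm p (p ℕ.^ s)) k<p^1+s))))

    V-sum : ℕ → K
    V-sum b = sumTo p (V b)

    small-sum≈ : ∀ b → sumTo (suc m) (V b) ≈[ 3 ] sumTo (suc m) (V 0)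
    small-sum≈ b = ≈-trans (scaled b) (≈-trans (≈-*ˡ scale-integral (sum-v≈0 not-multiple b)) (≈-sym (scaled 0)))
      where
      not-multiple : ∀ b → X b + κ ≢ 0#
      not-multiple b eq = *-nonzero π≢0 (ρ+b≢0 b) (trans (sym (trans (cong (_+ κ) (X≡ b)) (solve 3 (λ b p r → b :* p :+ p :* r := p :* (r :+ b)) refl (ι b) π ρ))) eq)
      scaled : ∀ b → sumTo (suc m) (V b) ≈[ 3 ] scale * sumTo (suc m) (λ a → v a (X b))
      scaled b = ≈-trans (≈-sum (suc m) λ a a≤m → V≈v b a (ℕₚ.≤-pred a≤m)) (≡⇒≈ (sym (sumTo-*ˡ (suc m) scale (λ a → v a (X b)))))

    -- Dividing and multiplying by 1 - γ + b absorbs the only possible denominator of V b a.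
    block-difference : ∀ s b → b < p ℕ.^ s → O 3 (π^ s * (τ b * (V-sum b - V-sum 0)))
    block-difference s b b<p^s = subst (O 3) (sym eq) (O-*ˡ (τ-integral s b b<p^s) ω-difference)
      where
      large : ℕ → K
      large b = sumTo m (λ i → V b (suc m ℕ.+ i))
      split : ∀ b → V-sum b ≡ sumTo (suc m) (V b) + large b
      split b = sumTo-+ (suc m) m (V b)
      1+m+i≤2m : ∀ i → i < m → suc m ℕ.+ i ≤ m ℕ.+ m
      1+m+i≤2m i i<m = ℕₚ.≤-trans (ℕₚ.≤-reflexive (sym (ℕₚ.+-suc m i))) (ℕₚ.+-monoʳ-≤ m i<m)
      ωlarge-O3 : ∀ b → O 3 (ω b * large b)
      ωlarge-O3 b = subst (O 3) (sym (sumTo-*ˡ m (ω b) (λ i → V b (suc m ℕ.+ i))))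
        (O-sum m λ i i<m → subst (O 3) (*-comm _ _) (Ratio.V*w-O3 b (suc m ℕ.+ i) (1+m+i≤2m i i<m) (s≤s (ℕₚ.m≤m+n m i))))
      large0-O3 : O 3 (large 0)
      large0-O3 = subst (O 3) cancel (O-*ˡ (integral-inv unit-1-γ) (ωlarge-O3 0))
        where
        cancel : inv (1# - γ) * (ω 0 * large 0) ≡ large 0
        cancel = trans (cong (λ t → inv (1# - γ) * (t * large 0)) (+-identityʳ (1# - γ))) (trans (sym (*-assoc _ _ _)) (trans (cong (_* large 0) (inv-l (nonzero unit-1-γ))) (*-identityˡ _)))
      ω-difference : O 3 (ω b * (V-sum b - V-sum 0))
      ω-difference = subst (O 3) (trans
          (solve 5 (λ w s s₀ l l₀ → w :* (s :- s₀) :+ (w :* l :- w :* l₀) := w :* ((s :+ l) :- (s₀ :+ l₀))) refl (ω b) (sumTo (suc m) (V b)) (sumTo (suc m) (V 0)) (large b) (large 0))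
          (cong (ω b *_) (sym (cong₂ _-_ (split b) (split 0)))))
        (O-+ (O-*ˡ (ω-integral b) (small-sum≈ b)) (O-- (ωlarge-O3 b) (O-*ˡ (ω-integral b) large0-O3)))
      eq : π^ s * (τ b * (V-sum b - V-sum 0)) ≡ π^ s * (τ b * inv (ω b)) * (ω b * (V-sum b - V-sum 0))
      eq = trans (sym (*-identityʳ _)) (trans (cong (π^ s * (τ b * (V-sum b - V-sum 0)) *_) (sym (inv-r (1-γ+b≢0 b))))
        (solve 5 (λ q t d w j → q :* (t :* d) :* (w :* j) := q :* (t :* j) :* (w :* d)) refl (π^ s) (τ b) (V-sum b - V-sum 0) (ω b) (inv (ω b))))

    first-sum : π * sumTo (p ℕ.^ 1) τ ≡ V-sum 0
    first-sum = begin
      π * sumTo (p ℕ.* 1) τ ≡⟨ cong (λ n → π * sumTo n τ) (ℕₚ.*-identityʳ p) ⟩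
      π * sumTo p τ ≡⟨ sumTo-*ˡ p π τ ⟩
      sumTo p (λ a → π * τ a) ≡⟨ sumTo-cong p (λ a a<p → trans (cong (λ k → π * τ k) (sym (ℕₚ.+-identityʳ a))) (trans (Ratio.term-block 0 a (ℕₚ.≤-pred a<p)) (trans (cong (_* V 0 a) τ-0) (*-identityˡ _)))) ⟩
      V-sum 0 ∎

    next-sum : ∀ s → π^ (suc s) * sumTo (p ℕ.^ suc s) τ ≡ sumTo (p ℕ.^ s) (λ b → π^ s * (τ b * V-sum b))
    next-sum s = begin
      π * π^ s * sumTo (p ℕ.* p ℕ.^ s) τ
        ≡⟨ cong₂ _*_ (*-comm π (π^ s)) (trans (cong (λ n → sumTo n τ) (ℕₚ.*-comm p (p ℕ.^ s))) (sumTo-* (p ℕ.^ s) p τ)) ⟩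
      π^ s * π * sumTo (p ℕ.^ s) (λ b → sumTo p (λ a → τ (a ℕ.+ b ℕ.* p)))
        ≡⟨ sumTo-*ˡ (p ℕ.^ s) _ _ ⟩
      sumTo (p ℕ.^ s) (λ b → π^ s * π * sumTo p (λ a → τ (a ℕ.+ b ℕ.* p)))
        ≡⟨ sumTo-cong (p ℕ.^ s) (λ b _ → trans (*-assoc _ _ _) (cong (π^ s *_) (trans (sumTo-*ˡ p π _)
             (trans (sumTo-cong p (λ a a<p → Ratio.term-block b a (ℕₚ.≤-pred a<p))) (sym (sumTo-*ˡ p (τ b) (V b))))))) ⟩
      sumTo (p ℕ.^ s) (λ b → π^ s * (τ b * V-sum b)) ∎

    -- With k = a + p b, the left side is the sum of p^s term(b) · `V-sum b` over b < p^s, while p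
    -- times the first truncated sum is `V-sum 0`. The difference is thus a sum of terms treated in
    -- `block-difference`.
    supercongruence : ∀ s → π^ (suc s) * sumTo (p ℕ.^ suc s) τ ≈[ 3 ] (π^ s * sumTo (p ℕ.^ s) τ) * (π * sumTo (p ℕ.^ 1) τ)
    supercongruence s = subst (O 3) (sym eq) (O-sum (p ℕ.^ s) (block-difference s))
      where
      eq : π^ (suc s) * sumTo (p ℕ.^ suc s) τ - (π^ s * sumTo (p ℕ.^ s) τ) * (π * sumTo (p ℕ.^ 1) τ)
        ≡ sumTo (p ℕ.^ s) (λ b → π^ s * (τ b * (V-sum b - V-sum 0)))
      eq = begin
        π^ (suc s) * sumTo (p ℕ.^ suc s) τ - (π^ s * sumTo (p ℕ.^ s) τ) * (π * sumTo (p ℕ.^ 1) τ)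
          ≡⟨ cong₂ _-_ (next-sum s) (trans (cong (π^ s * sumTo (p ℕ.^ s) τ *_) first-sum)
               (trans (solve 3 (λ q t v → q :* t :* v := q :* v :* t) refl (π^ s) (sumTo (p ℕ.^ s) τ) (V-sum 0)) (sumTo-*ˡ (p ℕ.^ s) (π^ s * V-sum 0) τ))) ⟩
        sumTo (p ℕ.^ s) (λ b → π^ s * (τ b * V-sum b)) - sumTo (p ℕ.^ s) (λ b → π^ s * V-sum 0 * τ b)
          ≡⟨ sumTo-distrib-- (p ℕ.^ s) _ _ ⟩
        sumTo (p ℕ.^ s) (λ b → π^ s * (τ b * V-sum b) - π^ s * V-sum 0 * τ b)
          ≡⟨ sumTo-cong (p ℕ.^ s) (λ b _ → solve 4 (λ q t v v₀ → q :* (t :* v) :- q :* v₀ :* t := q :* (t :* (v :- v₀))) refl (π^ s) (τ b) (V-sum b) (V-sum 0)) ⟩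
        sumTo (p ℕ.^ s) (λ b → π^ s * (τ b * (V-sum b - V-sum 0))) ∎

-- Primes p ≥ 7 are ±1 modulo 2, 3, 4 and 6

PlusMinusOne : ℕ → ℕ → Set
PlusMinusOne p d = (∃ λ q → suc (q ℕ.* d) ≡ p) ⊎ (∃ λ q → suc q ℕ.* d ≡ suc p)

no-divisor : ∀ {p} → Prime p → ∀ d → 2 ≤ d → d < p → ¬ (d ∣ p)
no-divisor p-prime d 2≤d d<p d∣p with prime⇒irreducible p-prime d∣p
... | inj₁ refl = ℕₚ.<-irrefl refl 2≤d
... | inj₂ refl = ℕₚ.<-irrefl refl d<p

module Residues {p : ℕ} (p-prime : Prime p) (7≤p : 7 ≤ p) where
  private
    2∤p : ∀ q → q ℕ.* 2 ≢ p
    2∤p q eq = no-divisor p-prime 2 ℕₚ.≤-refl (ℕₚ.≤-trans (s≤s (s≤s (s≤s z≤n))) 7≤p) (ℕ∣.divides q (sym eq))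

    3∤p : ∀ q → q ℕ.* 3 ≢ p
    3∤p q eq = no-divisor p-prime 3 (s≤s (s≤s z≤n)) (ℕₚ.≤-trans (s≤s (s≤s (s≤s (s≤s z≤n)))) 7≤p) (ℕ∣.divides q (sym eq))

    even-remainder : ∀ r q d → r ℕ.* 2 ℕ.+ q ℕ.* (d ℕ.* 2) ≢ p
    even-remainder r q d eq = 2∤p (r ℕ.+ q ℕ.* d) (trans (ℕₚ.*-distribʳ-+ 2 r (q ℕ.* d)) (trans (cong (r ℕ.* 2 ℕ.+_) (ℕₚ.*-assoc q d 2)) eq))

    decompose : ∀ d .{{_ : ℕ.NonZero d}} → ∃ λ r → r < d × ∃ λ q → p ≡ r ℕ.+ q ℕ.* d
    decompose d = p ℕ÷.% d , ℕ÷.m%n<n p d , p ℕ÷./ d , ℕ÷.m≡m%n+[m/n]*n p d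

  mod2 : ∃ λ q → suc (q ℕ.* 2) ≡ p
  mod2 with decompose 2
  ... | 0 , _ , q , eq = ⊥-elim (2∤p q (sym eq))
  ... | 1 , _ , q , eq = q , sym eq
  ... | suc (suc _) , s≤s (s≤s ()) , _

  mod3 : PlusMinusOne p 3
  mod3 with decompose 3
  ... | 0 , _ , q , eq = ⊥-elim (3∤p q (sym eq))
  ... | 1 , _ , q , eq = inj₁ (q , sym eq)
  ... | 2 , _ , q , eq = inj₂ (q , cong suc (sym eq))
  ... | suc (suc (suc _)) , s≤s (s≤s (s≤s ())) , _

  mod4 : PlusMinusOne p 4
  mod4 with decompose 4
  ... | 0 , _ , q , eq = ⊥-elim (even-remainder 0 q 2 (sym eq))
  ... | 1 , _ , q , eq = inj₁ (q , sym eq)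
  ... | 2 , _ , q , eq = ⊥-elim (even-remainder 1 q 2 (sym eq))
  ... | 3 , _ , q , eq = inj₂ (q , cong suc (sym eq))
  ... | suc (suc (suc (suc _))) , s≤s (s≤s (s≤s (s≤s ()))) , _

  mod6 : PlusMinusOne p 6
  mod6 with decompose 6
  ... | 0 , _ , q , eq = ⊥-elim (even-remainder 0 q 3 (sym eq))
  ... | 1 , _ , q , eq = inj₁ (q , sym eq)
  ... | 2 , _ , q , eq = ⊥-elim (even-remainder 1 q 3 (sym eq))
  ... | 3 , _ , q , eq = ⊥-elim (3∤p (1 ℕ.+ q ℕ.* 2) (trans (cong (3 ℕ.+_) (ℕₚ.*-assoc q 2 3)) (sym eq)))
  ... | 4 , _ , q , eq = ⊥-elim (even-remainder 2 q 3 (sym eq))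
  ... | 5 , _ , q , eq = inj₂ (q , cong suc (sym eq))
  ... | suc (suc (suc (suc (suc (suc _))))) , s≤s (s≤s (s≤s (s≤s (s≤s (s≤s ()))))) , _

-- Parameters r₂ = 1/d and γ = 1/d′

module Reciprocals (F : CharZeroField) (m : ℕ) (p-prime : Prime (suc (m ℕ.+ m))) (3≤m : 3 ≤ m) where
  open CharZeroField F
  open FieldAlgebra F
  open Valuation F (suc (m ℕ.+ m)) p-prime
  open OddPrime F m p-prime 3≤m
  open Unit

  *-≡ : ∀ d {x y} → x * ι (suc d) ≡ y * ι (suc d) → x ≡ y
  *-≡ d = *-cancelʳ (ι (suc d)) (ι≢0 d)

  inv-ι* : ∀ d x → x * inv (ι (suc d)) * ι (suc d) ≡ x
  inv-ι* d x = trans (*-assoc _ _ _) (trans (cong (x *_) (inv-l (ι≢0 d))) (*-identityʳ x))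

  reciprocal+ι≢0 : ∀ d b → inv (ι (suc d)) + ι b ≢ 0#
  reciprocal+ι≢0 d b eq = ι≢0 (b ℕ.* suc d) (begin
    ι (suc (b ℕ.* suc d)) ≡⟨ trans (ι-suc _) (cong (1# +_) (ι-* b (suc d))) ⟩
    1# + ι b * ι (suc d) ≡⟨ cong (_+ ι b * ι (suc d)) (inv-l (ι≢0 d)) ⟨
    inv (ι (suc d)) * ι (suc d) + ι b * ι (suc d) ≡⟨ solve 3 (λ i b d → i :* d :+ b :* d := (i :+ b) :* d) refl (inv (ι (suc d))) (ι b) (ι (suc d)) ⟩
    (inv (ι (suc d)) + ι b) * ι (suc d) ≡⟨ cong (_* ι (suc d)) eq ⟩
    0# * ι (suc d) ≡⟨ zeroˡ _ ⟩
    0# ∎)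

  1-reciprocal : ∀ d → 1# - inv (ι (suc d)) ≡ ι d * inv (ι (suc d))
  1-reciprocal d = *-≡ d (begin
    (1# - inv (ι (suc d))) * ι (suc d) ≡⟨ solve 2 (λ i d → (:1 :- i) :* d := d :- i :* d) refl (inv (ι (suc d))) (ι (suc d)) ⟩
    ι (suc d) - inv (ι (suc d)) * ι (suc d) ≡⟨ cong₂ _-_ (ι-suc d) (inv-l (ι≢0 d)) ⟩
    1# + ι d - 1# ≡⟨ solve 1 (λ d → :1 :+ d :- :1 := d) refl (ι d) ⟩
    ι d ≡⟨ inv-ι* d (ι d) ⟨
    ι d * inv (ι (suc d)) * ι (suc d) ∎)

  1-reciprocal+ι≢0 : ∀ d b → 1# - inv (ι (suc (suc d))) + ι b ≢ 0#
  1-reciprocal+ι≢0 d b eq = ι≢0 (d ℕ.+ b ℕ.* suc (suc d)) (begin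
    ι (suc d ℕ.+ b ℕ.* suc (suc d)) ≡⟨ trans (ι-+ (suc d) _) (cong (ι (suc d) +_) (ι-* b _)) ⟩
    ι (suc d) + ι b * ι (suc (suc d)) ≡⟨ cong (_+ ι b * ι (suc (suc d))) (inv-ι* (suc d) (ι (suc d))) ⟨
    ι (suc d) * i * ι (suc (suc d)) + ι b * ι (suc (suc d)) ≡⟨ solve 3 (λ x b d → x :* d :+ b :* d := (x :+ b) :* d) refl (ι (suc d) * i) (ι b) (ι (suc (suc d))) ⟩
    (ι (suc d) * i + ι b) * ι (suc (suc d)) ≡⟨ cong (_* ι (suc (suc d))) (trans (cong (_+ ι b) (sym (1-reciprocal (suc d)))) eq) ⟩
    0# * ι (suc (suc d)) ≡⟨ zeroˡ _ ⟩
    0# ∎)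
    where
    i = inv (ι (suc (suc d)))

  minus-residue : ∀ d q → suc (q ℕ.* suc d) ≡ p → π * inv (ι (suc d)) - ι q ≡ inv (ι (suc d))
  minus-residue d q eq = *-≡ d (begin
    (π * i - ι q) * n ≡⟨ solve 4 (λ p i q n → (p :* i :- q) :* n := p :* (i :* n) :- q :* n) refl π i (ι q) n ⟩
    π * (i * n) - ι q * n ≡⟨ cong₂ (λ s t → s * t - ι q * n) π≡ (inv-l (ι≢0 d)) ⟩
    (1# + ι q * n) * 1# - ι q * n ≡⟨ solve 1 (λ t → (:1 :+ t) :* :1 :- t := :1) refl (ι q * n) ⟩
    1# ≡⟨ inv-l (ι≢0 d) ⟨
    i * n ∎)
    where
    n = ι (suc d)
    i = inv n
    π≡ : π ≡ 1# + ι q * n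
    π≡ = trans (cong ι (sym eq)) (trans (ι-suc _) (cong (1# +_) (ι-* q (suc d))))

  plus-residue : ∀ d q → q ℕ.* suc d ≡ suc p → π * inv (ι (suc d)) - ι q ≡ - inv (ι (suc d))
  plus-residue d q eq = *-≡ d (begin
    (π * i - ι q) * n ≡⟨ solve 4 (λ p i q n → (p :* i :- q) :* n := p :* (i :* n) :- q :* n) refl π i (ι q) n ⟩
    π * (i * n) - ι q * n ≡⟨ cong₂ (λ s t → π * s - t) (inv-l (ι≢0 d)) (trans (sym (ι-* q (suc d))) (trans (cong ι eq) (ι-suc p))) ⟩
    π * 1# - (1# + π) ≡⟨ solve 1 (λ p → p :* :1 :- (:1 :+ p) := :- :1) refl π ⟩
    - 1# ≡⟨ cong -_ (inv-l (ι≢0 d)) ⟨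
    - (i * n) ≡⟨ solve 2 (λ i n → :- (i :* n) := (:- i) :* n) refl i n ⟩
    - i * n ∎)
    where
    n = ι (suc d)
    i = inv n

  module _ (d₀ : ℕ) (pm : PlusMinusOne p (suc (suc d₀))) where
    private
      d : ℕ
      d = suc (suc d₀)

    -- Here e is the integer part of p / d, namely q both for p = q d + 1 and for p = (q + 1) d - 1.
    -- The two bounds record this for the comparison with m and g.
    ρ-witness : ∃ λ e → (π * inv (ι d) - ι e ≡ inv (ι d) ⊎ π * inv (ι d) - ι e ≡ 1# - inv (ι d))
      × e ℕ.* d ≤ m ℕ.+ m × suc p ≤ suc e ℕ.* d
    ρ-witness = by-case pm
      where
      by-case : PlusMinusOne p d → _
      by-case (inj₁ (q , eq)) = q , inj₁ (minus-residue (suc d₀) q eq) , ℕₚ.≤-reflexive (ℕₚ.suc-injective eq) ,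
        ℕₚ.≤-trans (ℕₚ.≤-reflexive (cong suc (sym eq))) (ℕₚ.+-monoˡ-≤ (q ℕ.* d) (s≤s (s≤s z≤n)))
      by-case (inj₂ (q , eq)) = q , inj₂ residue , ℕₚ.≤-pred (ℕₚ.≤-pred (ℕₚ.≤-trans (ℕₚ.+-monoˡ-≤ (q ℕ.* d) (s≤s (s≤s z≤n))) (ℕₚ.≤-reflexive eq))) , ℕₚ.≤-reflexive (sym eq)
        where
        i = inv (ι d)
        residue : π * i - ι q ≡ 1# - i
        residue = begin
          π * i - ι q ≡⟨ solve 3 (λ p i q → p :* i :- q := :1 :+ (p :* i :- (:1 :+ q))) refl π i (ι q) ⟩
          1# + (π * i - (1# + ι q)) ≡⟨ cong (λ t → 1# + (π * i - t)) (ι-suc q) ⟨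
          1# + (π * i - ι (suc q)) ≡⟨ cong (1# +_) (plus-residue (suc d₀) (suc q) eq) ⟩
          1# - i ∎

    -- Here p / d - g has to be ±1/d, so for p ≡ -1 the choice of g is one more than the integer
    -- part of p / d. As p > 1, it is positive.
    γ-witness : ∃ λ g′ → (π * inv (ι d) - ι (suc g′) ≡ inv (ι d) ⊎ π * inv (ι d) - ι (suc g′) ≡ - inv (ι d))
      × suc g′ ℕ.* d ≤ suc p
    γ-witness = by-case pm
      where
      by-case : PlusMinusOne p d → _
      by-case (inj₁ (zero , eq)) = ⊥-elim (ℕₚ.<⇒≢ (ℕₚ.≤-trans (s≤s z≤n) (ℕₚ.≤-trans 3≤m m≤2m)) (ℕₚ.suc-injective eq))
      by-case (inj₁ (suc q , eq)) = q , inj₁ (minus-residue (suc d₀) (suc q) eq) , ℕₚ.≤-trans (ℕₚ.n≤1+n _) (ℕₚ.≤-trans (ℕₚ.≤-reflexive eq) (ℕₚ.n≤1+n _))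
      by-case (inj₂ (q , eq)) = q , inj₂ (plus-residue (suc d₀) (suc q) eq) , ℕₚ.≤-reflexive eq

  reciprocal-supercongruence : ∀ d₀ d₁ → d₀ < d₁ → suc (suc d₁) < p → PlusMinusOne p (suc (suc d₀)) → PlusMinusOne p (suc (suc d₁)) → ∀ s →
    let τ = term (inv (ι (suc (suc d₀)))) (inv (ι (suc (suc d₁)))) in
    π^ (suc s) * sumTo (p ℕ.^ suc s) τ ≈[ 3 ] (π^ s * sumTo (p ℕ.^ s) τ) * (π * sumTo (p ℕ.^ 1) τ)
  reciprocal-supercongruence d₀ d₁ d₀<d₁ d<p pm₀ pm₁ with ρ-witness d₀ pm₀ | γ-witness d₁ pm₁
  ... | e , ρ-residue , ed≤2m , p<[e+1]d | g′ , γ-residue , gd≤p+1 =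
    Terms.supercongruence (inv (ι d)) (inv (ι d′)) (integral-inv (unit-ι d (s≤s z≤n) (ℕₚ.<-trans (s≤s (s≤s d₀<d₁)) d<p)))
      (unit-inv unit-d′) (subst Unit (sym (1-reciprocal (suc d₁))) (unit-* (unit-ι (suc d₁) (s≤s z≤n) (ℕₚ.<-trans ℕₚ.≤-refl d<p)) (unit-inv unit-d′)))
      e (m ℕ.+ m ℕ.∸ e) g′ (m ℕ.+ m ℕ.∸ suc g′) (ℕₚ.m+[n∸m]≡n (ℕₚ.≤-trans e≤m m≤2m)) (ℕₚ.m+[n∸m]≡n (ℕₚ.≤-trans (ℕₚ.<⇒≤ g<m) m≤2m))
      e≤m g≤e g<m ρ-residue γ-residue (reciprocal+ι≢0 (suc d₀)) (reciprocal+ι≢0 (suc d₁)) (1-reciprocal+ι≢0 d₁)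
    where
    d d′ : ℕ
    d = suc (suc d₀)
    d′ = suc (suc d₁)
    unit-d′ : Unit (ι d′)
    unit-d′ = unit-ι d′ (s≤s z≤n) d<p
    double : ∀ n → n ℕ.* 2 ≡ n ℕ.+ n
    double n = trans (ℕₚ.*-comm n 2) (cong (n ℕ.+_) (ℕₚ.+-identityʳ n))
    e≤m : e ≤ m
    e≤m = ℕₚ.*-cancelʳ-≤ e m 2 (ℕₚ.≤-trans (ℕₚ.*-monoʳ-≤ e (s≤s (s≤s z≤n))) (ℕₚ.≤-trans ed≤2m (ℕₚ.≤-reflexive (sym (double m)))))
    -- Otherwise g d′ ≥ (e + 1)(d + 1) = (e + 1) d + e + 1 > p + 1.
    g≤e : suc g′ ≤ e
    g≤e = ℕₚ.≮⇒≥ λ e<g → ℕₚ.<⇒≱ (s≤s (ℕₚ.≤-trans p<[e+1]d (ℕₚ.m≤n+m (suc e ℕ.* d) e)))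
      (ℕₚ.≤-trans (ℕₚ.≤-reflexive (sym (ℕₚ.*-suc (suc e) d))) (ℕₚ.≤-trans (ℕₚ.*-mono-≤ e<g (s≤s (s≤s d₀<d₁))) gd≤p+1))
    -- Otherwise 3m ≤ g d′ ≤ p + 1 = 2m + 2, against m ≥ 3; note d′ > d ≥ 2.
    g<m : suc g′ < m
    g<m = ℕₚ.≰⇒> λ m≤g → ℕₚ.<⇒≱ 3≤m (ℕₚ.+-cancelʳ-≤ (m ℕ.+ m) m 2
      (ℕₚ.≤-trans (ℕₚ.≤-reflexive (trans (cong (m ℕ.+_) (sym (double m))) (sym (ℕₚ.*-suc m 2))))
        (ℕₚ.≤-trans (ℕₚ.*-mono-≤ m≤g (s≤s (s≤s (ℕₚ.≤-trans (s≤s z≤n) d₀<d₁)))) gd≤p+1)))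

  π^≡ι : ∀ n → π^ n ≡ ι (p ℕ.^ n)
  π^≡ι zero    = refl
  π^≡ι (suc n) = trans (cong (π *_) (π^≡ι n)) (sym (ι-* p (p ℕ.^ n)))

  O⇒fraction : ∀ {n x} → O n x → Σ ℤ λ a → Σ ℕ λ b → (b ≢ 0) × ¬ (p ∣ b) × x * ι b ≡ ι (p ℕ.^ n) * ⟦ a ⟧
  O⇒fraction {n} (mkO q (integral num den p∤den scaled) refl) = by-sign den p∤den scaled
    where
    positive : ∀ num b → ¬ (p ∣ b) → q * ι b ≡ ⟦ num ⟧ → _
    positive num b p∤b scaled =
      num , b , (λ { refl → p∤b (p ℕ∣.∣0) }) , p∤b , trans (*-assoc _ _ _) (cong₂ _*_ (π^≡ι n) scaled)
    by-sign : ∀ den → ¬ (p ∣ ℤ.∣ den ∣) → q * ⟦ den ⟧ ≡ ⟦ num ⟧ → _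
    by-sign (ℤ.+ b)  p∤b scaled = positive num b p∤b scaled
    by-sign -[1+ b ] p∤b scaled = positive (ℤ.- num) (suc b) p∤b
      (trans (cong (q *_) (⟦⟧-neg -[1+ b ])) (trans (solve 2 (λ q d → q :* (:- d) := :- (q :* d)) refl q ⟦ -[1+ b ] ⟧) (trans (cong -_ scaled) (sym (⟦⟧-neg num)))))

-- Transfer to the rational numbers

open import Defs
open ℚ using (ℚ; 0ℚ; 1ℚ; _*_; _-_; _/_; ≢-nonZero)

-- On unnormalised fractions with denominator 1 the laws of the embedding of ℤ are integer
-- identities, free of gcds; injectivity of `toℚᵘ` carries them back to ℚ.
toℚᵘ-/1 : ∀ i → ℚ.toℚᵘ (i / 1) ℚᵘ.≃ ℚᵘ.mkℚᵘ i 0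
toℚᵘ-/1 i = ℚₚ.toℚᵘ-fromℚᵘ (ℚᵘ.mkℚᵘ i 0)

/1-+ : ∀ i j → (i ℤ.+ j) / 1 ≡ (i / 1) ℚ.+ (j / 1)
/1-+ i j = ℚₚ.toℚᵘ-injective (ℚᵘₚ.≃-trans (toℚᵘ-/1 (i ℤ.+ j)) (ℚᵘₚ.≃-trans
  (ℚᵘ.*≡* (cong (ℤ._* ℤ.+ 1) (sym (cong₂ ℤ._+_ (ℤₚ.*-identityʳ i) (ℤₚ.*-identityʳ j)))))
  (ℚᵘₚ.≃-sym (ℚᵘₚ.≃-trans (ℚₚ.toℚᵘ-homo-+ (i / 1) (j / 1)) (ℚᵘₚ.+-cong (toℚᵘ-/1 i) (toℚᵘ-/1 j))))))

/1-* : ∀ i j → (i ℤ.* j) / 1 ≡ (i / 1) * (j / 1)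
/1-* i j = ℚₚ.toℚᵘ-injective (ℚᵘₚ.≃-trans (toℚᵘ-/1 (i ℤ.* j)) (ℚᵘₚ.≃-sym
  (ℚᵘₚ.≃-trans (ℚₚ.toℚᵘ-homo-* (i / 1) (j / 1)) (ℚᵘₚ.*-cong (toℚᵘ-/1 i) (toℚᵘ-/1 j)))))

/1-neg : ∀ i → (ℤ.- i) / 1 ≡ ℚ.- (i / 1)
/1-neg i = ℚₚ.toℚᵘ-injective (ℚᵘₚ.≃-trans (toℚᵘ-/1 (ℤ.- i)) (ℚᵘₚ.≃-sym
  (ℚᵘₚ.≃-trans (ℚₚ.toℚᵘ-homo‿- (i / 1)) (ℚᵘₚ.-‿cong (toℚᵘ-/1 i)))))

/1≡0 : ∀ i → i / 1 ≡ 0ℚ → i ≡ ℤ.+ 0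
/1≡0 i eq with ℚᵘₚ.≃-trans (ℚᵘₚ.≃-sym (toℚᵘ-/1 i)) (ℚᵘₚ.≃-reflexive (cong ℚ.toℚᵘ eq))
... | ℚᵘ.*≡* e = trans (sym (ℤₚ.*-identityʳ i)) (trans e (ℤₚ.*-zeroˡ (ℤ.+ 1)))

*-divℚ : ∀ x {y} → y ≢ 0ℚ → y * divℚ x y ≡ x
*-divℚ x {y} y≢0 with y ℚₚ.≟ 0ℚ
... | yes y≡0 = ⊥-elim (y≢0 y≡0)
... | no  nz  = begin
  y * (x * ℚ.1/ y)   ≡⟨ cong (y *_) (ℚₚ.*-comm x _) ⟩
  y * (ℚ.1/ y * x)   ≡⟨ ℚₚ.*-assoc y _ x ⟨
  y * ℚ.1/ y * x     ≡⟨ cong (_* x) (ℚₚ.*-inverseʳ y) ⟩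
  1ℚ * x             ≡⟨ ℚₚ.*-identityˡ x ⟩
  x                  ∎
  where
  instance
    nonZero : ℚ.NonZero y
    nonZero = ≢-nonZero nz

divℚ≡*inverse : ∀ x y → divℚ x y ≡ x * divℚ 1ℚ y
divℚ≡*inverse x y with y ℚₚ.≟ 0ℚ
... | yes _ = sym (ℚₚ.*-zeroʳ x)
... | no nz = cong (x *_) (sym (ℚₚ.*-identityˡ _))

-- The value 0 of `divℚ` at a zero divisor is what `inv-0` asks for, so the total division of the
-- statement can serve as the inverse of the abstract field.
ℚ-field : CharZeroField
ℚ-field = record
  { K = ℚ ; _+_ = ℚ._+_ ; _*_ = _*_ ; -_ = ℚ.-_ ; ⟦_⟧ = λ i → i / 1
  ; isCommutativeRing = ℚₚ.+-*-isCommutativeRing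
  ; _≟_ = ℚₚ._≟_ ; inv = divℚ 1ℚ ; inv-0 = refl ; inv-r = *-divℚ 1ℚ
  ; ⟦⟧-+ = /1-+ ; ⟦⟧-* = /1-* ; ⟦⟧-neg = /1-neg ; ⟦⟧≡0 = /1≡0
  }

private
  module A = FieldAlgebra ℚ-field

poch≡ : ∀ a n → poch a n ≡ A.poch a n
poch≡ a zero    = refl
poch≡ a (suc n) = cong (_* (a ℚ.+ ι n)) (poch≡ a n)

sumTo≡ : ∀ n {f f′ : ℕ → ℚ} → (∀ k → f k ≡ f′ k) → sumTo n f ≡ A.sumTo n f′
sumTo≡ zero    eq = refl
sumTo≡ (suc n) eq = cong₂ ℚ._+_ (sumTo≡ n eq) (eq n)

module AtPrime (m : ℕ) (p-prime : Prime (suc (m ℕ.+ m))) (3≤m : 3 ≤ m) where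
  p : ℕ
  p = suc (m ℕ.+ m)

  open OddPrime ℚ-field m p-prime 3≤m using () renaming (term to fieldTerm)

  1/ : ℕ → ℚ
  1/ n = divℚ 1ℚ (ι n)

  module _ (ρ γ q : ℚ) (q≡ : 1ℚ ℚ.+ γ ≡ q) (2-q≡ : 1ℚ - γ ≡ ι 2 - q) where
    term≡ : ∀ k → term (alpha (triple half ρ q)) (beta (triple half ρ q)) k ≡ fieldTerm ρ γ k
    term≡ k = trans (divℚ≡*inverse
        (poch half k * poch (1ℚ - half) k * poch ρ k * poch (1ℚ - ρ) k) (poch 1ℚ k * poch 1ℚ k * poch q k * poch (ι 2 - q) k))
      (cong₂ (λ x y → x * divℚ 1ℚ y)
      (cong₂ _*_ (cong₂ _*_ (cong₂ _*_ (poch≡ half k) (poch≡ (1ℚ - half) k)) (poch≡ ρ k)) (poch≡ (1ℚ - ρ) k))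
      (cong₂ _*_ (cong₂ _*_ (cong₂ _*_ (poch≡ 1ℚ k) (poch≡ 1ℚ k)) (trans (poch≡ q k) (cong (λ a → A.poch a k) (sym q≡)))) (trans (poch≡ (ι 2 - q) k) (cong (λ a → A.poch a k) (sym 2-q≡)))))

  tuple-supercongruence : ∀ d₀ d₁ ρ q → d₀ < d₁ → suc (suc d₁) < p →
    PlusMinusOne p (suc (suc d₀)) → PlusMinusOne p (suc (suc d₁)) →
    1/ (suc (suc d₀)) ≡ ρ → 1ℚ ℚ.+ 1/ (suc (suc d₁)) ≡ q → 1ℚ - 1/ (suc (suc d₁)) ≡ ι 2 - q → ∀ s →
    let t = triple half ρ q in
    ((ι (p ^ suc s) * F p (suc s) (alpha t) (beta t)) ≡[ p ^ 3 ])
      ((ι (p ^ s) * F p s (alpha t) (beta t)) * (ι p * F p 1 (alpha t) (beta t)))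
  tuple-supercongruence d₀ d₁ ρ q d₀<d₁ d<p pm₀ pm₁ refl q≡ 2-q≡ s =
    subst (vAtLeast p 3) (sym (cong₂ _-_ (scaled (suc s)) (cong₂ _*_ (scaled s) (cong (ι p *_) (sum≡ 1)))))
      (O⇒fraction (reciprocal-supercongruence d₀ d₁ d₀<d₁ d<p pm₀ pm₁ s))
    where
    open Reciprocals ℚ-field m p-prime 3≤m
    sum≡ : ∀ s → F p s (alpha (triple half ρ q)) (beta (triple half ρ q)) ≡ A.sumTo (p ^ s) (fieldTerm ρ (1/ (suc (suc d₁))))
    sum≡ s = sumTo≡ (p ^ s) (term≡ ρ (1/ (suc (suc d₁))) q q≡ 2-q≡)
    scaled : ∀ s → ι (p ^ s) * F p s (alpha (triple half ρ q)) (beta (triple half ρ q)) ≡ _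
    scaled s = cong₂ _*_ (sym (π^≡ι s)) (sum≡ s)

theorem1p4 : (p : ℕ) → Prime p → 7 ≤ p → (t : Triple) → t ∈ sixTuples → (s : ℕ) →
    ((ι (p ^ suc s) * F p (suc s) (alpha t) (beta t)) ≡[ p ^ 3 ])
    ((ι (p ^ s) * F p s (alpha t) (beta t)) * (ι p * F p 1 (alpha t) (beta t)))
theorem1p4 p p-prime 7≤p t t∈ s = by-half (Residues.mod2 p-prime 7≤p)
  where
  open Residues p-prime 7≤p
  by-half : (∃ λ q → suc (q ℕ.* 2) ≡ p) → _
  by-half (m , eq) = at m (trans (cong suc (trans (cong (m ℕ.+_) (sym (ℕₚ.+-identityʳ m))) (ℕₚ.*-comm 2 m))) eq)
    where
    at : ∀ m → suc (m ℕ.+ m) ≡ p → _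
    at m refl = by-tuple t∈
      where
      3≤m : 3 ≤ m
      3≤m = ℕₚ.≮⇒≥ λ m<3 → ℕₚ.<⇒≱ (ℕₚ.≤-trans (s≤s (s≤s (ℕₚ.+-mono-≤ (ℕₚ.≤-pred m<3) (ℕₚ.≤-pred m<3)))) (ℕₚ.n≤1+n 6)) 7≤p
      open AtPrime m p-prime 3≤m using (tuple-supercongruence)
      2-residue : PlusMinusOne p 2
      2-residue = inj₁ mod2
      small : ∀ d → d ≤ 6 → d < p
      small d d≤6 = ℕₚ.≤-trans (s≤s d≤6) 7≤p
      3<p = small 3 (s≤s (s≤s (s≤s z≤n)))
      4<p = small 4 (s≤s (s≤s (s≤s (s≤s z≤n))))
      6<p = small 6 ℕₚ.≤-refl
      by-tuple : t ∈ sixTuples → _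
      -- The numeric arguments are d - 2 and d′ - 2 for r₂ = 1/d and q = 1 + 1/d′.
      by-tuple (here refl) = tuple-supercongruence 0 1 half (ℤ.+ 4 / 3) (s≤s z≤n) 3<p 2-residue mod3 refl refl refl s
      by-tuple (there (here refl)) = tuple-supercongruence 0 4 half (ℤ.+ 7 / 6) (s≤s z≤n) 6<p 2-residue mod6 refl refl refl s
      by-tuple (there (there (here refl))) = tuple-supercongruence 1 4 third (ℤ.+ 7 / 6) (s≤s (s≤s z≤n)) 6<p mod3 mod6 refl refl refl s
      by-tuple (there (there (there (here refl)))) = tuple-supercongruence 1 2 third (ℤ.+ 5 / 4) (s≤s (s≤s z≤n)) 4<p mod3 mod4 refl refl refl s
      by-tuple (there (there (there (there (here refl))))) = tuple-supercongruence 2 4 quarter (ℤ.+ 7 / 6) (s≤s (s≤s (s≤s z≤n))) 6<p mod4 mod6 refl refl refl s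
      by-tuple (there (there (there (there (there (here refl)))))) = tuple-supercongruence 0 2 half (ℤ.+ 5 / 4) (s≤s z≤n) 4<p 2-residue mod4 refl refl refl s
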